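{- Let $p>3$ be a prime, $x\in\mathbb Z_p$ and $x'=(x-\langle x\rangle_p)/p$. Then $$\sum_{n=0}^{p-1}(2n+1)(-1)^nV_n(x)\equiv(-1)^{\langle x\rangle_p}p+p^3\big(x'(x'+1)+1\big)E_{p-3}(-x)\pmod{p^4}.$$ Consequently $$\sum_{n=0}^{p-1}(2n+1)\frac{V_n^{(3)}}{(-27)^n}\equiv(-1)^{[p/3]}p+7p^3U_{p-3}\pmod{p^4},\quad\sum_{n=0}^{p-1}(2n+1)\frac{V_n^{(4)}}{(-64)^n}\equiv(-1)^{[p/4]}p+13p^3s_{p-3}\pmod{p^4},$$ $$\sum_{n=0}^{p-1}(2n+1)\frac{V_n^{(6)}}{(-432)^n}\equiv(-1)^{\frac{p-1}2}p+\tfrac{155}9p^3E_{p-3}\pmod{p^4}.$$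
   Context: For real $x$ and integer $k\ge0$, $\binom xk=x(x-1)\cdots(x-k+1)/k!$. $V_n(x)=\sum_{k=0}^n\binom nk\binom{n+k}k(-1)^k\binom xk\binom{ -1-x}k$. $\mathbb Z_p$: rationals with denominator prime to $p$; congruences modulo powers of $p$ are in $\mathbb Z_p$; for $x\in\mathbb Z_p$, $\langle x\rangle_p\in\{0,\ldots,p-1\}$ with $x\equiv\langle x\rangle_p\pmod p$. $[y]$ is the floor. Euler numbers: $E_{2n-1}=0$, $E_0=1$, $E_{2n}=-\sum_{k=1}^n\binom{2n}{2k}E_{2n-2k}$; Euler polynomials $E_n(x)=2^{ -n}\sum_{k=0}^n\binom nk(2x-1)^{n-k}E_k$. $U_{2n-1}=0$, $U_0=1$, $U_{2n}=-2\sum_{k=1}^n\binom{2n}{2k}U_{2n-2k}$. $s_0=1$, $s_n=1-\sum_{k=0}^{n-1}\binom nk2^{2n-1-2k}s_k$ ($n\ge1$). $V_n^{(3)}=27^nV_n(-\tfrac13)$, $V_n^{(4)}=64^nV_n(-\tfrac14)$, $V_n^{(6)}=432^nV_n(-\tfrac16)$. -}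

module Defs where

open import Data.Nat as ℕ using (ℕ; zero; suc; _∸_; _<_)
open import Data.Nat.Divisibility using (_∣_)
open import Data.Nat.DivMod using (_/_; _%_)
open import Data.Nat.Combinatorics using (_C_)
open import Data.Integer as ℤ using (ℤ; +_)
open import Data.Rational as ℚ using (ℚ; ↧ₙ_)
open import Data.List using (List; []; _∷_; _++_)
open import Data.Product using (Σ; _×_)
open import Relation.Binary.PropositionalEquality using (_≡_)
import Data.Nat.Properties
open import Relation.Nullary using (¬_; yes; no)

ΣQ : ℕ → (ℕ → ℚ) → ℚ
ΣQ zero    f = ℚ.0ℚ
ΣQ (suc n) f = ΣQ n f ℚ.+ f n

ΣZ : ℕ → (ℕ → ℤ) → ℤ
ΣZ zero    f = + 0
ΣZ (suc n) f = ΣZ n f ℤ.+ f n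

_^Q_ : ℚ → ℕ → ℚ
q ^Q zero  = ℚ.1ℚ
q ^Q suc n = (q ^Q n) ℚ.* q

ℕ→ℚ : ℕ → ℚ
ℕ→ℚ n = (+ n) ℚ./ 1

ℤ→ℚ : ℤ → ℚ
ℤ→ℚ z = z ℚ./ 1

sgn : ℕ → ℚ
sgn n = (ℚ.- ℚ.1ℚ) ^Q n

binom : ℚ → ℕ → ℚ
binom x zero    = ℚ.1ℚ
binom x (suc k) = binom x k ℚ.* (x ℚ.- ℕ→ℚ k) ℚ.* ((+ 1) ℚ./ suc k)

V : ℕ → ℚ → ℚ
V n x = ΣQ (suc n) λ k →
  ℕ→ℚ (n C k) ℚ.* ℕ→ℚ ((n ℕ.+ k) C k) ℚ.* sgn k
    ℚ.* binom x k ℚ.* binom (ℚ.- ℚ.1ℚ ℚ.- x) k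

-- Course-of-values recursion for integer sequences:
-- seqOf step n = step n (the list of earlier values, read by index).

at : List ℤ → ℕ → ℤ
at []       _       = + 0
at (a ∷ as) zero    = a
at (a ∷ as) (suc i) = at as i

history : ((n : ℕ) → (ℕ → ℤ) → ℤ) → ℕ → List ℤ
history step zero    = []
history step (suc n) = history step n ++ (step n (at (history step n)) ∷ [])

seqOf : ((n : ℕ) → (ℕ → ℤ) → ℤ) → ℕ → ℤ
seqOf step n = step n (at (history step n))

eulerStep : (n : ℕ) → (ℕ → ℤ) → ℤ
eulerStep zero f = + 1
eulerStep (suc m) f with (suc m) % 2 ℕ.≟ 0
... | no _  = + 0
... | yes _ = ℤ.- ΣZ (suc m / 2) λ j →
    let k = suc j in + ((suc m) C (2 ℕ.* k)) ℤ.* f (suc m ∸ 2 ℕ.* k)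

eulerNum : ℕ → ℤ
eulerNum = seqOf eulerStep

UStep : (n : ℕ) → (ℕ → ℤ) → ℤ
UStep zero f = + 1
UStep (suc m) f with (suc m) % 2 ℕ.≟ 0
... | no _  = + 0
... | yes _ = ℤ.- (+ 2 ℤ.* ΣZ (suc m / 2) λ j →
    let k = suc j in + ((suc m) C (2 ℕ.* k)) ℤ.* f (suc m ∸ 2 ℕ.* k))

U : ℕ → ℤ
U = seqOf UStep

sStep : (n : ℕ) → (ℕ → ℤ) → ℤ
sStep zero f = + 1
sStep (suc m) f = + 1 ℤ.- ΣZ (suc m) λ k →
  + ((suc m C k) ℕ.* (2 ℕ.^ (2 ℕ.* suc m ∸ 1 ∸ 2 ℕ.* k))) ℤ.* f k

s : ℕ → ℤ
s = seqOf sStep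

eulerPoly : ℕ → ℚ → ℚ
eulerPoly n x = ((+ 1) ℚ./ (2 ℕ.^ n)) ℚ.* ΣQ (suc n) λ k →
  ℕ→ℚ (n C k) ℚ.* ((ℕ→ℚ 2 ℚ.* x ℚ.- ℚ.1ℚ) ^Q (n ∸ k)) ℚ.* ℤ→ℚ (eulerNum k)
  where
  instance
    nz : ℕ.NonZero (2 ℕ.^ n)
    nz = ℕ.>-nonZero (Data.Nat.Properties.m^n>0 2 n)

InZp : ℕ → ℚ → Set
InZp p q = ¬ (p ∣ ↧ₙ q)

CongZp : ℕ → ℕ → ℚ → ℚ → Set
CongZp p k a b = Σ ℚ λ c → InZp p c × (a ℚ.- b ≡ (ℕ→ℚ p ^Q k) ℚ.* c)

V3 V4 V6 : ℕ → ℚ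
V3 n = (ℕ→ℚ 27 ^Q n) ℚ.* V n ((ℤ.- + 1) ℚ./ 3)
V4 n = (ℕ→ℚ 64 ^Q n) ℚ.* V n ((ℤ.- + 1) ℚ./ 4)
V6 n = (ℕ→ℚ 432 ^Q n) ℚ.* V n ((ℤ.- + 1) ℚ./ 6)

-- 1/n for n ≠ 0 (only used with n = p a prime)
invℕ : ℕ → ℚ
invℕ zero    = ℚ.0ℚ
invℕ (suc n) = (+ 1) ℚ./ suc n

{-# OPTIONS --safe #-}
module Submission where

-- Write h z k = C(z,k) C(−1−z,k) and D n z = ∏_{i=1}^{n} (1 − z²/i²).  Then Vₙ(x) = Σ_{k≤n} h n k · h x k, and summing
-- over n first gives Σ_{n<p} (2n+1)(−1)ⁿVₙ(x) = p T(x) with T(x) = Σ_{k<p} D k p · h x k, so T is needed modulo p³.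
-- Since h z k + h (z−1) k = 2 (D k z − D (k−1) z) and D k p ≡ 1 − p² Σ_{i≤k} 1/i² (mod p³), summation by parts gives
-- z² (T z + T (z−1)) ≡ 2 p² (x′(x′+1) + 1) (mod p³) for z = p x′ + j, 1 ≤ j < p.  By Fermat's theorem the function
-- p² (x′(x′+1) + 1) Eₚ₋₃(−z) satisfies the same recurrence, because Eₚ₋₃(−z) + Eₚ₋₃(1−z) = 2 zᵖ⁻³.  At j = 0 one has
-- Eₚ₋₃(−p x′) ≡ Eₚ₋₃(0) = 0 (mod p), and T ≡ 1 (mod p³) by Wolstenholme's congruences for H₁ = Σ_{k<p} 1/k and
-- H₂ = Σ_{k<p} 1/k².  These come from the same sums: Σ_{k<p} h (−p) k = 1 yields H₁ ≡ p H₂ (mod p²), while k ↔ p − k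
-- yields 2 H₁ ≡ −p H₂ (mod p²).
-- The corollaries are the cases x = −1/3, −1/4, −1/6, where x′(x′+1) does not depend on the residue of p; they use
-- U₂ₙ = 3²ⁿE₂ₙ(1/3), sₙ = 4ⁿEₙ(1/4) and 2·6²ⁿE₂ₙ(1/6) = (1 + 3²ⁿ)E₂ₙ.

open import Defs
open import Data.Nat as ℕ using (ℕ; zero; suc; _<_; _∸_; _/_; s≤s; z≤n)
import Data.Nat.Properties as ℕ
open import Data.Nat.Combinatorics using (_C_; nCk≡nC[n∸k]; nCn≡1; nCk+nC[k+1]≡[n+1]C[k+1]; k>n⇒nCk≡0)
import Data.Nat.Coprimality as Coprimality
open import Data.Nat.Divisibility using (_∣_; divides; ∣⇒≤; ∣-trans; ∣1⇒≡1; n∣m*n)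
open import Data.Nat.DivMod using (_%_; _divMod_; result; m*n/n≡m; m*n%n≡0; [m+kn]%n≡m%n; +-distrib-/-∣ʳ)
open import Data.Nat.Induction using (<-rec)
open import Data.Nat.Primality using (Prime; euclidsLemma; prime⇒irreducible)
open import Data.Fin using (zero; suc)
open import Data.Integer as ℤ using (ℤ; +_)
import Data.Integer.Properties as ℤ
import Data.Integer.Tactic.RingSolver as ℤ-Solver
open import Data.List using (List; []; _∷_; _++_; length)
open import Data.List.Properties using (length-++)
open import Data.Rational as ℚ using (ℚ; mkℚ; fromℚᵘ; ½; _+_; _*_; -_; _-_; 0ℚ; 1ℚ)
import Data.Rational.Properties as ℚ
open import Data.Rational.Unnormalised as ℚᵘ using (mkℚᵘ; *≡*)
import Data.Rational.Unnormalised.Properties as ℚᵘ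
open import Data.Product using (∃; _×_; _,_)
open import Data.Sum using (_⊎_; inj₁; inj₂; [_,_]′)
open import Level using (0ℓ)
open import Relation.Binary using (Setoid)
import Relation.Binary.Reasoning.Setoid as SetoidReasoning
open import Relation.Nullary using (¬_; yes; no; contradiction)
open import Relation.Nullary.Decidable using (dec⇒maybe)
open import Relation.Binary.PropositionalEquality
open import Tactic.RingSolver using (solve-∀)
open import Tactic.RingSolver.Core.AlmostCommutativeRing using (AlmostCommutativeRing; fromCommutativeRing)

-- The obstacle is the factor z²: the recurrence determines T z from T (z-1) only where z is a unit,
-- so every residue class has to be reached from j = 0, and the value there needs the harmonic sums.
-- The two summands of x′(x′+1) + 1 have different origins. Replacing D k p by 1 leaves 2z² D (p-1)
-- z. Among the factors (z-i)(z+i), 1 ≤ i < p, are p x′ (i = j) and p (x′+1) (i = p - j), which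
-- explains p² x′(x′+1). The second-order correction -p² Σ 1/i² contributes the summand 1, as a
-- boundary term of the summation by parts. All congruences are kept as equations with an explicit
-- p-integral quotient, so that they reduce to ring identities.

ℚ-ring : AlmostCommutativeRing 0ℓ 0ℓ
ℚ-ring = fromCommutativeRing ℚ.+-*-commutativeRing λ x → dec⇒maybe (0ℚ ℚ.≟ x)

-- Embeddings of ℕ and ℤ in ℚ

fromℚᵘ-+ : ∀ x y → fromℚᵘ (x ℚᵘ.+ y) ≡ fromℚᵘ x + fromℚᵘ y
fromℚᵘ-+ x y = ℚ.toℚᵘ-injective (ℚᵘ.≃-trans (ℚ.toℚᵘ-fromℚᵘ (x ℚᵘ.+ y))
  (ℚᵘ.≃-sym (ℚᵘ.≃-trans (ℚ.toℚᵘ-homo-+ (fromℚᵘ x) (fromℚᵘ y))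
    (ℚᵘ.+-cong (ℚ.toℚᵘ-fromℚᵘ x) (ℚ.toℚᵘ-fromℚᵘ y)))))

fromℚᵘ-* : ∀ x y → fromℚᵘ (x ℚᵘ.* y) ≡ fromℚᵘ x * fromℚᵘ y
fromℚᵘ-* x y = ℚ.toℚᵘ-injective (ℚᵘ.≃-trans (ℚ.toℚᵘ-fromℚᵘ (x ℚᵘ.* y))
  (ℚᵘ.≃-sym (ℚᵘ.≃-trans (ℚ.toℚᵘ-homo-* (fromℚᵘ x) (fromℚᵘ y))
    (ℚᵘ.*-cong (ℚ.toℚᵘ-fromℚᵘ x) (ℚ.toℚᵘ-fromℚᵘ y)))))

ℤ→ℚ-+ : ∀ a b → ℤ→ℚ (a ℤ.+ b) ≡ ℤ→ℚ a + ℤ→ℚ b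
ℤ→ℚ-+ a b = trans
  (ℚ.fromℚᵘ-cong {mkℚᵘ (a ℤ.+ b) 0} {mkℚᵘ a 0 ℚᵘ.+ mkℚᵘ b 0} (*≡* (eq a b)))
  (fromℚᵘ-+ (mkℚᵘ a 0) (mkℚᵘ b 0))
  where
  eq : ∀ a b → (a ℤ.+ b) ℤ.* + 1 ≡ (a ℤ.* + 1 ℤ.+ b ℤ.* + 1) ℤ.* + 1
  eq = ℤ-Solver.solve-∀

ℤ→ℚ-* : ∀ a b → ℤ→ℚ (a ℤ.* b) ≡ ℤ→ℚ a * ℤ→ℚ b
ℤ→ℚ-* a b = trans
  (ℚ.fromℚᵘ-cong {mkℚᵘ (a ℤ.* b) 0} {mkℚᵘ a 0 ℚᵘ.* mkℚᵘ b 0} (*≡* refl))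
  (fromℚᵘ-* (mkℚᵘ a 0) (mkℚᵘ b 0))

ℤ→ℚ-neg : ∀ a → ℤ→ℚ (ℤ.- a) ≡ - ℤ→ℚ a
ℤ→ℚ-neg a = begin
  ℤ→ℚ (ℤ.- a)                        ≡⟨ add-sub (ℤ→ℚ (ℤ.- a)) (ℤ→ℚ a) ⟩
  (ℤ→ℚ (ℤ.- a) + ℤ→ℚ a) + - ℤ→ℚ a    ≡⟨ cong (_+ - ℤ→ℚ a) (ℤ→ℚ-+ (ℤ.- a) a) ⟨
  ℤ→ℚ (ℤ.- a ℤ.+ a) + - ℤ→ℚ a        ≡⟨ cong (λ z → ℤ→ℚ z + - ℤ→ℚ a) (ℤ.+-inverseˡ a) ⟩
  0ℚ + - ℤ→ℚ a                       ≡⟨ ℚ.+-identityˡ (- ℤ→ℚ a) ⟩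
  - ℤ→ℚ a                            ∎
  where
  open ≡-Reasoning
  add-sub : ∀ x y → x ≡ (x + y) + - y
  add-sub = solve-∀ ℚ-ring

ℕ→ℚ-+ : ∀ m n → ℕ→ℚ (m ℕ.+ n) ≡ ℕ→ℚ m + ℕ→ℚ n
ℕ→ℚ-+ m n = ℤ→ℚ-+ (+ m) (+ n)

ℕ→ℚ-* : ∀ m n → ℕ→ℚ (m ℕ.* n) ≡ ℕ→ℚ m * ℕ→ℚ n
ℕ→ℚ-* m n = trans (cong ℤ→ℚ (ℤ.pos-* m n)) (ℤ→ℚ-* (+ m) (+ n))

ℕ→ℚ-suc : ∀ n → ℕ→ℚ (suc n) ≡ ℕ→ℚ n + 1ℚ
ℕ→ℚ-suc n = trans (cong ℕ→ℚ (ℕ.+-comm 1 n)) (ℕ→ℚ-+ n 1)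

ℕ→ℚ-^ : ∀ m n → ℕ→ℚ (m ℕ.^ n) ≡ ℕ→ℚ m ^Q n
ℕ→ℚ-^ m zero    = refl
ℕ→ℚ-^ m (suc n) = trans (ℕ→ℚ-* m (m ℕ.^ n))
  (trans (ℚ.*-comm (ℕ→ℚ m) _) (cong (_* ℕ→ℚ m) (ℕ→ℚ-^ m n)))

/-*-cancel : ∀ z n → (z ℚ./ suc n) * ℕ→ℚ (suc n) ≡ ℤ→ℚ z
/-*-cancel z n = trans (sym (fromℚᵘ-* (mkℚᵘ z n) (mkℚᵘ (+ suc n) 0)))
  (ℚ.fromℚᵘ-cong {mkℚᵘ z n ℚᵘ.* mkℚᵘ (+ suc n) 0} {mkℚᵘ z 0} (*≡* (begin
    z ℤ.* + suc n ℤ.* + 1             ≡⟨ ℤ.*-identityʳ (z ℤ.* + suc n) ⟩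
    z ℤ.* + suc n                     ≡⟨ cong (λ m → z ℤ.* + m) (sym (ℕ.*-identityʳ (suc n))) ⟩
    z ℤ.* + (suc n ℕ.* 1)             ∎)))
  where open ≡-Reasoning

invℕ-inverse : ∀ n → invℕ (suc n) * ℕ→ℚ (suc n) ≡ 1ℚ
invℕ-inverse n = /-*-cancel (+ 1) n

-- Finite sums, powers and signs

ΣQ-cong : ∀ n {f g : ℕ → ℚ} → (∀ k → k < n → f k ≡ g k) → ΣQ n f ≡ ΣQ n g
ΣQ-cong zero    eq = refl
ΣQ-cong (suc n) eq = cong₂ _+_ (ΣQ-cong n λ k k<n → eq k (ℕ.m<n⇒m<1+n k<n)) (eq n ℕ.≤-refl)

ΣQ-+ : ∀ n (f g : ℕ → ℚ) → ΣQ n (λ k → f k + g k) ≡ ΣQ n f + ΣQ n g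
ΣQ-+ zero    f g = refl
ΣQ-+ (suc n) f g = trans (cong (_+ (f n + g n)) (ΣQ-+ n f g)) (lemma (ΣQ n f) (ΣQ n g) (f n) (g n))
  where
  lemma : ∀ a b c d → (a + b) + (c + d) ≡ (a + c) + (b + d)
  lemma = solve-∀ ℚ-ring

ΣQ-*ˡ : ∀ c n (f : ℕ → ℚ) → ΣQ n (λ k → c * f k) ≡ c * ΣQ n f
ΣQ-*ˡ c zero    f = sym (ℚ.*-zeroʳ c)
ΣQ-*ˡ c (suc n) f = trans (cong (_+ c * f n) (ΣQ-*ˡ c n f)) (sym (ℚ.*-distribˡ-+ c (ΣQ n f) (f n)))

ΣQ-zero : ∀ n {f : ℕ → ℚ} → (∀ k → k < n → f k ≡ 0ℚ) → ΣQ n f ≡ 0ℚ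
ΣQ-zero zero    eq = refl
ΣQ-zero (suc n) eq = cong₂ _+_ (ΣQ-zero n λ k k<n → eq k (ℕ.m<n⇒m<1+n k<n)) (eq n ℕ.≤-refl)

ΣQ-head : ∀ n (f : ℕ → ℚ) → ΣQ (suc n) f ≡ f 0 + ΣQ n (λ k → f (suc k))
ΣQ-head zero    f = trans (ℚ.+-identityˡ (f 0)) (sym (ℚ.+-identityʳ (f 0)))
ΣQ-head (suc n) f = trans (cong (_+ f (suc n)) (ΣQ-head n f)) (ℚ.+-assoc (f 0) _ (f (suc n)))

ΣQ-reverse : ∀ n (f : ℕ → ℚ) → ΣQ (suc n) (λ k → f (n ∸ k)) ≡ ΣQ (suc n) f
ΣQ-reverse zero    f = refl
ΣQ-reverse (suc n) f = begin
  ΣQ (2 ℕ.+ n) (λ k → f (suc n ∸ k))         ≡⟨ ΣQ-head (suc n) (λ k → f (suc n ∸ k)) ⟩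
  f (suc n) + ΣQ (suc n) (λ k → f (n ∸ k))   ≡⟨ cong (_+_ (f (suc n))) (ΣQ-reverse n f) ⟩
  f (suc n) + ΣQ (suc n) f                   ≡⟨ ℚ.+-comm (f (suc n)) (ΣQ (suc n) f) ⟩
  ΣQ (2 ℕ.+ n) f                             ∎
  where open ≡-Reasoning

^Q-+ : ∀ q m n → q ^Q (m ℕ.+ n) ≡ q ^Q m * q ^Q n
^Q-+ q m zero    = trans (cong (q ^Q_) (ℕ.+-identityʳ m)) (sym (ℚ.*-identityʳ (q ^Q m)))
^Q-+ q m (suc n) = trans (cong (q ^Q_) (ℕ.+-suc m n))
  (trans (cong (_* q) (^Q-+ q m n)) (ℚ.*-assoc (q ^Q m) (q ^Q n) q))

^Q-distribʳ-* : ∀ a b n → (a * b) ^Q n ≡ a ^Q n * b ^Q n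
^Q-distribʳ-* a b zero    = refl
^Q-distribʳ-* a b (suc n) = trans (cong (_* (a * b)) (^Q-distribʳ-* a b n)) (lemma (a ^Q n) (b ^Q n) a b)
  where
  lemma : ∀ x y a b → x * y * (a * b) ≡ x * a * (y * b)
  lemma = solve-∀ ℚ-ring

1^Q : ∀ n → 1ℚ ^Q n ≡ 1ℚ
1^Q zero    = refl
1^Q (suc n) = cong (_* 1ℚ) (1^Q n)

sgn-suc : ∀ n → sgn (suc n) ≡ - sgn n
sgn-suc n = lemma (sgn n)
  where
  lemma : ∀ x → x * - 1ℚ ≡ - x
  lemma = solve-∀ ℚ-ring

sgn-square : ∀ n → sgn n * sgn n ≡ 1ℚ
sgn-square n = trans (sym (^Q-distribʳ-* (- 1ℚ) (- 1ℚ) n)) (1^Q n)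

sgn-double : ∀ n → sgn (n ℕ.+ n) ≡ 1ℚ
sgn-double n = trans (^Q-+ (- 1ℚ) n n) (sgn-square n)

-- p-integral rationals and congruences modulo pᵏ

record Integral (p : ℕ) (q : ℚ) : Set where
  constructor integral
  field
    den   : ℕ
    num   : ℤ
    p∤den : ¬ p ∣ den
    eq    : q * ℕ→ℚ den ≡ ℤ→ℚ num

InZp⇒Integral : ∀ {p} q → InZp p q → Integral p q
InZp⇒Integral q@(mkℚ n d _) p∤d = integral (suc d) n p∤d
  (trans (cong (_* ℕ→ℚ (suc d)) (sym (ℚ.fromℚᵘ-toℚᵘ q))) (/-*-cancel n d))

-- An `Integral` witness may be any fraction with denominator prime to p, which makes closure under
-- sums and products immediate. Passing back to lowest terms uses coprimality: the reduced
-- denominator divides every other one.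
Integral⇒InZp : ∀ {p} q → Integral p q → InZp p q
Integral⇒InZp q@(mkℚ n d c) (integral e z p∤e eq) p∣d = p∤e (∣-trans p∣d d∣e)
  where
  open ≡-Reasoning
  n*e≡z*d : n ℤ.* + e ≡ z ℤ.* + suc d
  n*e≡z*d = begin
    n ℤ.* + e                    ≡⟨ ℤ.*-identityʳ (n ℤ.* + e) ⟨
    n ℤ.* + e ℤ.* + 1            ≡⟨ ℚᵘ.drop-*≡* q*e≃z ⟩
    z ℤ.* + (suc d ℕ.* 1)        ≡⟨ cong (λ m → z ℤ.* + m) (ℕ.*-identityʳ (suc d)) ⟩
    z ℤ.* + suc d                ∎
    where
    q*e≃z : mkℚᵘ n d ℚᵘ.* mkℚᵘ (+ e) 0 ℚᵘ.≃ mkℚᵘ z 0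
    q*e≃z = ℚᵘ.≃-trans (ℚᵘ.*-congˡ {mkℚᵘ n d} (ℚᵘ.≃-sym (ℚ.toℚᵘ-fromℚᵘ (mkℚᵘ (+ e) 0))))
      (ℚᵘ.≃-trans (ℚᵘ.≃-sym (ℚ.toℚᵘ-homo-* q (ℕ→ℚ e)))
      (ℚᵘ.≃-trans (ℚ.toℚᵘ-cong eq) (ℚ.toℚᵘ-fromℚᵘ (mkℚᵘ z 0))))
  d∣n*e : suc d ∣ ℤ.∣ n ∣ ℕ.* e
  d∣n*e = divides ℤ.∣ z ∣ (begin
    ℤ.∣ n ∣ ℕ.* e           ≡⟨ ℤ.abs-* n (+ e) ⟨
    ℤ.∣ n ℤ.* + e ∣         ≡⟨ cong ℤ.∣_∣ n*e≡z*d ⟩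
    ℤ.∣ z ℤ.* + suc d ∣     ≡⟨ ℤ.abs-* z (+ suc d) ⟩
    ℤ.∣ z ∣ ℕ.* suc d       ∎)
  d∣e : suc d ∣ e
  d∣e = Coprimality.coprime-divisor (Coprimality.sym (Coprimality.recompute c)) d∣n*e

module Congruence {p : ℕ} (pp : Prime p) where

  open Prime pp using (nontrivial)

  π : ℚ
  π = ℕ→ℚ p

  p∤1 : ¬ p ∣ 1
  p∤1 p∣1 = ℕ.nonTrivial⇒≢1 (∣1⇒≡1 p∣1)

  p∤* : ∀ {m n} → ¬ p ∣ m → ¬ p ∣ n → ¬ p ∣ m ℕ.* n
  p∤* {m} {n} p∤m p∤n p∣mn = [ p∤m , p∤n ]′ (euclidsLemma m n pp p∣mn)

  p∤< : ∀ {n} → 0 < n → n < p → ¬ p ∣ n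
  p∤< {suc n} _ n<p p∣n = ℕ.<⇒≱ n<p (∣⇒≤ p∣n)

  int-ℤ : ∀ z → Integral p (ℤ→ℚ z)
  int-ℤ z = integral 1 z p∤1 (ℚ.*-identityʳ (ℤ→ℚ z))

  int-ℕ : ∀ n → Integral p (ℕ→ℚ n)
  int-ℕ n = int-ℤ (+ n)

  int-1 : Integral p 1ℚ
  int-1 = int-ℕ 1

  int-+ : ∀ {a b} → Integral p a → Integral p b → Integral p (a + b)
  int-+ {a} {b} (integral d z p∤d da) (integral e w p∤e eb) =
    integral (d ℕ.* e) (z ℤ.* + e ℤ.+ w ℤ.* + d) (p∤* p∤d p∤e) (begin
      (a + b) * ℕ→ℚ (d ℕ.* e)                        ≡⟨ cong ((a + b) *_) (ℕ→ℚ-* d e) ⟩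
      (a + b) * (ℕ→ℚ d * ℕ→ℚ e)                      ≡⟨ lemma a b (ℕ→ℚ d) (ℕ→ℚ e) ⟩
      (a * ℕ→ℚ d) * ℕ→ℚ e + (b * ℕ→ℚ e) * ℕ→ℚ d      ≡⟨ cong₂ (λ x y → x * ℕ→ℚ e + y * ℕ→ℚ d) da eb ⟩
      ℤ→ℚ z * ℕ→ℚ e + ℤ→ℚ w * ℕ→ℚ d                  ≡⟨ cong₂ _+_ (ℤ→ℚ-* z (+ e)) (ℤ→ℚ-* w (+ d)) ⟨
      ℤ→ℚ (z ℤ.* + e) + ℤ→ℚ (w ℤ.* + d)              ≡⟨ ℤ→ℚ-+ (z ℤ.* + e) (w ℤ.* + d) ⟨
      ℤ→ℚ (z ℤ.* + e ℤ.+ w ℤ.* + d)                  ∎)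
    where
    open ≡-Reasoning
    lemma : ∀ a b d e → (a + b) * (d * e) ≡ (a * d) * e + (b * e) * d
    lemma = solve-∀ ℚ-ring

  int-* : ∀ {a b} → Integral p a → Integral p b → Integral p (a * b)
  int-* {a} {b} (integral d z p∤d da) (integral e w p∤e eb) =
    integral (d ℕ.* e) (z ℤ.* w) (p∤* p∤d p∤e) (begin
      a * b * ℕ→ℚ (d ℕ.* e)              ≡⟨ cong (a * b *_) (ℕ→ℚ-* d e) ⟩
      a * b * (ℕ→ℚ d * ℕ→ℚ e)            ≡⟨ lemma a b (ℕ→ℚ d) (ℕ→ℚ e) ⟩
      (a * ℕ→ℚ d) * (b * ℕ→ℚ e)          ≡⟨ cong₂ _*_ da eb ⟩
      ℤ→ℚ z * ℤ→ℚ w                      ≡⟨ ℤ→ℚ-* z w ⟨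
      ℤ→ℚ (z ℤ.* w)                      ∎)
    where
    open ≡-Reasoning
    lemma : ∀ a b d e → a * b * (d * e) ≡ (a * d) * (b * e)
    lemma = solve-∀ ℚ-ring

  int-neg : ∀ {a} → Integral p a → Integral p (- a)
  int-neg {a} (integral d z p∤d da) = integral d (ℤ.- z) p∤d
    (trans (sym (ℚ.neg-distribˡ-* a (ℕ→ℚ d))) (trans (cong -_ da) (sym (ℤ→ℚ-neg z))))

  int-sub : ∀ {a b} → Integral p a → Integral p b → Integral p (a - b)
  int-sub ia ib = int-+ ia (int-neg ib)

  int-^ : ∀ {a} n → Integral p a → Integral p (a ^Q n)
  int-^ zero    ia = int-1
  int-^ (suc n) ia = int-* (int-^ n ia) ia

  int-Σ : ∀ n {f} → (∀ k → k < n → Integral p (f k)) → Integral p (ΣQ n f)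
  int-Σ zero    i = int-ℕ 0
  int-Σ (suc n) i = int-+ (int-Σ n λ k k<n → i k (ℕ.m<n⇒m<1+n k<n)) (i n ℕ.≤-refl)

  int-/ : ∀ z n → ¬ p ∣ suc n → Integral p (z ℚ./ suc n)
  int-/ z n p∤n = integral (suc n) z p∤n (/-*-cancel z n)

  int-invℕ : ∀ n → ¬ p ∣ suc n → Integral p (invℕ (suc n))
  int-invℕ = int-/ (+ 1)

  invℕ-p : invℕ p * π ≡ 1ℚ
  invℕ-p = lemma p (ℕ.nonTrivial⇒nonZero p)
    where
    lemma : ∀ n → .(ℕ.NonZero n) → invℕ n * ℕ→ℚ n ≡ 1ℚ
    lemma (suc n) _ = invℕ-inverse n

  infix 4 _≈_[_]

  -- The two sides themselves need not be integral, which is why the product rules ask for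
  -- integrality of factors.
  record _≈_[_] (a b : ℚ) (k : ℕ) : Set where
    constructor congruent
    field
      quotient : ℚ
      int      : Integral p quotient
      equality : a ≡ b + π ^Q k * quotient

  ≈⇒CongZp : ∀ {a b k} → a ≈ b [ k ] → CongZp p k a b
  ≈⇒CongZp {a} {b} {k} (congruent c ic eq) = c , Integral⇒InZp c ic ,
    trans (cong (_- b) eq) (lemma b (π ^Q k * c))
    where
    lemma : ∀ b x → (b + x) - b ≡ x
    lemma = solve-∀ ℚ-ring

  ≈-reflexive : ∀ {a b k} → a ≡ b → a ≈ b [ k ]
  ≈-reflexive {a} {b} {k} refl = congruent 0ℚ (int-ℕ 0) (lemma a (π ^Q k))
    where
    lemma : ∀ a x → a ≡ a + x * 0ℚ
    lemma = solve-∀ ℚ-ring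

  ≈-refl : ∀ {a k} → a ≈ a [ k ]
  ≈-refl = ≈-reflexive refl

  ≈-sym : ∀ {a b k} → a ≈ b [ k ] → b ≈ a [ k ]
  ≈-sym {a} {b} {k} (congruent c ic eq) = congruent (- c) (int-neg ic)
    (trans (lemma b (π ^Q k) c) (cong (_+ π ^Q k * - c) (sym eq)))
    where
    lemma : ∀ b x c → b ≡ (b + x * c) + x * - c
    lemma = solve-∀ ℚ-ring

  ≈-trans : ∀ {a b c k} → a ≈ b [ k ] → b ≈ c [ k ] → a ≈ c [ k ]
  ≈-trans {a} {b} {c} {k} (congruent x ix eq) (congruent y iy eq′) = congruent (y + x) (int-+ iy ix)
    (trans eq (trans (cong (_+ π ^Q k * x) eq′) (lemma c (π ^Q k) x y)))
    where
    lemma : ∀ c z x y → (c + z * y) + z * x ≡ c + z * (y + x)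
    lemma = solve-∀ ℚ-ring

  ≈-setoid : ℕ → Setoid 0ℓ 0ℓ
  ≈-setoid k = record
    { Carrier = ℚ
    ; _≈_ = λ a b → a ≈ b [ k ]
    ; isEquivalence = record { refl = ≈-refl ; sym = ≈-sym ; trans = ≈-trans }
    }

  module ≈-Reasoning (k : ℕ) = SetoidReasoning (≈-setoid k)

  ≈-int : ∀ {a b k} → a ≈ b [ k ] → Integral p b → Integral p a
  ≈-int {k = k} (congruent c ic eq) ib = subst (Integral p) (sym eq) (int-+ ib (int-* (int-^ k (int-ℕ p)) ic))

  ≈-+ : ∀ {a a′ b b′ k} → a ≈ a′ [ k ] → b ≈ b′ [ k ] → a + b ≈ a′ + b′ [ k ]
  ≈-+ {a} {a′} {b} {b′} {k} (congruent x ix eq) (congruent y iy eq′) = congruent (x + y) (int-+ ix iy)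
    (trans (cong₂ _+_ eq eq′) (lemma a′ b′ (π ^Q k) x y))
    where
    lemma : ∀ a b z x y → (a + z * x) + (b + z * y) ≡ (a + b) + z * (x + y)
    lemma = solve-∀ ℚ-ring

  ≈-neg : ∀ {a b k} → a ≈ b [ k ] → - a ≈ - b [ k ]
  ≈-neg {a} {b} {k} (congruent x ix eq) = congruent (- x) (int-neg ix) (trans (cong -_ eq) (lemma b (π ^Q k) x))
    where
    lemma : ∀ b z x → - (b + z * x) ≡ - b + z * - x
    lemma = solve-∀ ℚ-ring

  ≈-sub : ∀ {a a′ b b′ k} → a ≈ a′ [ k ] → b ≈ b′ [ k ] → a - b ≈ a′ - b′ [ k ]
  ≈-sub a≈a′ b≈b′ = ≈-+ a≈a′ (≈-neg b≈b′)

  ≈-*ˡ : ∀ {a b b′ k} → Integral p a → b ≈ b′ [ k ] → a * b ≈ a * b′ [ k ]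
  ≈-*ˡ {a} {b} {b′} {k} ia (congruent x ix eq) = congruent (a * x) (int-* ia ix)
    (trans (cong (a *_) eq) (lemma a b′ (π ^Q k) x))
    where
    lemma : ∀ a b z x → a * (b + z * x) ≡ a * b + z * (a * x)
    lemma = solve-∀ ℚ-ring

  ≈-*ʳ : ∀ {a a′ b k} → Integral p b → a ≈ a′ [ k ] → a * b ≈ a′ * b [ k ]
  ≈-*ʳ {a} {a′} {b} ib a≈a′ = subst₂ (λ x y → x ≈ y [ _ ]) (ℚ.*-comm b a) (ℚ.*-comm b a′) (≈-*ˡ ib a≈a′)

  ≈-* : ∀ {a a′ b b′ k} → Integral p a′ → Integral p b → a ≈ a′ [ k ] → b ≈ b′ [ k ] → a * b ≈ a′ * b′ [ k ]
  ≈-* ia′ ib a≈a′ b≈b′ = ≈-trans (≈-*ʳ ib a≈a′) (≈-*ˡ ia′ b≈b′)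

  ≈-^ : ∀ {a b k} n → Integral p a → Integral p b → a ≈ b [ k ] → a ^Q n ≈ b ^Q n [ k ]
  ≈-^ zero    ia ib a≈b = ≈-refl
  ≈-^ (suc n) ia ib a≈b = ≈-* (int-^ n ib) ia (≈-^ n ia ib a≈b) a≈b

  ≈-Σ : ∀ n {f g k} → (∀ i → i < n → f i ≈ g i [ k ]) → ΣQ n f ≈ ΣQ n g [ k ]
  ≈-Σ zero    eq = ≈-refl
  ≈-Σ (suc n) eq = ≈-+ (≈-Σ n λ i i<n → eq i (ℕ.m<n⇒m<1+n i<n)) (eq n ℕ.≤-refl)

  ≈-weaken : ∀ {a b k} → a ≈ b [ suc k ] → a ≈ b [ k ]
  ≈-weaken {a} {b} {k} (congruent x ix eq) = congruent (π * x) (int-* (int-ℕ p) ix)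
    (trans eq (cong (_+_ b) (ℚ.*-assoc (π ^Q k) π x)))

  ≈-scale : ∀ {a b k} → a ≈ b [ k ] → π * a ≈ π * b [ suc k ]
  ≈-scale {a} {b} {k} (congruent x ix eq) = congruent x ix (trans (cong (π *_) eq) (lemma π b (π ^Q k) x))
    where
    lemma : ∀ π b z x → π * (b + z * x) ≡ π * b + z * π * x
    lemma = solve-∀ ℚ-ring

  -- Costs one power of p; relations between harmonic sums are read off in this way from expansions
  -- in which they occur multiplied by p.
  ≈-unscale : ∀ {a b k} → π * a ≈ π * b [ suc k ] → a ≈ b [ k ]
  ≈-unscale {a} {b} {k} (congruent x ix eq) = congruent x ix (begin
    a                                          ≡⟨ cancel a ⟨
    invℕ p * (π * a)                           ≡⟨ cong (invℕ p *_) (trans eq (lemma π b (π ^Q k) x)) ⟩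
    invℕ p * (π * (b + π ^Q k * x))            ≡⟨ cancel (b + π ^Q k * x) ⟩
    b + π ^Q k * x                             ∎)
    where
    open ≡-Reasoning
    lemma : ∀ π b z x → π * b + z * π * x ≡ π * (b + z * x)
    lemma = solve-∀ ℚ-ring
    cancel : ∀ y → invℕ p * (π * y) ≡ y
    cancel y = trans (sym (ℚ.*-assoc (invℕ p) π y)) (trans (cong (_* y) invℕ-p) (ℚ.*-identityˡ y))

  ≈-cancelˡ : ∀ {u v a b k} → Integral p v → v * u ≡ 1ℚ → u * a ≈ u * b [ k ] → a ≈ b [ k ]
  ≈-cancelˡ {u} {v} {a} {b} iv vu≡1 ua≈ub = subst₂ (λ x y → x ≈ y [ _ ]) (cancel a) (cancel b) (≈-*ˡ iv ua≈ub)
    where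
    cancel : ∀ y → v * (u * y) ≡ y
    cancel y = trans (sym (ℚ.*-assoc v u y)) (trans (cong (_* y) vu≡1) (ℚ.*-identityˡ y))

2ℚ : ℚ
2ℚ = ℕ→ℚ 2

-- Umbral calculus: umbral n a x is (x + A)ⁿ, with Aᵏ read as a k

umbral : ℕ → (ℕ → ℚ) → ℚ → ℚ
umbral zero    a x = a 0
umbral (suc n) a x = umbral n (λ k → x * a k + a (suc k)) x

umbral-cong : ∀ n {a b} x → (∀ k → k ℕ.≤ n → a k ≡ b k) → umbral n a x ≡ umbral n b x
umbral-cong zero    x eq = eq 0 z≤n
umbral-cong (suc n) x eq = umbral-cong n x λ k k≤n →
  cong₂ (λ y z → x * y + z) (eq k (ℕ.m≤n⇒m≤1+n k≤n)) (eq (suc k) (s≤s k≤n))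

umbral-+ : ∀ n a b x → umbral n (λ k → a k + b k) x ≡ umbral n a x + umbral n b x
umbral-+ zero    a b x = refl
umbral-+ (suc n) a b x = trans
  (umbral-cong n x λ k _ → lemma x (a k) (b k) (a (suc k)) (b (suc k)))
  (umbral-+ n (λ k → x * a k + a (suc k)) (λ k → x * b k + b (suc k)) x)
  where
  lemma : ∀ x a b c d → x * (a + b) + (c + d) ≡ (x * a + c) + (x * b + d)
  lemma = solve-∀ ℚ-ring

umbral-* : ∀ n c a x → umbral n (λ k → c * a k) x ≡ c * umbral n a x
umbral-* zero    c a x = refl
umbral-* (suc n) c a x = trans
  (umbral-cong n x λ k _ → lemma x c (a k) (a (suc k)))
  (umbral-* n c (λ k → x * a k + a (suc k)) x)
  where
  lemma : ∀ x c a b → x * (c * a) + c * b ≡ c * (x * a + b)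
  lemma = solve-∀ ℚ-ring

-- The sequence k ↦ (x + A)ᵏ again consists of powers of a symbol, so translations compose (the
-- Appell property). This takes the place of rearranging double binomial sums.
umbral-umbral : ∀ n a x y → umbral n (λ k → umbral k a x) y ≡ umbral n a (x + y)
umbral-umbral zero    a x y = refl
umbral-umbral (suc n) a x y = begin
  umbral n (λ k → y * umbral k a x + umbral k (λ i → x * a i + a (suc i)) x) y
    ≡⟨ umbral-cong n y (λ k _ → step k) ⟩
  umbral n (λ k → umbral k (λ i → (x + y) * a i + a (suc i)) x) y
    ≡⟨ umbral-umbral n (λ i → (x + y) * a i + a (suc i)) x y ⟩
  umbral n (λ i → (x + y) * a i + a (suc i)) (x + y)
    ∎
  where
  open ≡-Reasoning
  lemma : ∀ x y a b → y * a + (x * a + b) ≡ (x + y) * a + b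
  lemma = solve-∀ ℚ-ring
  step : ∀ k → y * umbral k a x + umbral k (λ i → x * a i + a (suc i)) x
             ≡ umbral k (λ i → (x + y) * a i + a (suc i)) x
  step k = begin
    y * umbral k a x + umbral k (λ i → x * a i + a (suc i)) x
      ≡⟨ cong (_+ umbral k (λ i → x * a i + a (suc i)) x) (umbral-* k y a x) ⟨
    umbral k (λ i → y * a i) x + umbral k (λ i → x * a i + a (suc i)) x
      ≡⟨ umbral-+ k (λ i → y * a i) (λ i → x * a i + a (suc i)) x ⟨
    umbral k (λ i → y * a i + (x * a i + a (suc i))) x
      ≡⟨ umbral-cong k x (λ i _ → lemma x y (a i) (a (suc i))) ⟩
    umbral k (λ i → (x + y) * a i + a (suc i)) x
      ∎

umbral-scale : ∀ n c a x → umbral n (λ k → c ^Q k * a k) (c * x) ≡ c ^Q n * umbral n a x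
umbral-scale zero    c a x = refl
umbral-scale (suc n) c a x = begin
  umbral n (λ k → c * x * (c ^Q k * a k) + c ^Q k * c * a (suc k)) (c * x)
    ≡⟨ umbral-cong n (c * x) (λ k _ → lemma c x (c ^Q k) (a k) (a (suc k))) ⟩
  umbral n (λ k → c * (c ^Q k * (x * a k + a (suc k)))) (c * x)
    ≡⟨ umbral-* n c (λ k → c ^Q k * (x * a k + a (suc k))) (c * x) ⟩
  c * umbral n (λ k → c ^Q k * (x * a k + a (suc k))) (c * x)
    ≡⟨ cong (c *_) (umbral-scale n c (λ k → x * a k + a (suc k)) x) ⟩
  c * (c ^Q n * umbral (suc n) a x)
    ≡⟨ lemma′ c (c ^Q n) (umbral (suc n) a x) ⟩
  c ^Q n * c * umbral (suc n) a x
    ∎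
  where
  open ≡-Reasoning
  lemma : ∀ c x y a b → c * x * (y * a) + y * c * b ≡ c * (y * (x * a + b))
  lemma = solve-∀ ℚ-ring
  lemma′ : ∀ c y u → c * (y * u) ≡ y * c * u
  lemma′ = solve-∀ ℚ-ring

umbral-geometric : ∀ n c y x → umbral n (λ k → c * y ^Q k) x ≡ c * (x + y) ^Q n
umbral-geometric zero    c y x = refl
umbral-geometric (suc n) c y x = begin
  umbral n (λ k → x * (c * y ^Q k) + c * (y ^Q k * y)) x
    ≡⟨ umbral-cong n x (λ k _ → lemma x c y (y ^Q k)) ⟩
  umbral n (λ k → c * (x + y) * y ^Q k) x
    ≡⟨ umbral-geometric n (c * (x + y)) y x ⟩
  c * (x + y) * (x + y) ^Q n
    ≡⟨ lemma′ c (x + y) ((x + y) ^Q n) ⟩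
  c * ((x + y) ^Q n * (x + y))
    ∎
  where
  open ≡-Reasoning
  lemma : ∀ x c y z → x * (c * z) + c * (z * y) ≡ c * (x + y) * z
  lemma = solve-∀ ℚ-ring
  lemma′ : ∀ c x z → c * x * z ≡ c * (z * x)
  lemma′ = solve-∀ ℚ-ring

-- The recursive definition suits translation and scaling; the binomial sum is the link to the given
-- recurrences. The induction step is Pascal's rule after shifting half of the sum by one index.
umbral-Σ : ∀ n a x → umbral n a x ≡ ΣQ (suc n) λ k → ℕ→ℚ (n C k) * x ^Q (n ∸ k) * a k
umbral-Σ zero    a x = lemma (a 0)
  where
  lemma : ∀ a → a ≡ 0ℚ + 1ℚ * 1ℚ * a
  lemma = solve-∀ ℚ-ring
umbral-Σ (suc n) a x = begin
  umbral n (λ k → x * a k + a (suc k)) x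
    ≡⟨ umbral-Σ n (λ k → x * a k + a (suc k)) x ⟩
  ΣQ (suc n) (λ k → ℕ→ℚ (n C k) * x ^Q (n ∸ k) * (x * a k + a (suc k)))
    ≡⟨ ΣQ-cong (suc n) (λ k _ → split (ℕ→ℚ (n C k)) (x ^Q (n ∸ k)) x (a k) (a (suc k))) ⟩
  ΣQ (suc n) (λ k → f k + g k)
    ≡⟨ ΣQ-+ (suc n) f g ⟩
  ΣQ (suc n) f + ΣQ (suc n) g
    ≡⟨ cong (_+ ΣQ (suc n) g) (trans (ΣQ-head n f) (cong (_+_ (h 0)) shift)) ⟩
  (h 0 + ΣQ (suc n) f′) + ΣQ (suc n) g
    ≡⟨ ℚ.+-assoc (h 0) (ΣQ (suc n) f′) (ΣQ (suc n) g) ⟩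
  h 0 + (ΣQ (suc n) f′ + ΣQ (suc n) g)
    ≡⟨ cong (λ y → h 0 + y) (trans (sym (ΣQ-+ (suc n) f′ g)) (ΣQ-cong (suc n) λ k _ → pascal k)) ⟩
  h 0 + ΣQ (suc n) (λ k → h (suc k))
    ≡⟨ ΣQ-head (suc n) h ⟨
  ΣQ (2 ℕ.+ n) h
    ∎
  where
  open ≡-Reasoning
  f f′ g h : ℕ → ℚ
  f k = ℕ→ℚ (n C k) * (x ^Q (n ∸ k) * x) * a k
  f′ k = ℕ→ℚ (n C suc k) * x ^Q (n ∸ k) * a (suc k)
  g k = ℕ→ℚ (n C k) * x ^Q (n ∸ k) * a (suc k)
  h k = ℕ→ℚ (suc n C k) * x ^Q (suc n ∸ k) * a k
  split : ∀ c y x a b → c * y * (x * a + b) ≡ c * (y * x) * a + c * y * b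
  split = solve-∀ ℚ-ring
  vanish : ∀ y z → 0ℚ * y * z ≡ 0ℚ
  vanish = solve-∀ ℚ-ring
  shift : ΣQ n (λ k → f (suc k)) ≡ ΣQ (suc n) f′
  shift = begin
    ΣQ n (λ k → f (suc k))
      ≡⟨ ΣQ-cong n (λ k k<n → cong (λ i → ℕ→ℚ (n C suc k) * x ^Q i * a (suc k)) (sym (ℕ.+-∸-assoc 1 k<n))) ⟩
    ΣQ n f′
      ≡⟨ ℚ.+-identityʳ (ΣQ n f′) ⟨
    ΣQ n f′ + 0ℚ
      -- The term k = n is added at no cost because C(n, n+1) = 0.
      ≡⟨ cong (_+_ (ΣQ n f′)) (trans (cong (λ c → ℕ→ℚ c * x ^Q (n ∸ n) * a (suc n)) (k>n⇒nCk≡0 {n} (ℕ.n<1+n n))) (vanish (x ^Q (n ∸ n)) (a (suc n)))) ⟨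
    ΣQ (suc n) f′
      ∎
  pascal : ∀ k → f′ k + g k ≡ h (suc k)
  pascal k = trans
    (lemma (ℕ→ℚ (n C suc k)) (ℕ→ℚ (n C k)) (x ^Q (n ∸ k)) (a (suc k)))
    (cong (λ c → c * x ^Q (n ∸ k) * a (suc k))
      (trans (sym (ℕ→ℚ-+ (n C k) (n C suc k))) (cong ℕ→ℚ (nCk+nC[k+1]≡[n+1]C[k+1] n k))))
    where
    lemma : ∀ c d y a → c * y * a + d * y * a ≡ (d + c) * y * a
    lemma = solve-∀ ℚ-ring

umbral-last : ∀ n a x → umbral n a x ≡ ΣQ n (λ k → ℕ→ℚ (n C k) * x ^Q (n ∸ k) * a k) + a n
umbral-last n a x = trans (umbral-Σ n a x) (cong (_+_ (ΣQ n _))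
  (trans (cong₂ (λ c i → ℕ→ℚ c * x ^Q i * a n) (nCn≡1 n) (ℕ.n∸n≡0 n)) (lemma (a n))))
  where
  lemma : ∀ a → 1ℚ * 1ℚ * a ≡ a
  lemma = solve-∀ ℚ-ring

umbral-Σ-reversed : ∀ n a x → umbral n a x ≡ ΣQ (suc n) λ k → ℕ→ℚ (n C k) * x ^Q k * a (n ∸ k)
umbral-Σ-reversed n a x = begin
  umbral n a x
    ≡⟨ umbral-Σ n a x ⟩
  ΣQ (suc n) (λ k → ℕ→ℚ (n C k) * x ^Q (n ∸ k) * a k)
    ≡⟨ ΣQ-reverse n (λ k → ℕ→ℚ (n C k) * x ^Q (n ∸ k) * a k) ⟨
  ΣQ (suc n) (λ k → ℕ→ℚ (n C (n ∸ k)) * x ^Q (n ∸ (n ∸ k)) * a (n ∸ k))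
    ≡⟨ ΣQ-cong (suc n) (λ k k≤n → cong₂ (λ c i → ℕ→ℚ c * x ^Q i * a (n ∸ k))
         (sym (nCk≡nC[n∸k] (ℕ.s≤s⁻¹ k≤n))) (ℕ.m∸[m∸n]≡n (ℕ.s≤s⁻¹ k≤n))) ⟩
  ΣQ (suc n) (λ k → ℕ→ℚ (n C k) * x ^Q k * a (n ∸ k))
    ∎
  where open ≡-Reasoning

double-injective : ∀ {x y z w} → x + (z + x) ≡ y + (w + y) → z ≡ w → x ≡ y
double-injective {x} {y} {z} eq refl = begin
  x                               ≡⟨ halve x z ⟩
  ½ * ((x + (z + x)) - z)         ≡⟨ cong (λ t → ½ * (t - z)) eq ⟩
  ½ * ((y + (z + y)) - z)         ≡⟨ halve y z ⟨
  y                               ∎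
  where
  open ≡-Reasoning
  halve : ∀ x z → x ≡ ½ * ((x + (z + x)) - z)
  halve = solve-∀ ℚ-ring

-- By `umbral-last` the term of index n occurs with coefficient 2 and all others have smaller index,
-- so strong induction and halving determine the sequence. Closed forms for `sQ` and `eulerQ` are
-- verified this way.
umbral-unique : ∀ c {a b} → (∀ n → a n + umbral n a c ≡ b n + umbral n b c) → ∀ n → a n ≡ b n
umbral-unique c {a} {b} eq = <-rec _ λ n ih → double-injective
  (trans (cong (_+_ (a n)) (sym (umbral-last n a c))) (trans (eq n) (cong (_+_ (b n)) (umbral-last n b c))))
  (ΣQ-cong n λ k k<n → cong (ℕ→ℚ (n C k) * c ^Q (n ∸ k) *_) (ih k<n))

-- Parity of indices and symmetric umbral sums

even⊎odd : ∀ n → (∃ λ m → n ≡ 2 ℕ.* m) ⊎ (∃ λ m → n ≡ suc (2 ℕ.* m))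
even⊎odd zero = inj₁ (0 , refl)
even⊎odd (suc n) with even⊎odd n
... | inj₁ (m , refl) = inj₂ (m , refl)
... | inj₂ (m , refl) = inj₁ (suc m , cong suc (sym (ℕ.+-suc m (m ℕ.+ 0))))

parity-elim : (P : ℕ → Set) → (∀ m → P (2 ℕ.* m)) → (∀ m → P (suc (2 ℕ.* m))) → ∀ n → P n
parity-elim P P-even P-odd n with even⊎odd n
... | inj₁ (m , refl) = P-even m
... | inj₂ (m , refl) = P-odd m

sgn-even : ∀ m → sgn (2 ℕ.* m) ≡ 1ℚ
sgn-even m = trans (cong (λ k → sgn (m ℕ.+ k)) (ℕ.+-identityʳ m)) (sgn-double m)

sgn-odd : ∀ m → sgn (suc (2 ℕ.* m)) ≡ - 1ℚ
sgn-odd m = trans (sgn-suc (2 ℕ.* m)) (cong -_ (sgn-even m))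

ΣQ-even : ∀ m {f : ℕ → ℚ} → (∀ j → f (suc (2 ℕ.* j)) ≡ 0ℚ) → ΣQ (suc (2 ℕ.* m)) f ≡ ΣQ (suc m) (λ j → f (2 ℕ.* j))
ΣQ-even zero        odd = refl
ΣQ-even (suc m) {f} odd = begin
  ΣQ (suc (2 ℕ.* suc m)) f                                       ≡⟨ cong (λ k → ΣQ (suc k) f) (double-suc m) ⟩
  ΣQ (suc (2 ℕ.* m)) f + f (suc (2 ℕ.* m)) + f (2 ℕ.+ 2 ℕ.* m)   ≡⟨ cong₂ (λ x k → ΣQ (suc (2 ℕ.* m)) f + x + f k) (odd m) (sym (double-suc m)) ⟩
  ΣQ (suc (2 ℕ.* m)) f + 0ℚ + f (2 ℕ.* suc m)                    ≡⟨ cong (_+ f (2 ℕ.* suc m)) (trans (ℚ.+-identityʳ (ΣQ (suc (2 ℕ.* m)) f)) (ΣQ-even m odd)) ⟩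
  ΣQ (2 ℕ.+ m) (λ j → f (2 ℕ.* j))                               ∎
  where
  open ≡-Reasoning
  double-suc : ∀ m → 2 ℕ.* suc m ≡ 2 ℕ.+ 2 ℕ.* m
  double-suc m = cong suc (ℕ.+-suc m (m ℕ.+ 0))

umbral-±1 : ∀ n a → umbral n a 1ℚ + umbral n a (- 1ℚ) ≡ ΣQ (suc n) λ k → (1ℚ + sgn k) * (ℕ→ℚ (n C k) * a (n ∸ k))
umbral-±1 n a = begin
  umbral n a 1ℚ + umbral n a (- 1ℚ)
    ≡⟨ cong₂ _+_ (umbral-Σ-reversed n a 1ℚ) (umbral-Σ-reversed n a (- 1ℚ)) ⟩
  ΣQ (suc n) f + ΣQ (suc n) g
    ≡⟨ ΣQ-+ (suc n) f g ⟨
  ΣQ (suc n) (λ k → f k + g k)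
    ≡⟨ ΣQ-cong (suc n) (λ k _ → trans (cong (λ y → ℕ→ℚ (n C k) * y * a (n ∸ k) + g k) (1^Q k)) (lemma (ℕ→ℚ (n C k)) (sgn k) (a (n ∸ k)))) ⟩
  ΣQ (suc n) (λ k → (1ℚ + sgn k) * (ℕ→ℚ (n C k) * a (n ∸ k)))
    ∎
  where
  open ≡-Reasoning
  f g : ℕ → ℚ
  f k = ℕ→ℚ (n C k) * 1ℚ ^Q k * a (n ∸ k)
  g k = ℕ→ℚ (n C k) * sgn k * a (n ∸ k)
  lemma : ∀ c s a → c * 1ℚ * a + c * s * a ≡ (1ℚ + s) * (c * a)
  lemma = solve-∀ ℚ-ring

-- The recurrences of E and U run over even index differences only; the factor 1 + (-1)ᵏ of
-- `umbral-±1` is what selects them.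
umbral-±1-even : ∀ m a → let n = 2 ℕ.* m in
  umbral n a 1ℚ + umbral n a (- 1ℚ) ≡ 2ℚ * ΣQ (suc m) λ j → ℕ→ℚ (n C (2 ℕ.* j)) * a (n ∸ 2 ℕ.* j)
umbral-±1-even m a = begin
  umbral n a 1ℚ + umbral n a (- 1ℚ)
    ≡⟨ umbral-±1 n a ⟩
  ΣQ (suc n) (λ k → (1ℚ + sgn k) * (ℕ→ℚ (n C k) * a (n ∸ k)))
    ≡⟨ ΣQ-even m (λ j → trans (cong (λ s → (1ℚ + s) * (ℕ→ℚ (n C suc (2 ℕ.* j)) * a (n ∸ suc (2 ℕ.* j)))) (sgn-odd j))
                              (ℚ.*-zeroˡ (ℕ→ℚ (n C suc (2 ℕ.* j)) * a (n ∸ suc (2 ℕ.* j))))) ⟩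
  ΣQ (suc m) (λ j → (1ℚ + sgn (2 ℕ.* j)) * (ℕ→ℚ (n C (2 ℕ.* j)) * a (n ∸ 2 ℕ.* j)))
    ≡⟨ ΣQ-cong (suc m) (λ j _ → cong (λ s → (1ℚ + s) * (ℕ→ℚ (n C (2 ℕ.* j)) * a (n ∸ 2 ℕ.* j))) (sgn-even j)) ⟩
  ΣQ (suc m) (λ j → 2ℚ * (ℕ→ℚ (n C (2 ℕ.* j)) * a (n ∸ 2 ℕ.* j)))
    ≡⟨ ΣQ-*ˡ 2ℚ (suc m) (λ j → ℕ→ℚ (n C (2 ℕ.* j)) * a (n ∸ 2 ℕ.* j)) ⟩
  2ℚ * ΣQ (suc m) (λ j → ℕ→ℚ (n C (2 ℕ.* j)) * a (n ∸ 2 ℕ.* j))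
    ∎
  where
  open ≡-Reasoning
  n = 2 ℕ.* m

-- The course-of-values sequences

at-++ˡ : ∀ xs ys {i} → i < length xs → at (xs ++ ys) i ≡ at xs i
at-++ˡ (x ∷ xs) ys {zero}  _         = refl
at-++ˡ (x ∷ xs) ys {suc i} (s≤s i<n) = at-++ˡ xs ys i<n

at-length : ∀ xs y → at (xs ++ (y ∷ [])) (length xs) ≡ y
at-length []       y = refl
at-length (x ∷ xs) y = at-length xs y

length-history : ∀ step n → length (history step n) ≡ n
length-history step zero    = refl
length-history step (suc n) = trans (length-++ (history step n))
  (trans (cong (ℕ._+ 1) (length-history step n)) (ℕ.+-comm n 1))

-- The history only grows at its end, so an entry once written stays in place, and the default value
-- of `at` is not reached below n.
at-history : ∀ step n {i} → i < n → at (history step n) i ≡ seqOf step i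
at-history step (suc n) {i} i<1+n with ℕ.m≤n⇒m<n∨m≡n (ℕ.s≤s⁻¹ i<1+n)
... | inj₁ i<n  = trans (at-++ˡ (history step n) _ (subst (i <_) (sym (length-history step n)) i<n)) (at-history step n i<n)
... | inj₂ refl = trans (cong (at (history step (suc n))) (sym (length-history step n))) (at-length (history step n) _)

ΣZ⇒ΣQ : ∀ n f → ℤ→ℚ (ΣZ n f) ≡ ΣQ n (λ k → ℤ→ℚ (f k))
ΣZ⇒ΣQ zero    f = refl
ΣZ⇒ΣQ (suc n) f = trans (ℤ→ℚ-+ (ΣZ n f) (f n)) (cong (_+ ℤ→ℚ (f n)) (ΣZ⇒ΣQ n f))

odd%2 : ∀ m → suc (2 ℕ.* m) % 2 ≡ 1
odd%2 m = trans (cong (λ k → suc k % 2) (ℕ.*-comm 2 m)) ([m+kn]%n≡m%n 1 m 2)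

even%2 : ∀ m → 2 ℕ.* m % 2 ≡ 0
even%2 m = trans (cong (_% 2) (ℕ.*-comm 2 m)) (m*n%n≡0 m 2)

even/2 : ∀ m → 2 ℕ.* m / 2 ≡ m
even/2 m = trans (cong (_/ 2) (ℕ.*-comm 2 m)) (m*n/n≡m m 2)

n∸2[1+j]<n : ∀ n j → suc n ∸ 2 ℕ.* suc j < suc n
n∸2[1+j]<n n j = s≤s (ℕ.m∸n≤m n (j ℕ.+ (suc j ℕ.+ 0)))

ΣZ-binomial : ∀ n (c : ℕ → ℕ) (f : ℕ → ℤ) → ℤ→ℚ (ΣZ n (λ k → + c k ℤ.* f k)) ≡ ΣQ n (λ k → ℕ→ℚ (c k) * ℤ→ℚ (f k))
ΣZ-binomial n c f = trans (ΣZ⇒ΣQ n _) (ΣQ-cong n λ k _ → ℤ→ℚ-* (+ c k) (f k))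

-- Euler numbers (c = 1) and U (c = 2) share one recurrence. The equations for `step` are hypotheses
-- because the step functions branch on a parity test that has to be decided before they reduce.
module EvenRecurrence (step : (n : ℕ) → (ℕ → ℤ) → ℤ) (a : ℕ → ℚ) (c : ℤ)
  (a-def : ∀ n → a n ≡ ℤ→ℚ (seqOf step n))
  (step-odd : ∀ n f → suc n % 2 ≡ 1 → step (suc n) f ≡ + 0)
  (step-even : ∀ n f → suc n % 2 ≡ 0 → step (suc n) f ≡
     ℤ.- (c ℤ.* ΣZ (suc n / 2) λ j → + (suc n C (2 ℕ.* suc j)) ℤ.* f (suc n ∸ 2 ℕ.* suc j))) where

  odd≡0 : ∀ m → a (suc (2 ℕ.* m)) ≡ 0ℚ
  odd≡0 m = trans (a-def (suc (2 ℕ.* m))) (cong ℤ→ℚ (step-odd (2 ℕ.* m) _ (odd%2 m)))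

  even-rec : ∀ m → let n = 2 ℕ.* suc m in
    a n ≡ - (ℤ→ℚ c * ΣQ (suc m) λ j → ℕ→ℚ (n C (2 ℕ.* suc j)) * a (n ∸ 2 ℕ.* suc j))
  even-rec m = begin
    a n
      ≡⟨ a-def n ⟩
    ℤ→ℚ (seqOf step n)
      ≡⟨ cong ℤ→ℚ (step-even n-1 f (even%2 (suc m))) ⟩
    ℤ→ℚ (ℤ.- (c ℤ.* Z (n / 2)))
      ≡⟨ cong (λ N → ℤ→ℚ (ℤ.- (c ℤ.* Z N))) (even/2 (suc m)) ⟩
    ℤ→ℚ (ℤ.- (c ℤ.* Z (suc m)))
      ≡⟨ trans (ℤ→ℚ-neg (c ℤ.* Z (suc m))) (cong -_ (ℤ→ℚ-* c (Z (suc m)))) ⟩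
    - (ℤ→ℚ c * ℤ→ℚ (Z (suc m)))
      ≡⟨ cong (λ z → - (ℤ→ℚ c * z)) (ΣZ-binomial (suc m) (λ j → n C (2 ℕ.* suc j)) (λ j → f (n ∸ 2 ℕ.* suc j))) ⟩
    - (ℤ→ℚ c * ΣQ (suc m) (λ j → ℕ→ℚ (n C (2 ℕ.* suc j)) * ℤ→ℚ (f (n ∸ 2 ℕ.* suc j))))
      ≡⟨ cong (λ z → - (ℤ→ℚ c * z)) (ΣQ-cong (suc m) λ j _ → cong (ℕ→ℚ (n C (2 ℕ.* suc j)) *_)
           (trans (cong ℤ→ℚ (at-history step n (n∸2[1+j]<n n-1 j))) (sym (a-def (n ∸ 2 ℕ.* suc j))))) ⟩
    - (ℤ→ℚ c * ΣQ (suc m) (λ j → ℕ→ℚ (n C (2 ℕ.* suc j)) * a (n ∸ 2 ℕ.* suc j)))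
      ∎
    where
    open ≡-Reasoning
    n n-1 : ℕ
    n = 2 ℕ.* suc m
    -- `2 * suc m` reduces to the successor of this term, which is the shape that `step-even`
    -- expects.
    n-1 = m ℕ.+ suc (m ℕ.+ 0)
    f : ℕ → ℤ
    f = at (history step n)
    Z : ℕ → ℤ
    Z N = ΣZ N λ j → + (n C (2 ℕ.* suc j)) ℤ.* f (n ∸ 2 ℕ.* suc j)

-- Euler polynomials, U and s in umbral form

eulerQ : ℕ → ℚ
eulerQ n = ℤ→ℚ (eulerNum n)

UQ : ℕ → ℚ
UQ n = ℤ→ℚ (U n)

sQ : ℕ → ℚ
sQ n = ℤ→ℚ (s n)

eulerStep-odd : ∀ n f → suc n % 2 ≡ 1 → eulerStep (suc n) f ≡ + 0
eulerStep-odd n f odd with suc n % 2 ℕ.≟ 0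
... | no _     = refl
... | yes even = contradiction (trans (sym odd) even) λ ()

UStep-odd : ∀ n f → suc n % 2 ≡ 1 → UStep (suc n) f ≡ + 0
UStep-odd n f odd with suc n % 2 ℕ.≟ 0
... | no _     = refl
... | yes even = contradiction (trans (sym odd) even) λ ()

eulerStep-even : ∀ n f → suc n % 2 ≡ 0 → eulerStep (suc n) f ≡
  ℤ.- (+ 1 ℤ.* ΣZ (suc n / 2) λ j → + (suc n C (2 ℕ.* suc j)) ℤ.* f (suc n ∸ 2 ℕ.* suc j))
eulerStep-even n f even with suc n % 2 ℕ.≟ 0
... | no odd = contradiction even odd
... | yes _  = cong ℤ.-_ (sym (ℤ.*-identityˡ _))

UStep-even : ∀ n f → suc n % 2 ≡ 0 → UStep (suc n) f ≡
  ℤ.- (+ 2 ℤ.* ΣZ (suc n / 2) λ j → + (suc n C (2 ℕ.* suc j)) ℤ.* f (suc n ∸ 2 ℕ.* suc j))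
UStep-even n f even with suc n % 2 ℕ.≟ 0
... | no odd = contradiction even odd
... | yes _  = refl

module Euler = EvenRecurrence eulerStep eulerQ (+ 1) (λ _ → refl) eulerStep-odd eulerStep-even
module U = EvenRecurrence UStep UQ (+ 2) (λ _ → refl) UStep-odd UStep-even

-- In generating functions: sech t · 2 cosh t = 2. For even n > 0 this is the defining recurrence.
-- For odd n every term vanishes, through 1 + (-1)ᵏ when k is odd and through the Euler number of
-- odd index n - k when k is even.
umbral-euler-±1 : ∀ n → umbral n eulerQ 1ℚ + umbral n eulerQ (- 1ℚ) ≡ 2ℚ * 0ℚ ^Q n
umbral-euler-±1 = parity-elim _ even odd
  where
  open ≡-Reasoning
  even : ∀ m → let n = 2 ℕ.* m in umbral n eulerQ 1ℚ + umbral n eulerQ (- 1ℚ) ≡ 2ℚ * 0ℚ ^Q n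
  even zero    = refl
  even (suc m) = begin
    umbral n eulerQ 1ℚ + umbral n eulerQ (- 1ℚ)            ≡⟨ umbral-±1-even (suc m) eulerQ ⟩
    2ℚ * ΣQ (2 ℕ.+ m) f                                    ≡⟨ cong (2ℚ *_) (ΣQ-head (suc m) f) ⟩
    2ℚ * (1ℚ * eulerQ n + S)                               ≡⟨ cong (λ e → 2ℚ * (1ℚ * e + S)) (Euler.even-rec m) ⟩
    2ℚ * (1ℚ * - (1ℚ * S) + S)                             ≡⟨ lemma S (0ℚ ^Q (m ℕ.+ suc (m ℕ.+ 0))) ⟩
    2ℚ * 0ℚ ^Q n                                           ∎
    where
    n : ℕ
    n = 2 ℕ.* suc m
    f : ℕ → ℚ
    f j = ℕ→ℚ (n C (2 ℕ.* j)) * eulerQ (n ∸ 2 ℕ.* j)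
    S : ℚ
    S = ΣQ (suc m) (λ j → f (suc j))
    lemma : ∀ s z → 2ℚ * (1ℚ * - (1ℚ * s) + s) ≡ 2ℚ * (z * 0ℚ)
    lemma = solve-∀ ℚ-ring
  odd : ∀ m → let n = suc (2 ℕ.* m) in umbral n eulerQ 1ℚ + umbral n eulerQ (- 1ℚ) ≡ 2ℚ * 0ℚ ^Q n
  odd m = trans (umbral-±1 n eulerQ) (trans (ΣQ-zero (suc n) (parity-elim _ even-term odd-term)) (lemma (0ℚ ^Q (2 ℕ.* m))))
    where
    n : ℕ
    n = suc (2 ℕ.* m)
    lemma : ∀ z → 0ℚ ≡ 2ℚ * (z * 0ℚ)
    lemma = solve-∀ ℚ-ring
    zeroʳ : ∀ s c → s * (c * 0ℚ) ≡ 0ℚ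
    zeroʳ = solve-∀ ℚ-ring
    zeroˡ : ∀ x → (1ℚ + - 1ℚ) * x ≡ 0ℚ
    zeroˡ = solve-∀ ℚ-ring
    even-term : ∀ j → let k = 2 ℕ.* j in k < suc n → (1ℚ + sgn k) * (ℕ→ℚ (n C k) * eulerQ (n ∸ k)) ≡ 0ℚ
    even-term j k≤n = trans
      (cong (λ e → (1ℚ + sgn (2 ℕ.* j)) * (ℕ→ℚ (n C (2 ℕ.* j)) * e)) (trans (cong eulerQ n∸k) (Euler.odd≡0 (m ∸ j))))
      (zeroʳ (1ℚ + sgn (2 ℕ.* j)) (ℕ→ℚ (n C (2 ℕ.* j))))
      where
      j≤m : j ℕ.≤ m
      j≤m = ℕ.≮⇒≥ λ m<j → ℕ.<⇒≱ k≤n (ℕ.≤-trans (ℕ.≤-reflexive (sym (cong suc (ℕ.+-suc m (m ℕ.+ 0))))) (ℕ.*-monoʳ-≤ 2 m<j))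
      n∸k : n ∸ 2 ℕ.* j ≡ suc (2 ℕ.* (m ∸ j))
      n∸k = trans (ℕ.+-∸-assoc 1 (ℕ.*-monoʳ-≤ 2 j≤m)) (cong suc (sym (ℕ.*-distribˡ-∸ 2 m j)))
    odd-term : ∀ j → let k = suc (2 ℕ.* j) in k < suc n → (1ℚ + sgn k) * (ℕ→ℚ (n C k) * eulerQ (n ∸ k)) ≡ 0ℚ
    odd-term j _ = trans
      (cong (λ s → (1ℚ + s) * (ℕ→ℚ (n C suc (2 ℕ.* j)) * eulerQ (n ∸ suc (2 ℕ.* j)))) (sgn-odd j))
      (zeroˡ (ℕ→ℚ (n C suc (2 ℕ.* j)) * eulerQ (n ∸ suc (2 ℕ.* j))))

-- This is Eₙ(x) + Eₙ(x+1) = 2xⁿ in the variable t = 2x - 1 and without the factor 2⁻ⁿ: a step 1 in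
-- x is a step 2 in t, with midpoint u = 2x.
umbral-euler-shift : ∀ n u → umbral n eulerQ (1ℚ + u) + umbral n eulerQ (- 1ℚ + u) ≡ 2ℚ * u ^Q n
umbral-euler-shift n u = begin
  umbral n eulerQ (1ℚ + u) + umbral n eulerQ (- 1ℚ + u)
    ≡⟨ cong₂ _+_ (umbral-umbral n eulerQ 1ℚ u) (umbral-umbral n eulerQ (- 1ℚ) u) ⟨
  umbral n (λ k → umbral k eulerQ 1ℚ) u + umbral n (λ k → umbral k eulerQ (- 1ℚ)) u
    ≡⟨ umbral-+ n (λ k → umbral k eulerQ 1ℚ) (λ k → umbral k eulerQ (- 1ℚ)) u ⟨
  umbral n (λ k → umbral k eulerQ 1ℚ + umbral k eulerQ (- 1ℚ)) u
    ≡⟨ umbral-cong n u (λ k _ → umbral-euler-±1 k) ⟩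
  umbral n (λ k → 2ℚ * 0ℚ ^Q k) u
    ≡⟨ umbral-geometric n 2ℚ 0ℚ u ⟩
  2ℚ * (u + 0ℚ) ^Q n
    ≡⟨ cong (λ v → 2ℚ * v ^Q n) (ℚ.+-identityʳ u) ⟩
  2ℚ * u ^Q n
    ∎
  where open ≡-Reasoning

-- Since the odd Euler numbers vanish, a sign (-1)ᵏ may be put in front of each, and then scaling by
-- -1 applies.
umbral-euler-neg : ∀ n t → umbral n eulerQ (- t) ≡ sgn n * umbral n eulerQ t
umbral-euler-neg n t = begin
  umbral n eulerQ (- t)                            ≡⟨ umbral-cong n (- t) (λ k _ → sign k) ⟩
  umbral n (λ k → sgn k * eulerQ k) (- t)          ≡⟨ cong (umbral n (λ k → sgn k * eulerQ k)) (minus t) ⟩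
  umbral n (λ k → sgn k * eulerQ k) (- 1ℚ * t)     ≡⟨ umbral-scale n (- 1ℚ) eulerQ t ⟩
  sgn n * umbral n eulerQ t                        ∎
  where
  open ≡-Reasoning
  minus : ∀ t → - t ≡ - 1ℚ * t
  minus = solve-∀ ℚ-ring
  sign : ∀ k → eulerQ k ≡ sgn k * eulerQ k
  sign = parity-elim _
    (λ m → sym (trans (cong (_* eulerQ (2 ℕ.* m)) (sgn-even m)) (ℚ.*-identityˡ (eulerQ (2 ℕ.* m)))))
    (λ m → trans (Euler.odd≡0 m) (sym (trans (cong (sgn (suc (2 ℕ.* m)) *_) (Euler.odd≡0 m)) (ℚ.*-zeroʳ (sgn (suc (2 ℕ.* m)))))))

umbral-euler-neg-even : ∀ m t → umbral (2 ℕ.* m) eulerQ (- t) ≡ umbral (2 ℕ.* m) eulerQ t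
umbral-euler-neg-even m t = trans (umbral-euler-neg (2 ℕ.* m) t)
  (trans (cong (_* umbral (2 ℕ.* m) eulerQ t) (sgn-even m)) (ℚ.*-identityˡ _))

-- The argument -1 is 2x - 1 at x = 0. The values at 1 and -1 agree by parity, and their sum is 2 ·
-- 0ⁿ with n > 0.
umbral-euler-at-1 : ∀ m → umbral (2 ℕ.* suc m) eulerQ (- 1ℚ) ≡ 0ℚ
umbral-euler-at-1 m = begin
  e                                    ≡⟨ halve e ⟩
  ½ * (e + e)                          ≡⟨ cong (λ x → ½ * (x + e)) (umbral-euler-neg-even (suc m) 1ℚ) ⟩
  ½ * (umbral n eulerQ 1ℚ + e)         ≡⟨ cong (½ *_) (umbral-euler-±1 n) ⟩
  ½ * (2ℚ * 0ℚ ^Q n)                   ≡⟨ lemma (0ℚ ^Q (m ℕ.+ suc (m ℕ.+ 0))) ⟩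
  0ℚ                                   ∎
  where
  open ≡-Reasoning
  n : ℕ
  n = 2 ℕ.* suc m
  e : ℚ
  e = umbral n eulerQ (- 1ℚ)
  halve : ∀ x → x ≡ ½ * (x + x)
  halve = solve-∀ ℚ-ring
  lemma : ∀ z → ½ * (2ℚ * (z * 0ℚ)) ≡ 0ℚ
  lemma = solve-∀ ℚ-ring

½^-inverse : ∀ n → ½ ^Q n * 2ℚ ^Q n ≡ 1ℚ
½^-inverse n = trans (sym (^Q-distribʳ-* ½ 2ℚ n)) (1^Q n)

/-inverse : ∀ d .{{_ : ℕ.NonZero d}} → ((+ 1) ℚ./ d) * ℕ→ℚ d ≡ 1ℚ
/-inverse (suc d) = /-*-cancel (+ 1) d

eulerPoly≡umbral : ∀ n x → eulerPoly n x ≡ ½ ^Q n * umbral n eulerQ (2ℚ * x - 1ℚ)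
eulerPoly≡umbral n x = cong₂ _*_ (begin
  i                             ≡⟨ ℚ.*-identityʳ i ⟨
  i * 1ℚ                        ≡⟨ cong (i *_) (½^-inverse n) ⟨
  i * (½ ^Q n * 2ℚ ^Q n)        ≡⟨ lemma i (½ ^Q n) (2ℚ ^Q n) ⟩
  ½ ^Q n * (i * 2ℚ ^Q n)        ≡⟨ cong (λ y → ½ ^Q n * (i * y)) (sym (ℕ→ℚ-^ 2 n)) ⟩
  ½ ^Q n * (i * ℕ→ℚ (2 ℕ.^ n))  ≡⟨ cong (½ ^Q n *_) (/-inverse (2 ℕ.^ n) {{nz}}) ⟩
  ½ ^Q n * 1ℚ                   ≡⟨ ℚ.*-identityʳ (½ ^Q n) ⟩
  ½ ^Q n                        ∎)
  (sym (umbral-Σ n eulerQ (2ℚ * x - 1ℚ)))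
  where
  open ≡-Reasoning
  nz : ℕ.NonZero (2 ℕ.^ n)
  nz = ℕ.>-nonZero (ℕ.m^n>0 2 n)
  i : ℚ
  i = ((+ 1) ℚ./ (2 ℕ.^ n)) {{nz}}
  lemma : ∀ i a b → i * (a * b) ≡ a * (i * b)
  lemma = solve-∀ ℚ-ring

2^½^ : ∀ n → 2ℚ ^Q n * ½ ^Q n ≡ 1ℚ
2^½^ n = trans (ℚ.*-comm (2ℚ ^Q n) (½ ^Q n)) (½^-inverse n)

⅓ ⅔ ¼ ⅙ : ℚ
⅓ = (+ 1) ℚ./ 3
⅔ = (+ 2) ℚ./ 3
¼ = (+ 1) ℚ./ 4
⅙ = (+ 1) ℚ./ 6

3/2 : ℚ
3/2 = (+ 3) ℚ./ 2

-- At x = 1/3 the argument 2x - 1 is -1/3, and 3ⁿ · 2⁻ⁿ gives the base 3/2. A step ±1 for `u` is a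
-- step ±2/3 for the Euler polynomial: -1/3 + 2/3 = 1/3 returns `u n` by parity, and -1/3 - 2/3 = -1
-- gives 0. So both steps together give `u n` itself, which is the recurrence of U.
U≡umbral : ∀ m → UQ (2 ℕ.* m) ≡ 3/2 ^Q (2 ℕ.* m) * umbral (2 ℕ.* m) eulerQ (- ⅓)
U≡umbral = <-rec _ go
  where
  u : ℕ → ℚ
  u k = 3/2 ^Q k * umbral k eulerQ (- ⅓)
  step : ∀ m → (∀ {k} → k < suc m → UQ (2 ℕ.* k) ≡ u (2 ℕ.* k)) → UQ (2 ℕ.* suc m) ≡ u (2 ℕ.* suc m)
  step m ih = begin
    UQ n                                                                         ≡⟨ U.even-rec m ⟩
    - (2ℚ * ΣQ (suc m) (λ j → ℕ→ℚ (n C (2 ℕ.* suc j)) * UQ (n ∸ 2 ℕ.* suc j)))  ≡⟨ cong (λ x → - (2ℚ * x)) (ΣQ-cong (suc m) λ j _ → cong (ℕ→ℚ (n C (2 ℕ.* suc j)) *_) (ih′ j)) ⟩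
    - (2ℚ * S)                                                                   ≡⟨ solve-rec (u n) S rec ⟨
    u n                                                                          ∎
    where
    open ≡-Reasoning
    n : ℕ
    n = 2 ℕ.* suc m
    f : ℕ → ℚ
    f j = ℕ→ℚ (n C (2 ℕ.* j)) * u (n ∸ 2 ℕ.* j)
    S : ℚ
    S = ΣQ (suc m) (λ j → f (suc j))
    ih′ : ∀ j → UQ (n ∸ 2 ℕ.* suc j) ≡ u (n ∸ 2 ℕ.* suc j)
    ih′ j = subst (λ k → UQ k ≡ u k) (ℕ.*-distribˡ-∸ 2 (suc m) (suc j)) (ih (s≤s (ℕ.m∸n≤m m j)))
    shift : ∀ x → umbral n u (3/2 * x) ≡ 3/2 ^Q n * umbral n eulerQ (- ⅓ + x)
    shift x = trans (umbral-scale n 3/2 (λ k → umbral k eulerQ (- ⅓)) x)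
      (cong (3/2 ^Q n *_) (umbral-umbral n eulerQ (- ⅓) x))
    rec : u n + 0ℚ ≡ 2ℚ * (1ℚ * u n + S)
    rec = begin
      u n + 0ℚ                                   ≡⟨ cong₂ _+_ (cong (3/2 ^Q n *_) (umbral-euler-neg-even (suc m) ⅓)) (sym (ℚ.*-zeroʳ (3/2 ^Q n))) ⟩
      3/2 ^Q n * umbral n eulerQ ⅓ + 3/2 ^Q n * 0ℚ  ≡⟨ cong (λ x → 3/2 ^Q n * umbral n eulerQ ⅓ + 3/2 ^Q n * x) (sym (umbral-euler-at-1 m)) ⟩
      3/2 ^Q n * umbral n eulerQ ⅓ + 3/2 ^Q n * umbral n eulerQ (- 1ℚ)  ≡⟨ cong₂ _+_ (shift ⅔) (shift (- ⅔)) ⟨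
      umbral n u 1ℚ + umbral n u (- 1ℚ)          ≡⟨ umbral-±1-even (suc m) u ⟩
      2ℚ * ΣQ (2 ℕ.+ m) f                        ≡⟨ cong (2ℚ *_) (ΣQ-head (suc m) f) ⟩
      2ℚ * (1ℚ * u n + S)                        ∎
    solve-rec : ∀ x y → x + 0ℚ ≡ 2ℚ * (1ℚ * x + y) → x ≡ - (2ℚ * y)
    solve-rec x y eq = trans (lemma x y) (trans (cong (λ z → 2ℚ * (1ℚ * x + y) - z + - (2ℚ * y)) eq) (lemma′ x y))
      where
      lemma : ∀ x y → x ≡ 2ℚ * (1ℚ * x + y) - (x + 0ℚ) + - (2ℚ * y)
      lemma = solve-∀ ℚ-ring
      lemma′ : ∀ x y → 2ℚ * (1ℚ * x + y) - 2ℚ * (1ℚ * x + y) + - (2ℚ * y) ≡ - (2ℚ * y)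
      lemma′ = solve-∀ ℚ-ring

  go : ∀ m → (∀ {k} → k < m → UQ (2 ℕ.* k) ≡ u (2 ℕ.* k)) → UQ (2 ℕ.* m) ≡ u (2 ℕ.* m)
  go zero    _  = refl
  go (suc m) ih = step m ih

-- Doubling turns 2^(2n-1-2k) into 4^(n-k), so the given recursion becomes a shift by 4 in which the
-- last term supplies the second sₙ.
s-rec : ∀ n → sQ n + umbral n sQ (ℕ→ℚ 4) ≡ 2ℚ
s-rec zero    = refl
s-rec (suc n-1) = begin
  sQ n + umbral n sQ (ℕ→ℚ 4)         ≡⟨ cong₂ _+_ unfold (umbral-last n sQ (ℕ→ℚ 4)) ⟩
  (1ℚ - S) + (T + sQ n)              ≡⟨ cong₂ (λ x y → (1ℚ - S) + (x + y)) T≡2S unfold ⟩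
  (1ℚ - S) + (2ℚ * S + (1ℚ - S))     ≡⟨ lemma S ⟩
  2ℚ                                 ∎
  where
  open ≡-Reasoning
  n : ℕ
  n = suc n-1
  S T : ℚ
  S = ΣQ n (λ k → ℕ→ℚ ((n C k) ℕ.* 2 ℕ.^ (2 ℕ.* n ∸ 1 ∸ 2 ℕ.* k)) * sQ k)
  T = ΣQ n (λ k → ℕ→ℚ (n C k) * ℕ→ℚ 4 ^Q (n ∸ k) * sQ k)
  lemma : ∀ x → (1ℚ - x) + (2ℚ * x + (1ℚ - x)) ≡ 2ℚ
  lemma = solve-∀ ℚ-ring
  unfold : sQ n ≡ 1ℚ - S
  unfold = begin
    sQ n                ≡⟨ trans (ℤ→ℚ-+ (+ 1) (ℤ.- Z)) (cong (_+_ 1ℚ) (ℤ→ℚ-neg Z)) ⟩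
    1ℚ - ℤ→ℚ Z          ≡⟨ cong (_-_ 1ℚ) (ΣZ-binomial n (λ k → (n C k) ℕ.* 2 ℕ.^ (2 ℕ.* n ∸ 1 ∸ 2 ℕ.* k)) (at (history sStep n))) ⟩
    1ℚ - ΣQ n (λ k → ℕ→ℚ ((n C k) ℕ.* 2 ℕ.^ (2 ℕ.* n ∸ 1 ∸ 2 ℕ.* k)) * ℤ→ℚ (at (history sStep n) k))
      ≡⟨ cong (_-_ 1ℚ) (ΣQ-cong n λ k k<n → cong (λ z → ℕ→ℚ ((n C k) ℕ.* 2 ℕ.^ (2 ℕ.* n ∸ 1 ∸ 2 ℕ.* k)) * ℤ→ℚ z) (at-history sStep n k<n)) ⟩
    1ℚ - S              ∎
    where
    Z : ℤ
    Z = ΣZ n (λ k → + ((n C k) ℕ.* 2 ℕ.^ (2 ℕ.* n ∸ 1 ∸ 2 ℕ.* k)) ℤ.* at (history sStep n) k)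
  -- Truncated subtraction is exact here because k < n.
  exponent : ∀ {k} → k < n → suc (2 ℕ.* n ∸ 1 ∸ 2 ℕ.* k) ≡ 2 ℕ.* (n ∸ k)
  exponent {k} k<n = begin
    suc (2 ℕ.* n ∸ 1 ∸ 2 ℕ.* k)     ≡⟨ ℕ.+-∸-assoc 1 2k≤ ⟨
    2 ℕ.* n ∸ 2 ℕ.* k               ≡⟨ ℕ.*-distribˡ-∸ 2 n k ⟨
    2 ℕ.* (n ∸ k)                   ∎
    where
    2k≤ : 2 ℕ.* k ℕ.≤ 2 ℕ.* n ∸ 1
    2k≤ = ℕ.s≤s⁻¹ (ℕ.*-monoʳ-< 2 k<n)
  power : ∀ {k} → k < n → 2ℚ * ℕ→ℚ (2 ℕ.^ (2 ℕ.* n ∸ 1 ∸ 2 ℕ.* k)) ≡ ℕ→ℚ 4 ^Q (n ∸ k)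
  power {k} k<n = begin
    2ℚ * ℕ→ℚ (2 ℕ.^ (2 ℕ.* n ∸ 1 ∸ 2 ℕ.* k))   ≡⟨ ℕ→ℚ-* 2 (2 ℕ.^ (2 ℕ.* n ∸ 1 ∸ 2 ℕ.* k)) ⟨
    ℕ→ℚ (2 ℕ.^ suc (2 ℕ.* n ∸ 1 ∸ 2 ℕ.* k))    ≡⟨ cong (λ i → ℕ→ℚ (2 ℕ.^ i)) (exponent k<n) ⟩
    ℕ→ℚ (2 ℕ.^ (2 ℕ.* (n ∸ k)))                ≡⟨ cong ℕ→ℚ (ℕ.^-*-assoc 2 2 (n ∸ k)) ⟨
    ℕ→ℚ (4 ℕ.^ (n ∸ k))                        ≡⟨ ℕ→ℚ-^ 4 (n ∸ k) ⟩
    ℕ→ℚ 4 ^Q (n ∸ k)                           ∎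
  T≡2S : T ≡ 2ℚ * S
  T≡2S = trans (ΣQ-cong n λ k k<n → begin
    ℕ→ℚ (n C k) * ℕ→ℚ 4 ^Q (n ∸ k) * sQ k
      ≡⟨ cong (λ y → ℕ→ℚ (n C k) * y * sQ k) (power k<n) ⟨
    ℕ→ℚ (n C k) * (2ℚ * ℕ→ℚ (2 ℕ.^ (2 ℕ.* n ∸ 1 ∸ 2 ℕ.* k))) * sQ k
      ≡⟨ shuffle (ℕ→ℚ (n C k)) (ℕ→ℚ (2 ℕ.^ (2 ℕ.* n ∸ 1 ∸ 2 ℕ.* k))) (sQ k) ⟩
    2ℚ * (ℕ→ℚ (n C k) * ℕ→ℚ (2 ℕ.^ (2 ℕ.* n ∸ 1 ∸ 2 ℕ.* k)) * sQ k)
      ≡⟨ cong (λ y → 2ℚ * (y * sQ k)) (ℕ→ℚ-* (n C k) (2 ℕ.^ (2 ℕ.* n ∸ 1 ∸ 2 ℕ.* k))) ⟨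
    2ℚ * (ℕ→ℚ ((n C k) ℕ.* 2 ℕ.^ (2 ℕ.* n ∸ 1 ∸ 2 ℕ.* k)) * sQ k)
      ∎) (ΣQ-*ˡ 2ℚ n _)
    where
    shuffle : ∀ a b c → a * (2ℚ * b) * c ≡ 2ℚ * (a * b * c)
    shuffle = solve-∀ ℚ-ring

-- At x = 1/4 the argument 2x - 1 is -1/2, and 4ⁿ · 2⁻ⁿ = 2ⁿ. The shift by 4 for s becomes the step
-- from -1/2 to 3/2, which is the pair -1 + u, 1 + u with u = 1/2.
s≡umbral : ∀ n → sQ n ≡ 2ℚ ^Q n * umbral n eulerQ (- ½)
s≡umbral = umbral-unique (ℕ→ℚ 4) λ n → trans (s-rec n) (sym (begin
  2ℚ ^Q n * e n (- ½) + umbral n (λ k → 2ℚ ^Q k * e k (- ½)) (2ℚ * 2ℚ)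
    ≡⟨ cong (_+_ (2ℚ ^Q n * e n (- ½))) (trans (umbral-scale n 2ℚ (λ k → e k (- ½)) 2ℚ) (cong (2ℚ ^Q n *_) (umbral-umbral n eulerQ (- ½) 2ℚ))) ⟩
  2ℚ ^Q n * e n (- 1ℚ + ½) + 2ℚ ^Q n * e n (1ℚ + ½)
    ≡⟨ factor (2ℚ ^Q n) (e n (- 1ℚ + ½)) (e n (1ℚ + ½)) ⟩
  2ℚ ^Q n * (e n (1ℚ + ½) + e n (- 1ℚ + ½))
    ≡⟨ cong (2ℚ ^Q n *_) (umbral-euler-shift n ½) ⟩
  2ℚ ^Q n * (2ℚ * ½ ^Q n)
    ≡⟨ swap (2ℚ ^Q n) (½ ^Q n) ⟩
  2ℚ * (2ℚ ^Q n * ½ ^Q n)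
    ≡⟨ cong (2ℚ *_) (2^½^ n) ⟩
  2ℚ
    ∎))
  where
  open ≡-Reasoning
  e : ℕ → ℚ → ℚ
  e n t = umbral n eulerQ t
  factor : ∀ c a b → c * a + c * b ≡ c * (b + a)
  factor = solve-∀ ℚ-ring
  swap : ∀ a b → a * (2ℚ * b) ≡ 2ℚ * (a * b)
  swap = solve-∀ ℚ-ring

umbral-at-0 : ∀ n a → umbral n a 0ℚ ≡ a n
umbral-at-0 zero    a = refl
umbral-at-0 (suc n) a = trans (umbral-at-0 n (λ k → 0ℚ * a k + a (suc k))) (lemma (a n) (a (suc n)))
  where
  lemma : ∀ x y → 0ℚ * x + y ≡ y
  lemma = solve-∀ ℚ-ring

-- The multiplication formula Eₙ(3x) = 3ⁿ(Eₙ(x) − Eₙ(x + 1/3) + Eₙ(x + 2/3)) at x = 1/6.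
euler-triplication : ∀ n → eulerQ n ≡
  ℕ→ℚ 3 ^Q n * (umbral n eulerQ (- ⅔) + (- 1ℚ * umbral n eulerQ 0ℚ + umbral n eulerQ ⅔))
euler-triplication = umbral-unique 2ℚ λ n → trans (lhs n) (sym (rhs n))
  where
  open ≡-Reasoning
  e : ℕ → ℚ → ℚ
  e n t = umbral n eulerQ t
  b : ℕ → ℚ
  b n = e n (- ⅔) + (- 1ℚ * e n 0ℚ + e n ⅔)
  lhs : ∀ n → eulerQ n + umbral n eulerQ 2ℚ ≡ 2ℚ
  lhs n = begin
    eulerQ n + e n 2ℚ                  ≡⟨ cong (_+ e n 2ℚ) (umbral-at-0 n eulerQ) ⟨
    e n (- 1ℚ + 1ℚ) + e n (1ℚ + 1ℚ)    ≡⟨ ℚ.+-comm (e n (- 1ℚ + 1ℚ)) (e n (1ℚ + 1ℚ)) ⟩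
    e n (1ℚ + 1ℚ) + e n (- 1ℚ + 1ℚ)    ≡⟨ umbral-euler-shift n 1ℚ ⟩
    2ℚ * 1ℚ ^Q n                       ≡⟨ cong (2ℚ *_) (1^Q n) ⟩
    2ℚ                                 ∎
  -- A step 2/3 moves each of -2/3, 0, 2/3 to the next, so adding the unshifted alternating sum
  -- leaves only -2/3 and 4/3. These are again -1 + u and 1 + u, with u = 1/3.
  shift : ∀ n → umbral n b ⅔ ≡ e n 0ℚ + (- 1ℚ * e n ⅔ + e n (1ℚ + ⅓))
  shift n = begin
    umbral n b ⅔
      ≡⟨ umbral-+ n (λ k → e k (- ⅔)) (λ k → - 1ℚ * e k 0ℚ + e k ⅔) ⅔ ⟩
    umbral n (λ k → e k (- ⅔)) ⅔ + umbral n (λ k → - 1ℚ * e k 0ℚ + e k ⅔) ⅔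
      ≡⟨ cong₂ _+_ (umbral-umbral n eulerQ (- ⅔) ⅔) (umbral-+ n (λ k → - 1ℚ * e k 0ℚ) (λ k → e k ⅔) ⅔) ⟩
    e n 0ℚ + (umbral n (λ k → - 1ℚ * e k 0ℚ) ⅔ + umbral n (λ k → e k ⅔) ⅔)
      ≡⟨ cong₂ (λ x y → e n 0ℚ + (x + y))
           (trans (umbral-* n (- 1ℚ) (λ k → e k 0ℚ) ⅔) (cong (- 1ℚ *_) (umbral-umbral n eulerQ 0ℚ ⅔)))
           (umbral-umbral n eulerQ ⅔ ⅔) ⟩
    e n 0ℚ + (- 1ℚ * e n ⅔ + e n (1ℚ + ⅓))
      ∎
  telescope : ∀ c x y z w → c * (x + (- 1ℚ * y + z)) + c * (y + (- 1ℚ * z + w)) ≡ c * (w + x)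
  telescope = solve-∀ ℚ-ring
  swap : ∀ a b → a * (2ℚ * b) ≡ 2ℚ * (a * b)
  swap = solve-∀ ℚ-ring
  rhs : ∀ n → ℕ→ℚ 3 ^Q n * b n + umbral n (λ k → ℕ→ℚ 3 ^Q k * b k) 2ℚ ≡ 2ℚ
  rhs n = begin
    ℕ→ℚ 3 ^Q n * b n + umbral n (λ k → ℕ→ℚ 3 ^Q k * b k) (ℕ→ℚ 3 * ⅔)
      ≡⟨ cong (_+_ (ℕ→ℚ 3 ^Q n * b n)) (trans (umbral-scale n (ℕ→ℚ 3) b ⅔) (cong (ℕ→ℚ 3 ^Q n *_) (shift n))) ⟩
    ℕ→ℚ 3 ^Q n * b n + ℕ→ℚ 3 ^Q n * (e n 0ℚ + (- 1ℚ * e n ⅔ + e n (1ℚ + ⅓)))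
      ≡⟨ telescope (ℕ→ℚ 3 ^Q n) (e n (- ⅔)) (e n 0ℚ) (e n ⅔) (e n (1ℚ + ⅓)) ⟩
    ℕ→ℚ 3 ^Q n * (e n (1ℚ + ⅓) + e n (- 1ℚ + ⅓))
      ≡⟨ cong (ℕ→ℚ 3 ^Q n *_) (umbral-euler-shift n ⅓) ⟩
    ℕ→ℚ 3 ^Q n * (2ℚ * ⅓ ^Q n)
      ≡⟨ swap (ℕ→ℚ 3 ^Q n) (⅓ ^Q n) ⟩
    2ℚ * (ℕ→ℚ 3 ^Q n * ⅓ ^Q n)
      ≡⟨ cong (2ℚ *_) (trans (sym (^Q-distribʳ-* (ℕ→ℚ 3) ⅓ n)) (1^Q n)) ⟩
    2ℚ
      ∎

-- The argument 2x - 1 at x = 1/6 is -2/3. For even n the outer terms of the triplication formula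
-- agree, so it can be solved for this value.
euler-sixth : ∀ m → let n = 2 ℕ.* m in
  2ℚ * (ℕ→ℚ 3 ^Q n * umbral n eulerQ (- ⅔)) ≡ (1ℚ + ℕ→ℚ 3 ^Q n) * eulerQ n
euler-sixth m = begin
  2ℚ * (c * a)                              ≡⟨ lemma c a E ⟩
  c * (a + (- 1ℚ * E + a)) + c * E          ≡⟨ cong₂ (λ x y → c * (a + (- 1ℚ * x + y)) + c * E) (umbral-at-0 n eulerQ) (umbral-euler-neg-even m (- ⅔)) ⟨
  c * (a + (- 1ℚ * umbral n eulerQ 0ℚ + umbral n eulerQ ⅔)) + c * E   ≡⟨ cong (_+ c * E) (euler-triplication n) ⟨
  E + c * E                                 ≡⟨ lemma′ c E ⟩
  (1ℚ + c) * E                              ∎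
  where
  open ≡-Reasoning
  n : ℕ
  n = 2 ℕ.* m
  c a E : ℚ
  c = ℕ→ℚ 3 ^Q n
  a = umbral n eulerQ (- ⅔)
  E = eulerQ n
  lemma : ∀ c a E → 2ℚ * (c * a) ≡ c * (a + (- 1ℚ * E + a)) + c * E
  lemma = solve-∀ ℚ-ring
  lemma′ : ∀ c E → E + c * E ≡ (1ℚ + c) * E
  lemma′ = solve-∀ ℚ-ring

-- The closed form of Σ (2n+1)(−1)ⁿVₙ(x)

h : ℚ → ℕ → ℚ
h z k = binom z k * binom (- 1ℚ - z) k

D : ℕ → ℚ → ℚ
D zero    z = 1ℚ
D (suc n) z = D n z * (1ℚ - z * z * (invℕ (suc n) * invℕ (suc n)))

invℕ-suc : ∀ k → invℕ (suc k) * (ℕ→ℚ k + 1ℚ) ≡ 1ℚ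
invℕ-suc k = trans (cong (invℕ (suc k) *_) (sym (ℕ→ℚ-suc k))) (invℕ-inverse k)

D-suc : ∀ k z → let κ = ℕ→ℚ k ; ι = invℕ (suc k) in
  D (suc k) z ≡ D k z * (((κ + 1ℚ) * (κ + 1ℚ) - z * z) * (ι * ι))
D-suc k z = cong (D k z *_) (trans
  (cong (λ u → u * u - z * z * (ι * ι)) (sym (invℕ-suc k)))
  (lemma ι (ℕ→ℚ k) z))
  where
  ι : ℚ
  ι = invℕ (suc k)
  lemma : ∀ ι κ z → (ι * (κ + 1ℚ)) * (ι * (κ + 1ℚ)) - z * z * (ι * ι) ≡ ((κ + 1ℚ) * (κ + 1ℚ) - z * z) * (ι * ι)
  lemma = solve-∀ ℚ-ring

-- `h z k` is (-1)ᵏ/k!² times the product of z + i over -k < i ≤ k. The factor z - k makes this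
-- range symmetric, and pairing i with -i gives z times D.
D-h : ∀ k z → z * D k z ≡ h z k * (z - ℕ→ℚ k)
D-h zero    z = lemma z
  where
  lemma : ∀ z → z * 1ℚ ≡ 1ℚ * 1ℚ * (z - 0ℚ)
  lemma = solve-∀ ℚ-ring
D-h (suc k) z = begin
  z * D (suc k) z
    ≡⟨ cong (z *_) (D-suc k z) ⟩
  z * (D k z * (((κ + 1ℚ) * (κ + 1ℚ) - z * z) * (ι * ι)))
    ≡⟨ ℚ.*-assoc z (D k z) _ ⟨
  z * D k z * (((κ + 1ℚ) * (κ + 1ℚ) - z * z) * (ι * ι))
    ≡⟨ cong (_* (((κ + 1ℚ) * (κ + 1ℚ) - z * z) * (ι * ι))) (D-h k z) ⟩
  h z k * (z - κ) * (((κ + 1ℚ) * (κ + 1ℚ) - z * z) * (ι * ι))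
    ≡⟨ lemma (binom z k) (binom (- 1ℚ - z) k) z κ ι ⟩
  h z (suc k) * (z - (κ + 1ℚ))
    ≡⟨ cong (λ x → h z (suc k) * (z - x)) (ℕ→ℚ-suc k) ⟨
  h z (suc k) * (z - ℕ→ℚ (suc k))
    ∎
  where
  open ≡-Reasoning
  κ ι : ℚ
  κ = ℕ→ℚ k
  ι = invℕ (suc k)
  lemma : ∀ b c z κ ι → b * c * (z - κ) * (((κ + 1ℚ) * (κ + 1ℚ) - z * z) * (ι * ι))
    ≡ (b * (z - κ) * ι) * (c * (- 1ℚ - z - κ) * ι) * (z - (κ + 1ℚ))
  lemma = solve-∀ ℚ-ring

-- With z - 1 in place of z the product of z + i runs over -k ≤ i < k, so the missing factor is z +
-- k.
D-h-pred : ∀ k z → z * D k z ≡ h (z - 1ℚ) k * (z + ℕ→ℚ k)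
D-h-pred zero    z = lemma z
  where
  lemma : ∀ z → z * 1ℚ ≡ 1ℚ * 1ℚ * (z + 0ℚ)
  lemma = solve-∀ ℚ-ring
D-h-pred (suc k) z = begin
  z * D (suc k) z
    ≡⟨ cong (z *_) (D-suc k z) ⟩
  z * (D k z * (((κ + 1ℚ) * (κ + 1ℚ) - z * z) * (ι * ι)))
    ≡⟨ ℚ.*-assoc z (D k z) _ ⟨
  z * D k z * (((κ + 1ℚ) * (κ + 1ℚ) - z * z) * (ι * ι))
    ≡⟨ cong (_* (((κ + 1ℚ) * (κ + 1ℚ) - z * z) * (ι * ι))) (D-h-pred k z) ⟩
  h (z - 1ℚ) k * (z + κ) * (((κ + 1ℚ) * (κ + 1ℚ) - z * z) * (ι * ι))
    ≡⟨ lemma (binom (z - 1ℚ) k) (binom (- 1ℚ - (z - 1ℚ)) k) z κ ι ⟩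
  h (z - 1ℚ) (suc k) * (z + (κ + 1ℚ))
    ≡⟨ cong (λ x → h (z - 1ℚ) (suc k) * (z + x)) (ℕ→ℚ-suc k) ⟨
  h (z - 1ℚ) (suc k) * (z + ℕ→ℚ (suc k))
    ∎
  where
  open ≡-Reasoning
  κ ι : ℚ
  κ = ℕ→ℚ k
  ι = invℕ (suc k)
  lemma : ∀ b c z κ ι → b * c * (z + κ) * (((κ + 1ℚ) * (κ + 1ℚ) - z * z) * (ι * ι))
    ≡ (b * (z - 1ℚ - κ) * ι) * (c * (- 1ℚ - (z - 1ℚ) - κ) * ι) * (z + (κ + 1ℚ))
  lemma = solve-∀ ℚ-ring

+1-1 : ∀ z → z + 1ℚ - 1ℚ ≡ z
+1-1 = solve-∀ ℚ-ring

-- The link is `h z n`, which the factor z - n completes to D at z and the factor z + 1 + n to D at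
-- z + 1.
D-shift : ∀ n z → (z + 1ℚ) * (z - ℕ→ℚ n) * D n (z + 1ℚ) ≡ z * (z + 1ℚ + ℕ→ℚ n) * D n z
D-shift n z = begin
  (z + 1ℚ) * (z - ν) * D n (z + 1ℚ)                   ≡⟨ reorder (z + 1ℚ) (z - ν) (D n (z + 1ℚ)) ⟩
  (z - ν) * ((z + 1ℚ) * D n (z + 1ℚ))                 ≡⟨ cong ((z - ν) *_) (D-h-pred n (z + 1ℚ)) ⟩
  (z - ν) * (h (z + 1ℚ - 1ℚ) n * (z + 1ℚ + ν))        ≡⟨ cong (λ y → (z - ν) * (h y n * (z + 1ℚ + ν))) (+1-1 z) ⟩
  (z - ν) * (h z n * (z + 1ℚ + ν))                    ≡⟨ reorder′ (z - ν) (h z n) (z + 1ℚ + ν) ⟩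
  h z n * (z - ν) * (z + 1ℚ + ν)                      ≡⟨ cong (_* (z + 1ℚ + ν)) (D-h n z) ⟨
  z * D n z * (z + 1ℚ + ν)                            ≡⟨ reorder″ z (D n z) (z + 1ℚ + ν) ⟩
  z * (z + 1ℚ + ν) * D n z                            ∎
  where
  open ≡-Reasoning
  ν : ℚ
  ν = ℕ→ℚ n
  reorder : ∀ a b c → a * b * c ≡ b * (a * c)
  reorder = solve-∀ ℚ-ring
  reorder′ : ∀ a b c → a * (b * c) ≡ b * a * c
  reorder′ = solve-∀ ℚ-ring
  reorder″ : ∀ a b c → a * b * c ≡ a * c * b
  reorder″ = solve-∀ ℚ-ring

h-suc : ∀ k z → let ι = invℕ (suc k) in h z (suc k) ≡ - (z * D k z * (z + ℕ→ℚ k + 1ℚ) * (ι * ι))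
h-suc k z = trans (lemma (binom z k) (binom (- 1ℚ - z) k) z (ℕ→ℚ k) (invℕ (suc k)))
  (cong (λ y → - (y * (z + ℕ→ℚ k + 1ℚ) * (invℕ (suc k) * invℕ (suc k)))) (sym (D-h k z)))
  where
  lemma : ∀ b c z κ ι → (b * (z - κ) * ι) * (c * (- 1ℚ - z - κ) * ι) ≡ - (b * c * (z - κ) * (z + κ + 1ℚ) * (ι * ι))
  lemma = solve-∀ ℚ-ring

h-pred-suc : ∀ k z → let ι = invℕ (suc k) in h (z - 1ℚ) (suc k) ≡ - (z * D k z * (z - 1ℚ - ℕ→ℚ k) * (ι * ι))
h-pred-suc k z = trans (lemma (binom (z - 1ℚ) k) (binom (- 1ℚ - (z - 1ℚ)) k) z (ℕ→ℚ k) (invℕ (suc k)))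
  (cong (λ y → - (y * (z - 1ℚ - ℕ→ℚ k) * (invℕ (suc k) * invℕ (suc k)))) (sym (D-h-pred k z)))
  where
  lemma : ∀ b c z κ ι → (b * (z - 1ℚ - κ) * ι) * (c * (- 1ℚ - (z - 1ℚ) - κ) * ι) ≡ - (b * c * (z + κ) * (z - 1ℚ - κ) * (ι * ι))
  lemma = solve-∀ ℚ-ring

-- Both terms contain z D k z/(k+1)², with cofactors z + k + 1 and z - 1 - k. These add up to 2z,
-- and z² D k z/(k+1)² is the decrement of D.
h-pair : ∀ k z → h z (suc k) + h (z - 1ℚ) (suc k) ≡ 2ℚ * (D (suc k) z - D k z)
h-pair k z = trans (cong₂ _+_ (h-suc k z) (h-pred-suc k z)) (lemma z (D k z) (ℕ→ℚ k) (invℕ (suc k)))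
  where
  lemma : ∀ z d κ ι → - (z * d * (z + κ + 1ℚ) * (ι * ι)) + - (z * d * (z - 1ℚ - κ) * (ι * ι))
    ≡ 2ℚ * (d * (1ℚ - z * z * (ι * ι)) - d)
  lemma = solve-∀ ℚ-ring

Σh-pair : ∀ n z → ΣQ (suc n) (h z) + ΣQ (suc n) (h (z - 1ℚ)) ≡ 2ℚ * D n z
Σh-pair zero    z = refl
Σh-pair (suc n) z = begin
  (ΣQ (suc n) (h z) + h z (suc n)) + (ΣQ (suc n) (h (z - 1ℚ)) + h (z - 1ℚ) (suc n))
    ≡⟨ interchange (ΣQ (suc n) (h z)) (h z (suc n)) (ΣQ (suc n) (h (z - 1ℚ))) (h (z - 1ℚ) (suc n)) ⟩
  (ΣQ (suc n) (h z) + ΣQ (suc n) (h (z - 1ℚ))) + (h z (suc n) + h (z - 1ℚ) (suc n))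
    ≡⟨ cong₂ _+_ (Σh-pair n z) (h-pair n z) ⟩
  2ℚ * D n z + 2ℚ * (D (suc n) z - D n z)
    ≡⟨ telescope (D n z) (D (suc n) z) ⟩
  2ℚ * D (suc n) z
    ∎
  where
  open ≡-Reasoning
  interchange : ∀ a b c d → (a + b) + (c + d) ≡ (a + c) + (b + d)
  interchange = solve-∀ ℚ-ring
  telescope : ∀ a b → 2ℚ * a + 2ℚ * (b - a) ≡ 2ℚ * b
  telescope = solve-∀ ℚ-ring

H₂ : ℕ → ℚ
H₂ n = ΣQ n λ k → invℕ (suc k) * invℕ (suc k)

-- Summation by parts: the increment 1/(k+1)² of H₂ times z² D k z is minus the increment of D, so
-- the remaining sum telescopes to D n z - 1.
ΣH₂-D : ∀ n z → z * z * ΣQ n (λ k → H₂ (suc k) * (D (suc k) z - D k z)) ≡ z * z * H₂ n * D n z - 1ℚ + D n z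
ΣH₂-D zero z = lemma z
  where
  lemma : ∀ z → z * z * 0ℚ ≡ z * z * 0ℚ * 1ℚ - 1ℚ + 1ℚ
  lemma = solve-∀ ℚ-ring
ΣH₂-D (suc n) z = begin
  z * z * (T + X)
    ≡⟨ ℚ.*-distribˡ-+ (z * z) T X ⟩
  z * z * T + z * z * X
    ≡⟨ cong (_+ z * z * X) (ΣH₂-D n z) ⟩
  z * z * H₂ n * D n z - 1ℚ + D n z + z * z * X
    ≡⟨ lemma z (H₂ n) (D n z) (invℕ (suc n)) ⟩
  z * z * H₂ (suc n) * D (suc n) z - 1ℚ + D (suc n) z
    ∎
  where
  open ≡-Reasoning
  T X : ℚ
  T = ΣQ n (λ k → H₂ (suc k) * (D (suc k) z - D k z))
  X = H₂ (suc n) * (D (suc n) z - D n z)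
  lemma : ∀ z H d ι → z * z * H * d - 1ℚ + d + z * z * ((H + ι * ι) * (d * (1ℚ - z * z * (ι * ι)) - d))
    ≡ z * z * (H + ι * ι) * (d * (1ℚ - z * z * (ι * ι))) - 1ℚ + d * (1ℚ - z * z * (ι * ι))
  lemma = solve-∀ ℚ-ring

-- Binomial coefficients and summation over n

binom-absorb : ∀ k z → binom (z + 1ℚ) (suc k) ≡ binom z k * (z + 1ℚ) * invℕ (suc k)
binom-absorb zero    z = lemma z
  where
  lemma : ∀ z → 1ℚ * (z + 1ℚ - 0ℚ) * 1ℚ ≡ 1ℚ * (z + 1ℚ) * 1ℚ
  lemma = solve-∀ ℚ-ring
binom-absorb (suc k) z = begin
  binom (z + 1ℚ) (suc k) * (z + 1ℚ - ℕ→ℚ (suc k)) * ι′      ≡⟨ cong₂ (λ b x → b * (z + 1ℚ - x) * ι′) (binom-absorb k z) (ℕ→ℚ-suc k) ⟩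
  binom z k * (z + 1ℚ) * ι * (z + 1ℚ - (ℕ→ℚ k + 1ℚ)) * ι′   ≡⟨ lemma (binom z k) z (ℕ→ℚ k) ι ι′ ⟩
  binom z (suc k) * (z + 1ℚ) * ι′                           ∎
  where
  open ≡-Reasoning
  ι ι′ : ℚ
  ι  = invℕ (suc k)
  ι′ = invℕ (2 ℕ.+ k)
  lemma : ∀ b z κ ι ι′ → b * (z + 1ℚ) * ι * (z + 1ℚ - (κ + 1ℚ)) * ι′ ≡ b * (z - κ) * ι * (z + 1ℚ) * ι′
  lemma = solve-∀ ℚ-ring

binom-pascal : ∀ k z → binom (z + 1ℚ) (suc k) ≡ binom z k + binom z (suc k)
binom-pascal k z = begin
  binom (z + 1ℚ) (suc k)                              ≡⟨ binom-absorb k z ⟩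
  b * (z + 1ℚ) * ι                                    ≡⟨ lemma b z (ℕ→ℚ k) ι ⟩
  b * (ι * (ℕ→ℚ k + 1ℚ)) + b * (z - ℕ→ℚ k) * ι        ≡⟨ cong (λ u → b * u + b * (z - ℕ→ℚ k) * ι) (invℕ-suc k) ⟩
  b * 1ℚ + b * (z - ℕ→ℚ k) * ι                        ≡⟨ cong (_+ b * (z - ℕ→ℚ k) * ι) (ℚ.*-identityʳ b) ⟩
  b + b * (z - ℕ→ℚ k) * ι                             ∎
  where
  open ≡-Reasoning
  b ι : ℚ
  b = binom z k
  ι = invℕ (suc k)
  lemma : ∀ b z κ ι → b * (z + 1ℚ) * ι ≡ b * (ι * (κ + 1ℚ)) + b * (z - κ) * ι
  lemma = solve-∀ ℚ-ring

binom-0 : ∀ k → binom 0ℚ (suc k) ≡ 0ℚ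
binom-0 zero    = refl
binom-0 (suc k) = trans (cong (λ b → b * (0ℚ - ℕ→ℚ (suc k)) * invℕ (2 ℕ.+ k)) (binom-0 k))
  (lemma (0ℚ - ℕ→ℚ (suc k)) (invℕ (2 ℕ.+ k)))
  where
  lemma : ∀ x y → 0ℚ * x * y ≡ 0ℚ
  lemma = solve-∀ ℚ-ring

C≡binom : ∀ n k → ℕ→ℚ (n C k) ≡ binom (ℕ→ℚ n) k
C≡binom n       zero    = refl
C≡binom zero    (suc k) = trans (cong ℕ→ℚ (k>n⇒nCk≡0 {0} {suc k} (s≤s z≤n))) (sym (binom-0 k))
C≡binom (suc n) (suc k) = begin
  ℕ→ℚ (suc n C suc k)                            ≡⟨ cong ℕ→ℚ (nCk+nC[k+1]≡[n+1]C[k+1] n k) ⟨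
  ℕ→ℚ (n C k ℕ.+ n C suc k)                      ≡⟨ ℕ→ℚ-+ (n C k) (n C suc k) ⟩
  ℕ→ℚ (n C k) + ℕ→ℚ (n C suc k)                  ≡⟨ cong₂ _+_ (C≡binom n k) (C≡binom n (suc k)) ⟩
  binom (ℕ→ℚ n) k + binom (ℕ→ℚ n) (suc k)        ≡⟨ binom-pascal k (ℕ→ℚ n) ⟨
  binom (ℕ→ℚ n + 1ℚ) (suc k)                     ≡⟨ cong (λ x → binom x (suc k)) (ℕ→ℚ-suc n) ⟨
  binom (ℕ→ℚ (suc n)) (suc k)                    ∎
  where open ≡-Reasoning

binom-neg : ∀ k z → binom (- 1ℚ - z) k ≡ sgn k * binom (z + ℕ→ℚ k) k
binom-neg zero    z = refl
binom-neg (suc k) z = begin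
  binom (- 1ℚ - z) k * (- 1ℚ - z - κ) * ι             ≡⟨ cong (λ b → b * (- 1ℚ - z - κ) * ι) (binom-neg k z) ⟩
  sgn k * binom (z + κ) k * (- 1ℚ - z - κ) * ι        ≡⟨ lemma (sgn k) (binom (z + κ) k) z κ ι ⟩
  sgn k * - 1ℚ * (binom (z + κ) k * (z + κ + 1ℚ) * ι) ≡⟨ cong (sgn (suc k) *_) (binom-absorb k (z + κ)) ⟨
  sgn (suc k) * binom (z + κ + 1ℚ) (suc k)            ≡⟨ cong (λ y → sgn (suc k) * binom y (suc k)) (trans (ℚ.+-assoc z κ 1ℚ) (cong (_+_ z) (sym (ℕ→ℚ-suc k)))) ⟩
  sgn (suc k) * binom (z + ℕ→ℚ (suc k)) (suc k)       ∎
  where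
  open ≡-Reasoning
  κ ι : ℚ
  κ = ℕ→ℚ k
  ι = invℕ (suc k)
  lemma : ∀ s b z κ ι → s * b * (- 1ℚ - z - κ) * ι ≡ s * - 1ℚ * (b * (z + κ + 1ℚ) * ι)
  lemma = solve-∀ ℚ-ring

-- The given factor (-1)ᵏ C(n+k, k) is C(-1-n, k), which makes n and x enter symmetrically.
V≡Σh : ∀ n x → V n x ≡ ΣQ (suc n) λ k → h (ℕ→ℚ n) k * h x k
V≡Σh n x = ΣQ-cong (suc n) λ k _ → begin
  ℕ→ℚ (n C k) * ℕ→ℚ ((n ℕ.+ k) C k) * sgn k * binom x k * binom (- 1ℚ - x) k
    ≡⟨ lemma (ℕ→ℚ (n C k)) (ℕ→ℚ ((n ℕ.+ k) C k)) (sgn k) (binom x k) (binom (- 1ℚ - x) k) ⟩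
  ℕ→ℚ (n C k) * (sgn k * ℕ→ℚ ((n ℕ.+ k) C k)) * h x k
    ≡⟨ cong₂ (λ a b → a * (sgn k * b) * h x k) (C≡binom n k) (trans (C≡binom (n ℕ.+ k) k) (cong (λ y → binom y k) (ℕ→ℚ-+ n k))) ⟩
  binom (ℕ→ℚ n) k * (sgn k * binom (ℕ→ℚ n + ℕ→ℚ k) k) * h x k
    ≡⟨ cong (λ b → binom (ℕ→ℚ n) k * b * h x k) (binom-neg k (ℕ→ℚ n)) ⟨
  h (ℕ→ℚ n) k * h x k
    ∎
  where
  open ≡-Reasoning
  lemma : ∀ a b s c d → a * b * s * c * d ≡ a * (s * b) * (c * d)
  lemma = solve-∀ ℚ-ring

-- Compare coefficients of `h x k`. By `D-h` and `D-h-pred`, N D k N and (N+1) D k (N+1) are h N k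
-- times N - k and N + 1 + k. The two cofactors add up to 2N + 1, so the alternating sum over n
-- telescopes.
Σ[2n+1]V : ∀ N x → ΣQ N (λ n → ℕ→ℚ (2 ℕ.* n ℕ.+ 1) * sgn n * V n x) ≡
  - sgn N * (ℕ→ℚ N * ΣQ N (λ k → D k (ℕ→ℚ N) * h x k))
Σ[2n+1]V zero    x = refl
Σ[2n+1]V (suc N) x = begin
  ΣQ N (λ n → ℕ→ℚ (2 ℕ.* n ℕ.+ 1) * sgn n * V n x) + ℕ→ℚ (2 ℕ.* N ℕ.+ 1) * σ * V N x
    ≡⟨ cong₂ _+_ (Σ[2n+1]V N x) (cong₂ (λ y v → y * σ * v) (trans (ℕ→ℚ-+ (2 ℕ.* N) 1) (cong (_+ 1ℚ) (ℕ→ℚ-* 2 N))) (V≡Σh N x)) ⟩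
  - σ * (ν * ΣQ N (f ν)) + (2ℚ * ν + 1ℚ) * σ * ΣQ (suc N) g
    ≡⟨ cong (λ y → - σ * y + (2ℚ * ν + 1ℚ) * σ * ΣQ (suc N) g) extend ⟩
  - σ * ΣQ (suc N) (λ k → ν * f ν k) + (2ℚ * ν + 1ℚ) * σ * ΣQ (suc N) g
    ≡⟨ cong₂ _+_ (ΣQ-*ˡ (- σ) (suc N) (λ k → ν * f ν k)) (ΣQ-*ˡ ((2ℚ * ν + 1ℚ) * σ) (suc N) g) ⟨
  ΣQ (suc N) (λ k → - σ * (ν * f ν k)) + ΣQ (suc N) (λ k → (2ℚ * ν + 1ℚ) * σ * g k)
    ≡⟨ ΣQ-+ (suc N) (λ k → - σ * (ν * f ν k)) (λ k → (2ℚ * ν + 1ℚ) * σ * g k) ⟨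
  ΣQ (suc N) (λ k → - σ * (ν * f ν k) + (2ℚ * ν + 1ℚ) * σ * g k)
    ≡⟨ ΣQ-cong (suc N) (λ k _ → term k) ⟩
  ΣQ (suc N) (λ k → - sgn (suc N) * ((ν + 1ℚ) * f (ν + 1ℚ) k))
    ≡⟨ ΣQ-*ˡ (- sgn (suc N)) (suc N) (λ k → (ν + 1ℚ) * f (ν + 1ℚ) k) ⟩
  - sgn (suc N) * ΣQ (suc N) (λ k → (ν + 1ℚ) * f (ν + 1ℚ) k)
    ≡⟨ cong (- sgn (suc N) *_) (ΣQ-*ˡ (ν + 1ℚ) (suc N) (f (ν + 1ℚ))) ⟩
  - sgn (suc N) * ((ν + 1ℚ) * ΣQ (suc N) (f (ν + 1ℚ)))
    ≡⟨ cong (λ y → - sgn (suc N) * (y * ΣQ (suc N) (f y))) (ℕ→ℚ-suc N) ⟨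
  - sgn (suc N) * (ℕ→ℚ (suc N) * ΣQ (suc N) (f (ℕ→ℚ (suc N))))
    ∎
  where
  open ≡-Reasoning
  ν σ : ℚ
  ν = ℕ→ℚ N
  σ = sgn N
  f : ℚ → ℕ → ℚ
  f z k = D k z * h x k
  g : ℕ → ℚ
  g k = h ν k * h x k
  -- The range grows by one at no cost: by `D-h` the term k = N contains the factor N - N.
  extend : ν * ΣQ N (f ν) ≡ ΣQ (suc N) (λ k → ν * f ν k)
  extend = begin
    ν * ΣQ N (f ν)                          ≡⟨ ΣQ-*ˡ ν N (f ν) ⟨
    ΣQ N (λ k → ν * f ν k)                  ≡⟨ ℚ.+-identityʳ _ ⟨
    ΣQ N (λ k → ν * f ν k) + 0ℚ             ≡⟨ cong (_+_ (ΣQ N (λ k → ν * f ν k))) (begin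
      ν * (D N ν * h x N)                     ≡⟨ ℚ.*-assoc ν (D N ν) (h x N) ⟨
      ν * D N ν * h x N                       ≡⟨ cong (_* h x N) (D-h N ν) ⟩
      h ν N * (ν - ν) * h x N                 ≡⟨ vanish (h ν N) ν (h x N) ⟩
      0ℚ                                      ∎) ⟨
    ΣQ (suc N) (λ k → ν * f ν k)            ∎
    where
    vanish : ∀ a ν b → a * (ν - ν) * b ≡ 0ℚ
    vanish = solve-∀ ℚ-ring
  term : ∀ k → - σ * (ν * f ν k) + (2ℚ * ν + 1ℚ) * σ * g k ≡ - sgn (suc N) * ((ν + 1ℚ) * f (ν + 1ℚ) k)
  term k = begin
    - σ * (ν * f ν k) + (2ℚ * ν + 1ℚ) * σ * g k
      ≡⟨ lemma₁ σ ν (D k ν) (h ν k) (h x k) ⟩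
    σ * ((2ℚ * ν + 1ℚ) * h ν k - ν * D k ν) * h x k
      ≡⟨ cong (λ y → σ * ((2ℚ * ν + 1ℚ) * h ν k - y) * h x k) (D-h k ν) ⟩
    σ * ((2ℚ * ν + 1ℚ) * h ν k - h ν k * (ν - ℕ→ℚ k)) * h x k
      ≡⟨ lemma₂ σ ν (ℕ→ℚ k) (h ν k) (h x k) ⟩
    - (σ * - 1ℚ) * (h ν k * (ν + 1ℚ + ℕ→ℚ k) * h x k)
      ≡⟨ cong (λ y → - (σ * - 1ℚ) * (h y k * (ν + 1ℚ + ℕ→ℚ k) * h x k)) (+1-1 ν) ⟨
    - (σ * - 1ℚ) * (h (ν + 1ℚ - 1ℚ) k * (ν + 1ℚ + ℕ→ℚ k) * h x k)
      ≡⟨ cong (λ y → - (σ * - 1ℚ) * (y * h x k)) (D-h-pred k (ν + 1ℚ)) ⟨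
    - (σ * - 1ℚ) * ((ν + 1ℚ) * D k (ν + 1ℚ) * h x k)
      ≡⟨ cong (- sgn (suc N) *_) (ℚ.*-assoc (ν + 1ℚ) (D k (ν + 1ℚ)) (h x k)) ⟩
    - sgn (suc N) * ((ν + 1ℚ) * f (ν + 1ℚ) k)
      ∎
    where
    lemma₁ : ∀ σ ν d a b → - σ * (ν * (d * b)) + (2ℚ * ν + 1ℚ) * σ * (a * b) ≡ σ * ((2ℚ * ν + 1ℚ) * a - ν * d) * b
    lemma₁ = solve-∀ ℚ-ring
    lemma₂ : ∀ σ ν κ a b → σ * ((2ℚ * ν + 1ℚ) * a - a * (ν - κ)) * b ≡ - (σ * - 1ℚ) * (a * (ν + 1ℚ + κ) * b)
    lemma₂ = solve-∀ ℚ-ring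

h-sym : ∀ k z → h (- 1ℚ - z) k ≡ h z k
h-sym k z = trans (ℚ.*-comm (binom (- 1ℚ - z) k) (binom (- 1ℚ - (- 1ℚ - z)) k))
  (cong (λ y → binom y k * binom (- 1ℚ - z) k) (lemma z))
  where
  lemma : ∀ z → - 1ℚ - (- 1ℚ - z) ≡ z
  lemma = solve-∀ ℚ-ring

D-vanish : ∀ n j → j < n → D n (ℕ→ℚ (suc j)) ≡ 0ℚ
D-vanish (suc n) j j<1+n = [ earlier , last ]′ (ℕ.m≤n⇒m<n∨m≡n (ℕ.s≤s⁻¹ j<1+n))
  where
  z : ℚ
  z = ℕ→ℚ (suc j)
  factor : ℕ → ℚ
  factor i = 1ℚ - z * z * (invℕ (suc i) * invℕ (suc i))
  lemma : ∀ z ι → 1ℚ - z * z * (ι * ι) ≡ 1ℚ - (ι * z) * (ι * z)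
  lemma = solve-∀ ℚ-ring
  earlier : j < n → D n z * factor n ≡ 0ℚ
  earlier j<n = trans (cong (_* factor n) (D-vanish n j j<n)) (ℚ.*-zeroˡ (factor n))
  last : j ≡ n → D n z * factor n ≡ 0ℚ
  last j≡n = begin
    D n z * factor n    ≡⟨ cong (λ i → D n z * factor i) j≡n ⟨
    D n z * factor j    ≡⟨ cong (D n z *_) (trans (lemma z (invℕ (suc j))) (cong (λ u → 1ℚ - u * u) (invℕ-inverse j))) ⟩
    D n z * 0ℚ          ≡⟨ ℚ.*-zeroʳ (D n z) ⟩
    0ℚ                  ∎
    where open ≡-Reasoning

ℕ→ℚ-pred : ∀ j → ℕ→ℚ (suc j) - 1ℚ ≡ ℕ→ℚ j
ℕ→ℚ-pred j = trans (cong (_- 1ℚ) (ℕ→ℚ-suc j)) (+1-1 (ℕ→ℚ j))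

-- By `Σh-pair` the sum changes sign from j to j + 1, because D m (j+1) has the factor 1 -
-- (j+1)²/(j+1)² as soon as j < m.
Σh-nat : ∀ m j → j ℕ.≤ m → ΣQ (suc m) (h (ℕ→ℚ j)) ≡ sgn j
Σh-nat m zero _ = trans (ΣQ-head m (h 0ℚ)) (cong (_+_ 1ℚ)
  (ΣQ-zero m λ k _ → trans (cong (_* binom (- 1ℚ - 0ℚ) (suc k)) (binom-0 k)) (ℚ.*-zeroˡ (binom (- 1ℚ - 0ℚ) (suc k)))))
Σh-nat m (suc j) j<m = begin
  A (ℕ→ℚ (suc j))                                         ≡⟨ add-sub (A (ℕ→ℚ (suc j))) (A (ℕ→ℚ (suc j) - 1ℚ)) ⟩
  A (ℕ→ℚ (suc j)) + A (ℕ→ℚ (suc j) - 1ℚ) - A (ℕ→ℚ (suc j) - 1ℚ)  ≡⟨ cong₂ _-_ (Σh-pair m (ℕ→ℚ (suc j))) (cong A (ℕ→ℚ-pred j)) ⟩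
  2ℚ * D m (ℕ→ℚ (suc j)) - A (ℕ→ℚ j)                      ≡⟨ cong₂ (λ d a → 2ℚ * d - a) (D-vanish m j j<m) (Σh-nat m j (ℕ.<⇒≤ j<m)) ⟩
  2ℚ * 0ℚ - sgn j                                         ≡⟨ lemma (sgn j) ⟩
  sgn j * - 1ℚ                                            ∎
  where
  open ≡-Reasoning
  A : ℚ → ℚ
  A z = ΣQ (suc m) (h z)
  add-sub : ∀ a b → a ≡ a + b - b
  add-sub = solve-∀ ℚ-ring
  lemma : ∀ s → 2ℚ * 0ℚ - s ≡ s * - 1ℚ
  lemma = solve-∀ ℚ-ring

H₁ : ℕ → ℚ
H₁ n = ΣQ n λ k → invℕ (suc k)

ΣQ-telescope : ∀ n (f : ℕ → ℚ) → ΣQ n (λ k → f (suc k) - f k) ≡ f n - f 0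
ΣQ-telescope zero    f = sym (ℚ.+-inverseʳ (f 0))
ΣQ-telescope (suc n) f = trans (cong (_+ (f (suc n) - f n)) (ΣQ-telescope n f)) (lemma (f n) (f 0) (f (suc n)))
  where
  lemma : ∀ a b c → a - b + (c - a) ≡ c - b
  lemma = solve-∀ ℚ-ring

eulerPoly-pair : ∀ l z → let n = 2 ℕ.* l in eulerPoly n (- z) + eulerPoly n (- (z - 1ℚ)) ≡ 2ℚ * z ^Q n
eulerPoly-pair l z = begin
  eulerPoly n (- z) + eulerPoly n (- (z - 1ℚ))
    ≡⟨ cong₂ _+_ (trans (eulerPoly≡umbral n (- z)) (cong (λ t → ½ ^Q n * e t) (arg₁ z)))
                 (trans (eulerPoly≡umbral n (- (z - 1ℚ))) (cong (λ t → ½ ^Q n * e t) (arg₂ z))) ⟩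
  ½ ^Q n * e (- 1ℚ + u) + ½ ^Q n * e (1ℚ + u)     ≡⟨ factor (½ ^Q n) (e (- 1ℚ + u)) (e (1ℚ + u)) ⟩
  ½ ^Q n * (e (1ℚ + u) + e (- 1ℚ + u))            ≡⟨ cong (½ ^Q n *_) (umbral-euler-shift n u) ⟩
  ½ ^Q n * (2ℚ * u ^Q n)                          ≡⟨ swap (½ ^Q n) (u ^Q n) ⟩
  2ℚ * (½ ^Q n * u ^Q n)                          ≡⟨ cong (2ℚ *_) (^Q-distribʳ-* ½ u n) ⟨
  2ℚ * (½ * u) ^Q n                               ≡⟨ cong (λ t → 2ℚ * t ^Q n) (halve z) ⟩
  2ℚ * (- 1ℚ * z) ^Q n                            ≡⟨ cong (2ℚ *_) (^Q-distribʳ-* (- 1ℚ) z n) ⟩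
  2ℚ * (sgn n * z ^Q n)                           ≡⟨ cong (λ s → 2ℚ * (s * z ^Q n)) (sgn-even l) ⟩
  2ℚ * (1ℚ * z ^Q n)                              ≡⟨ cong (2ℚ *_) (ℚ.*-identityˡ (z ^Q n)) ⟩
  2ℚ * z ^Q n                                     ∎
  where
  open ≡-Reasoning
  n : ℕ
  n = 2 ℕ.* l
  u : ℚ
  u = - 2ℚ * z
  e : ℚ → ℚ
  e t = umbral n eulerQ t
  arg₁ : ∀ z → 2ℚ * - z - 1ℚ ≡ - 1ℚ + - 2ℚ * z
  arg₁ = solve-∀ ℚ-ring
  arg₂ : ∀ z → 2ℚ * - (z - 1ℚ) - 1ℚ ≡ 1ℚ + - 2ℚ * z
  arg₂ = solve-∀ ℚ-ring
  factor : ∀ c a b → c * a + c * b ≡ c * (b + a)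
  factor = solve-∀ ℚ-ring
  swap : ∀ a b → a * (2ℚ * b) ≡ 2ℚ * (a * b)
  swap = solve-∀ ℚ-ring
  halve : ∀ z → ½ * (- 2ℚ * z) ≡ - 1ℚ * z
  halve = solve-∀ ℚ-ring

-- Residue classes of primes, signs and quotients

prime⇒∤ : ∀ {p} d → Prime p → 1 < d → d < p → ¬ d ∣ p
prime⇒∤ d pp 1<d d<p d∣p with prime⇒irreducible pp d∣p
... | inj₁ d≡1 = ℕ.<⇒≢ 1<d (sym d≡1)
... | inj₂ d≡p = ℕ.<⇒≢ d<p d≡p

-- In this shape `p ∸ 3` computes to an even number that is visibly positive, as required for
-- Eₚ₋₃(0) = 0.
prime>3⇒odd : ∀ {p} → Prime p → 3 < p → ∃ λ l → p ≡ 3 ℕ.+ 2 ℕ.* suc l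
prime>3⇒odd {p} pp 3<p with even⊎odd p
... | inj₁ (k , refl)           = contradiction (divides k (ℕ.*-comm 2 k)) (prime⇒∤ 2 pp (s≤s (s≤s z≤n)) (ℕ.<⇒≤ 3<p))
... | inj₂ (0 , refl)           = contradiction 3<p λ { (s≤s ()) }
... | inj₂ (1 , refl)           = contradiction 3<p λ { (s≤s (s≤s (s≤s ()))) }
... | inj₂ (suc (suc l) , refl) = l , cong (3 ℕ.+_) (ℕ.+-suc l (suc (l ℕ.+ 0)))

prime>3-mod-6 : ∀ {p} → Prime p → 3 < p → (∃ λ q → p ≡ 1 ℕ.+ q ℕ.* 6) ⊎ (∃ λ q → p ≡ 5 ℕ.+ q ℕ.* 6)
prime>3-mod-6 {p} pp 3<p with p divMod 6
... | result q zero eq = contradiction (divides (q ℕ.* 3) (trans eq (sym (ℕ.*-assoc q 3 2)))) 2∤p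
  where 2∤p = prime⇒∤ 2 pp (s≤s (s≤s z≤n)) (ℕ.<⇒≤ 3<p)
... | result q (suc zero) eq = inj₁ (q , eq)
... | result q (suc (suc zero)) eq = contradiction (divides (1 ℕ.+ q ℕ.* 3) (trans eq (cong (2 ℕ.+_) (sym (ℕ.*-assoc q 3 2))))) 2∤p
  where 2∤p = prime⇒∤ 2 pp (s≤s (s≤s z≤n)) (ℕ.<⇒≤ 3<p)
... | result q (suc (suc (suc zero))) eq = contradiction (divides (1 ℕ.+ q ℕ.* 2) (trans eq (cong (3 ℕ.+_) (sym (ℕ.*-assoc q 2 3))))) 3∤p
  where 3∤p = prime⇒∤ 3 pp (s≤s (s≤s z≤n)) 3<p
... | result q (suc (suc (suc (suc zero)))) eq = contradiction (divides (2 ℕ.+ q ℕ.* 3) (trans eq (cong (4 ℕ.+_) (sym (ℕ.*-assoc q 3 2))))) 2∤p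
  where 2∤p = prime⇒∤ 2 pp (s≤s (s≤s z≤n)) (ℕ.<⇒≤ 3<p)
... | result q (suc (suc (suc (suc (suc zero))))) eq = inj₂ (q , eq)

odd-mod-4 : ∀ l → let p = 3 ℕ.+ 2 ℕ.* suc l in (∃ λ q → p ≡ 1 ℕ.+ q ℕ.* 4) ⊎ (∃ λ q → p ≡ 3 ℕ.+ q ℕ.* 4)
odd-mod-4 l with even⊎odd (suc l)
... | inj₁ (q , eq) = inj₂ (q , cong (3 ℕ.+_) (trans (cong (2 ℕ.*_) eq) (trans (sym (ℕ.*-assoc 2 2 q)) (ℕ.*-comm 4 q))))
... | inj₂ (q , eq) = inj₁ (suc q , cong (3 ℕ.+_) (trans (cong (2 ℕ.*_) eq)
  (trans (ℕ.*-suc 2 (2 ℕ.* q)) (cong (2 ℕ.+_) (trans (sym (ℕ.*-assoc 2 2 q)) (ℕ.*-comm 4 q))))))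

[r+k*d]/d≡r/d+k : ∀ r k d .{{_ : ℕ.NonZero d}} → (r ℕ.+ k ℕ.* d) / d ≡ r / d ℕ.+ k
[r+k*d]/d≡r/d+k r k d = trans (+-distrib-/-∣ʳ r (n∣m*n k)) (cong (r / d ℕ.+_) (m*n/n≡m k d))

sgn-2+ : ∀ n → sgn (2 ℕ.+ n) ≡ sgn n
sgn-2+ n = lemma (sgn n)
  where
  lemma : ∀ s → s * - 1ℚ * - 1ℚ ≡ s
  lemma = solve-∀ ℚ-ring

sgn-+2* : ∀ r q → sgn (r ℕ.+ 2 ℕ.* q) ≡ sgn r
sgn-+2* r q = trans (^Q-+ (- 1ℚ) r (2 ℕ.* q)) (trans (cong (sgn r *_) (sgn-even q)) (ℚ.*-identityʳ (sgn r)))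

ℕ→ℚ-affine : ∀ r q d → ℕ→ℚ (r ℕ.+ q ℕ.* d) ≡ ℕ→ℚ r + ℕ→ℚ q * ℕ→ℚ d
ℕ→ℚ-affine r q d = trans (ℕ→ℚ-+ r (q ℕ.* d)) (cong (_+_ (ℕ→ℚ r)) (ℕ→ℚ-* q d))

twist : ∀ N (a b x : ℚ) → a * b ≡ - 1ℚ →
  ΣQ N (λ n → ℕ→ℚ (2 ℕ.* n ℕ.+ 1) * (a ^Q n * V n x) * b ^Q n) ≡ ΣQ N (λ n → ℕ→ℚ (2 ℕ.* n ℕ.+ 1) * sgn n * V n x)
twist N a b x ab≡-1 = ΣQ-cong N λ n _ → begin
  ℕ→ℚ (2 ℕ.* n ℕ.+ 1) * (a ^Q n * V n x) * b ^Q n    ≡⟨ lemma (ℕ→ℚ (2 ℕ.* n ℕ.+ 1)) (a ^Q n) (b ^Q n) (V n x) ⟩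
  ℕ→ℚ (2 ℕ.* n ℕ.+ 1) * (a ^Q n * b ^Q n) * V n x    ≡⟨ cong (λ y → ℕ→ℚ (2 ℕ.* n ℕ.+ 1) * y * V n x) (^Q-distribʳ-* a b n) ⟨
  ℕ→ℚ (2 ℕ.* n ℕ.+ 1) * (a * b) ^Q n * V n x         ≡⟨ cong (λ y → ℕ→ℚ (2 ℕ.* n ℕ.+ 1) * y ^Q n * V n x) ab≡-1 ⟩
  ℕ→ℚ (2 ℕ.* n ℕ.+ 1) * sgn n * V n x                ∎
  where
  open ≡-Reasoning
  lemma : ∀ c a b v → c * (a * v) * b ≡ c * (a * b) * v
  lemma = solve-∀ ℚ-ring

-- Congruences for the prime p = m + 1

module PrimeModulus {m : ℕ} (pp : Prime (suc m)) where

  open Congruence pp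

  p : ℕ
  p = suc m

  int-ι : ∀ {k} → k < m → Integral p (invℕ (suc k))
  int-ι {k} k<m = int-invℕ k (p∤< (s≤s z≤n) (s≤s k<m))

  int-D : ∀ {k z} → k ℕ.≤ m → Integral p z → Integral p (D k z)
  int-D {zero}  _   iz = int-1
  int-D {suc k} k<m iz = int-* (int-D (ℕ.<⇒≤ k<m) iz)
    (int-sub int-1 (int-* (int-* iz iz) (int-* (int-ι k<m) (int-ι k<m))))

  int-binom : ∀ {k z} → k ℕ.≤ m → Integral p z → Integral p (binom z k)
  int-binom {zero}  _   iz = int-1
  int-binom {suc k} k<m iz = int-* (int-* (int-binom (ℕ.<⇒≤ k<m) iz) (int-sub iz (int-ℕ k))) (int-ι k<m)

  int-h : ∀ {k z} → k ℕ.≤ m → Integral p z → Integral p (h z k)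
  int-h k≤m iz = int-* (int-binom k≤m iz) (int-binom k≤m (int-sub (int-neg int-1) iz))

  int-H₂ : ∀ {k} → k ℕ.≤ m → Integral p (H₂ k)
  int-H₂ {k} k≤m = int-Σ k λ i i<k → int-* (int-ι (ℕ.<-≤-trans i<k k≤m)) (int-ι (ℕ.<-≤-trans i<k k≤m))

  -- The level of the congruence is raised one step at a time, so an inverse of u modulo p suffices.
  ≈-cancel-unit : ∀ {u a b k} → k < m → u ≈ ℕ→ℚ (suc k) [ 1 ] → Integral p a → Integral p b →
    ∀ n → u * a ≈ u * b [ n ] → a ≈ b [ n ]
  ≈-cancel-unit {u} {a} {b} {k} k<m u≈j ia ib zero ua≈ub =
    congruent (a - b) (int-sub ia ib) (lemma a b)
    where
    lemma : ∀ a b → a ≡ b + 1ℚ * (a - b)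
    lemma = solve-∀ ℚ-ring
  ≈-cancel-unit {u} {a} {b} {k} k<m u≈j@(congruent q iq u≡) ia ib (suc n) ua≈ub =
    ≈-cancelˡ (int-ι k<m) (invℕ-inverse k) (subst₂ (λ x y → x ≈ y [ suc n ]) (eq a) (eq b)
      (≈-sub ua≈ub (≈-*ˡ iq (≈-scale (≈-cancel-unit k<m u≈j ia ib n (≈-weaken ua≈ub))))))
    where
    lemma : ∀ j π q x → (j + 1ℚ * π * q) * x - q * (π * x) ≡ j * x
    lemma = solve-∀ ℚ-ring
    eq : ∀ x → u * x - q * (π * x) ≡ ℕ→ℚ (suc k) * x
    eq x = trans (cong (λ v → v * x - q * (π * x)) u≡) (lemma (ℕ→ℚ (suc k)) π q x)

  D-≈1 : ∀ k {c} → k ℕ.≤ m → Integral p c → D k (π * c) ≈ 1ℚ [ 2 ]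
  D-≈1 zero    _   _  = ≈-refl
  D-≈1 (suc k) {c} k<m ic = step (D-≈1 k (ℕ.<⇒≤ k<m) ic)
    where
    ι : ℚ
    ι = invℕ (suc k)
    lemma₁ : ∀ d π c ι → d * (1ℚ - π * c * (π * c) * (ι * ι)) ≡ d - π * π * (d * (c * c * (ι * ι)))
    lemma₁ = solve-∀ ℚ-ring
    lemma₂ : ∀ π q x → (1ℚ + 1ℚ * π * π * q) - π * π * x ≡ 1ℚ + 1ℚ * π * π * (q - x)
    lemma₂ = solve-∀ ℚ-ring
    step : D k (π * c) ≈ 1ℚ [ 2 ] → D (suc k) (π * c) ≈ 1ℚ [ 2 ]
    step (congruent q iq eq) = congruent (q - D k (π * c) * (c * c * (ι * ι)))
      (int-sub iq (int-* (int-D (ℕ.<⇒≤ k<m) (int-* (int-ℕ p) ic)) (int-* (int-* ic ic) (int-* (int-ι k<m) (int-ι k<m)))))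
      (trans (lemma₁ (D k (π * c)) π c ι) (trans (cong (_- π * π * (D k (π * c) * (c * c * (ι * ι)))) eq) (lemma₂ π q _)))

  D-≈H₂ : ∀ k → k ℕ.≤ m → D k π ≈ 1ℚ - π * π * H₂ k [ 3 ]
  D-≈H₂ zero    _   = ≈-reflexive (lemma π)
    where
    lemma : ∀ π → 1ℚ ≡ 1ℚ - π * π * 0ℚ
    lemma = solve-∀ ℚ-ring
  D-≈H₂ (suc k) k<m = step (subst (λ y → D k y ≈ 1ℚ [ 2 ]) (ℚ.*-identityʳ π) (D-≈1 k (ℕ.<⇒≤ k<m) int-1)) (D-≈H₂ k (ℕ.<⇒≤ k<m))
    where
    ι : ℚ
    ι = invℕ (suc k)
    lemma₁ : ∀ d π ι → d * (1ℚ - π * π * (ι * ι)) ≡ d - π * π * (d * (ι * ι))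
    lemma₁ = solve-∀ ℚ-ring
    lemma₂ : ∀ π q r H ι → (1ℚ - π * π * H + 1ℚ * π * π * π * r) - π * π * ((1ℚ + 1ℚ * π * π * q) * (ι * ι))
      ≡ 1ℚ - π * π * (H + ι * ι) + 1ℚ * π * π * π * (r - π * (q * (ι * ι)))
    lemma₂ = solve-∀ ℚ-ring
    step : D k π ≈ 1ℚ [ 2 ] → D k π ≈ 1ℚ - π * π * H₂ k [ 3 ] → D (suc k) π ≈ 1ℚ - π * π * H₂ (suc k) [ 3 ]
    step (congruent q iq eq) (congruent r ir eq′) = congruent (r - π * (q * (ι * ι)))
      (int-sub ir (int-* (int-ℕ p) (int-* iq (int-* (int-ι k<m) (int-ι k<m)))))
      (trans (lemma₁ (D k π) π ι) (trans (cong₂ (λ x y → x - π * π * (y * (ι * ι))) eq′ eq) (lemma₂ π q r (H₂ k) ι)))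

  -- For y divisible by p, `h-suc` gives h y (k+1) = -y D k y (y + k + 1)/(k+1)², so D and the
  -- weight W matter only modulo p². Weight 1 serves for the harmonic sums, weight D k p for T.
  Σh-near-0 : ∀ (W : ℕ → ℚ) {c} → W 0 ≡ 1ℚ → (∀ k → k ℕ.≤ m → W k ≈ 1ℚ [ 2 ]) → Integral p c →
    ΣQ (suc m) (λ k → W k * h (π * c) k) ≈ 1ℚ - (π * c * H₁ m + π * c * (π * c) * H₂ m) [ 3 ]
  Σh-near-0 W {c} W0 W≈1 ic = begin
    ΣQ (suc m) (λ k → W k * h y k)
      ≡⟨ trans (ΣQ-head m _) (cong (λ w → w * h y 0 + ΣQ m (λ k → W (suc k) * h y (suc k))) W0) ⟩
    1ℚ + ΣQ m (λ k → W (suc k) * h y (suc k))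
      ≈⟨ ≈-+ (≈-refl {1ℚ}) (≈-Σ m term) ⟩
    1ℚ + ΣQ m (λ k → - y * ι k + - (y * y) * (ι k * ι k))
      ≡⟨ cong (_+_ 1ℚ) (trans (ΣQ-+ m _ _) (cong₂ _+_ (ΣQ-*ˡ (- y) m ι) (ΣQ-*ˡ (- (y * y)) m (λ k → ι k * ι k)))) ⟩
    1ℚ + (- y * H₁ m + - (y * y) * H₂ m)
      ≡⟨ lemma₀ y (H₁ m) (H₂ m) ⟩
    1ℚ - (y * H₁ m + y * y * H₂ m)
      ∎
    where
    open ≈-Reasoning 3
    y : ℚ
    y = π * c
    ι : ℕ → ℚ
    ι k = invℕ (suc k)
    lemma₀ : ∀ y a b → 1ℚ + (- y * a + - (y * y) * b) ≡ 1ℚ - (y * a + y * y * b)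
    lemma₀ = solve-∀ ℚ-ring
    term : ∀ k → k < m → W (suc k) * h y (suc k) ≈ - y * ι k + - (y * y) * (ι k * ι k) [ 3 ]
    term k k<m = expand (W≈1 (suc k) k<m) (D-≈1 k (ℕ.<⇒≤ k<m) ic)
      where
      κ : ℚ
      κ = ℕ→ℚ k
      lemma₁ : ∀ π c q r κ ι →
        (1ℚ + 1ℚ * π * π * q) * - (π * c * (1ℚ + 1ℚ * π * π * r) * (π * c + κ + 1ℚ) * (ι * ι))
        ≡ - (π * c) * (ι * (κ + 1ℚ) * ι) + - (π * c * (π * c)) * (ι * ι)
          + 1ℚ * π * π * π * - ((q + r + π * π * q * r) * (c * (π * c + (κ + 1ℚ)) * (ι * ι)))
      lemma₁ = solve-∀ ℚ-ring
      expand : W (suc k) ≈ 1ℚ [ 2 ] → D k y ≈ 1ℚ [ 2 ] → W (suc k) * h y (suc k) ≈ - y * ι k + - (y * y) * (ι k * ι k) [ 3 ]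
      expand (congruent q iq eq) (congruent r ir eq′) = congruent (- ((q + r + π * π * q * r) * (c * (y + (κ + 1ℚ)) * (ι k * ι k))))
        (int-neg (int-* (int-+ (int-+ iq ir) (int-* (int-* (int-* (int-ℕ p) (int-ℕ p)) iq) ir))
          (int-* (int-* ic (int-+ (int-* (int-ℕ p) ic) (int-+ (int-ℕ k) int-1))) (int-* (int-ι k<m) (int-ι k<m)))))
        (trans (cong₂ _*_ eq (trans (h-suc k y) (cong (λ d → - (y * d * (y + κ + 1ℚ) * (ι k * ι k))) eq′)))
        (trans (lemma₁ π c q r κ (ι k))
          (cong (λ x → - y * x + - (y * y) * (ι k * ι k) + π ^Q 3 * - ((q + r + π * π * q * r) * (c * (y + (κ + 1ℚ)) * (ι k * ι k))))
            (trans (cong (_* ι k) (invℕ-suc k)) (ℚ.*-identityˡ (ι k))))))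

  π≡ : π ≡ ℕ→ℚ m + 1ℚ
  π≡ = ℕ→ℚ-suc m

  H₁-H₂ : sgn m ≡ 1ℚ → H₁ m ≈ π * H₂ m [ 2 ]
  H₁-H₂ even = ≈-unscale (begin
    π * H₁ m
      ≡⟨ lemma₁ π (H₁ m) (H₂ m) ⟩
    (1ℚ - (π * - 1ℚ * H₁ m + π * - 1ℚ * (π * - 1ℚ) * H₂ m)) + (π * (π * H₂ m) - 1ℚ)
      ≈⟨ ≈-+ (≈-sym expansion) ≈-refl ⟩
    1ℚ + (π * (π * H₂ m) - 1ℚ)
      ≡⟨ lemma₂ (π * (π * H₂ m)) ⟩
    π * (π * H₂ m)
      ∎)
    where
    open ≈-Reasoning 3
    lemma₁ : ∀ π a b → π * a ≡ (1ℚ - (π * - 1ℚ * a + π * - 1ℚ * (π * - 1ℚ) * b)) + (π * (π * b) - 1ℚ)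
    lemma₁ = solve-∀ ℚ-ring
    lemma₂ : ∀ x → 1ℚ + (x - 1ℚ) ≡ x
    lemma₂ = solve-∀ ℚ-ring
    reflect : ∀ μ → (μ + 1ℚ) * - 1ℚ ≡ - 1ℚ - μ
    reflect = solve-∀ ℚ-ring
    -- -p = -1 - (p - 1), so the reflection z ↦ -1 - z leads to the natural number p - 1, where the
    -- sum is (-1)^(p-1).
    value : ΣQ (suc m) (λ k → 1ℚ * h (π * - 1ℚ) k) ≡ 1ℚ
    value = trans (ΣQ-cong (suc m) λ k _ → trans (ℚ.*-identityˡ _)
      (trans (cong (λ y → h y k) (trans (cong (_* - 1ℚ) π≡) (reflect (ℕ→ℚ m)))) (h-sym k (ℕ→ℚ m))))
      (trans (Σh-nat m m ℕ.≤-refl) even)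
    expansion : 1ℚ ≈ 1ℚ - (π * - 1ℚ * H₁ m + π * - 1ℚ * (π * - 1ℚ) * H₂ m) [ 3 ]
    expansion = subst (_≈ 1ℚ - (π * - 1ℚ * H₁ m + π * - 1ℚ * (π * - 1ℚ) * H₂ m) [ 3 ]) value (Σh-near-0 (λ _ → 1ℚ) refl (λ _ _ → ≈-refl) (int-neg int-1))

  -- Exactly, 1/k + 1/(p-k) = -p/k² + p²/(k²(p-k)), and the last term supplies the quotient. Summing
  -- over k counts H₁ twice.
  2H₁-H₂ : 2ℚ * H₁ m ≈ - π * H₂ m [ 2 ]
  2H₁-H₂ = reflected m refl
    where
    ι : ℕ → ℚ
    ι k = invℕ (suc k)
    pair : ∀ n → suc n ≡ m → ∀ k → k < suc n → ι k + ι (n ∸ k) ≈ - π * (ι k * ι k) [ 2 ]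
    pair n refl k k<m = congruent (ι k * ι k * ι (n ∸ k)) (int-* (int-* (int-ι k<m) (int-ι k<m)) (int-ι (s≤s (ℕ.m∸n≤m n k))))
      (combine (ι k) (ι (n ∸ k)) (ℕ→ℚ (suc k)) (ℕ→ℚ (suc (n ∸ k))) π (invℕ-inverse k) (invℕ-inverse (n ∸ k)) complement)
      where
      complement : π ≡ ℕ→ℚ (suc k) + ℕ→ℚ (suc (n ∸ k))
      complement = trans (cong ℕ→ℚ (cong suc (trans (cong suc (sym (ℕ.m+[n∸m]≡n (ℕ.s≤s⁻¹ k<m)))) (sym (ℕ.+-suc k (n ∸ k))))))
        (ℕ→ℚ-+ (suc k) (suc (n ∸ k)))
      combine : ∀ x y a b π → x * a ≡ 1ℚ → y * b ≡ 1ℚ → π ≡ a + b →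
        x + y ≡ - π * (x * x) + 1ℚ * π * π * (x * x * y)
      combine x y a b _ xa yb refl = sym (begin
        - (a + b) * (x * x) + 1ℚ * (a + b) * (a + b) * (x * x * y)
          ≡⟨ expand x y a b ⟩
        - (x * a * x) - b * x * x + x * a * (x * a) * y + (x * a * x + x * a * x) * (y * b) + b * x * x * (y * b)
          ≡⟨ cong₂ (λ u v → - (u * x) - b * x * x + u * u * y + (u * x + u * x) * v + b * x * x * v) xa yb ⟩
        - (1ℚ * x) - b * x * x + 1ℚ * 1ℚ * y + (1ℚ * x + 1ℚ * x) * 1ℚ + b * x * x * 1ℚ
          ≡⟨ simplify x y b ⟩
        x + y
          ∎)
        where
        open ≡-Reasoning
        expand : ∀ x y a b → - (a + b) * (x * x) + 1ℚ * (a + b) * (a + b) * (x * x * y)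
          ≡ - (x * a * x) - b * x * x + x * a * (x * a) * y + (x * a * x + x * a * x) * (y * b) + b * x * x * (y * b)
        expand = solve-∀ ℚ-ring
        simplify : ∀ x y b → - (1ℚ * x) - b * x * x + 1ℚ * 1ℚ * y + (1ℚ * x + 1ℚ * x) * 1ℚ + b * x * x * 1ℚ ≡ x + y
        simplify = solve-∀ ℚ-ring
    -- Reversing a sum needs a syntactic successor as its length, hence the auxiliary n equal to m.
    reflected : ∀ n → n ≡ m → 2ℚ * H₁ n ≈ - π * H₂ n [ 2 ]
    reflected zero    _  = ≈-reflexive (lemma π)
      where
      lemma : ∀ π → 2ℚ * 0ℚ ≡ - π * 0ℚ
      lemma = solve-∀ ℚ-ring
    reflected (suc n) eq = begin
      2ℚ * H₁ (suc n)                                   ≡⟨ double (H₁ (suc n)) ⟩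
      H₁ (suc n) + H₁ (suc n)                           ≡⟨ cong (_+_ (H₁ (suc n))) (ΣQ-reverse n ι) ⟨
      H₁ (suc n) + ΣQ (suc n) (λ k → ι (n ∸ k))         ≡⟨ ΣQ-+ (suc n) ι (λ k → ι (n ∸ k)) ⟨
      ΣQ (suc n) (λ k → ι k + ι (n ∸ k))                ≈⟨ ≈-Σ (suc n) (pair n eq) ⟩
      ΣQ (suc n) (λ k → - π * (ι k * ι k))              ≡⟨ ΣQ-*ˡ (- π) (suc n) (λ k → ι k * ι k) ⟩
      - π * H₂ (suc n)                                  ∎
      where
      open ≈-Reasoning 2
      double : ∀ x → 2ℚ * x ≡ x + x
      double = solve-∀ ℚ-ring

  -- Together the two relations between the harmonic sums say 3pH₂ ≡ 0 (mod p²), and 3 is invertible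
  -- because p > 3.
  H₂≈0 : sgn m ≡ 1ℚ → 2 < m → H₂ m ≈ 0ℚ [ 1 ]
  H₂≈0 even 2<m = ≈-cancelˡ {ℕ→ℚ 3} {invℕ 3} (int-ι 2<m) (invℕ-inverse 2) (≈-unscale (begin
    π * (ℕ→ℚ 3 * H₂ m)          ≡⟨ lemma₁ π (H₂ m) ⟩
    2ℚ * (π * H₂ m) + π * H₂ m  ≈⟨ ≈-+ (≈-*ˡ (int-ℕ 2) (≈-sym (H₁-H₂ even))) ≈-refl ⟩
    2ℚ * H₁ m + π * H₂ m        ≈⟨ ≈-+ 2H₁-H₂ ≈-refl ⟩
    - π * H₂ m + π * H₂ m       ≡⟨ lemma₂ π (H₂ m) ⟩
    π * (ℕ→ℚ 3 * 0ℚ)            ∎))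
    where
    open ≈-Reasoning 2
    lemma₁ : ∀ π x → π * (ℕ→ℚ 3 * x) ≡ 2ℚ * (π * x) + π * x
    lemma₁ = solve-∀ ℚ-ring
    lemma₂ : ∀ π x → - π * x + π * x ≡ π * (ℕ→ℚ 3 * 0ℚ)
    lemma₂ = solve-∀ ℚ-ring

  H₁≈0 : sgn m ≡ 1ℚ → 2 < m → H₁ m ≈ 0ℚ [ 2 ]
  H₁≈0 even 2<m = begin
    H₁ m           ≈⟨ H₁-H₂ even ⟩
    π * H₂ m       ≈⟨ ≈-scale (H₂≈0 even 2<m) ⟩
    π * 0ℚ         ≡⟨ ℚ.*-zeroʳ π ⟩
    0ℚ             ∎
    where open ≈-Reasoning 2

  T : ℚ → ℚ
  T z = ΣQ (suc m) λ k → D k π * h z k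

  T-near-0 : sgn m ≡ 1ℚ → 2 < m → ∀ {c} → Integral p c → T (π * c) ≈ 1ℚ [ 3 ]
  T-near-0 even 2<m {c} ic = begin
    T (π * c)
      ≈⟨ Σh-near-0 (λ k → D k π) refl (λ k k≤m → subst (λ y → D k y ≈ 1ℚ [ 2 ]) (ℚ.*-identityʳ π) (D-≈1 k k≤m int-1)) ic ⟩
    1ℚ - (π * c * H₁ m + π * c * (π * c) * H₂ m)
      ≡⟨ lemma₁ π c (H₁ m) (H₂ m) ⟩
    1ℚ - (π * (c * H₁ m) + π * (π * (c * c * H₂ m)))
      ≈⟨ ≈-sub (≈-refl {1ℚ}) (≈-+ (≈-scale (≈-*ˡ ic (H₁≈0 even 2<m))) (≈-scale (≈-scale (≈-*ˡ (int-* ic ic) (H₂≈0 even 2<m))))) ⟩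
    1ℚ - (π * (c * 0ℚ) + π * (π * (c * c * 0ℚ)))
      ≡⟨ lemma₂ π c ⟩
    1ℚ
      ∎
    where
    open ≈-Reasoning 3
    lemma₁ : ∀ π c a b → 1ℚ - (π * c * a + π * c * (π * c) * b) ≡ 1ℚ - (π * (c * a) + π * (π * (c * c * b)))
    lemma₁ = solve-∀ ℚ-ring
    lemma₂ : ∀ π c → 1ℚ - (π * (c * 0ℚ) + π * (π * (c * c * 0ℚ))) ≡ 1ℚ
    lemma₂ = solve-∀ ℚ-ring

  D-shift-p : ∀ z → (z + 1ℚ) * (z + 1ℚ - π) * D m (z + 1ℚ) ≡ z * (z + π) * D m z
  D-shift-p z = begin
    (z + 1ℚ) * (z + 1ℚ - π) * D m (z + 1ℚ)    ≡⟨ cong (λ y → (z + 1ℚ) * y * D m (z + 1ℚ)) (trans (cong (_-_ (z + 1ℚ)) π≡) (lemma₁ z (ℕ→ℚ m))) ⟩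
    (z + 1ℚ) * (z - ℕ→ℚ m) * D m (z + 1ℚ)     ≡⟨ D-shift m z ⟩
    z * (z + 1ℚ + ℕ→ℚ m) * D m z              ≡⟨ cong (λ y → z * y * D m z) (trans (lemma₂ z (ℕ→ℚ m)) (cong (_+_ z) (sym π≡))) ⟩
    z * (z + π) * D m z                       ∎
    where
    open ≡-Reasoning
    lemma₁ : ∀ z μ → z + 1ℚ - (μ + 1ℚ) ≡ z - μ
    lemma₁ = solve-∀ ℚ-ring
    lemma₂ : ∀ z μ → z + 1ℚ + μ ≡ z + (μ + 1ℚ)
    lemma₂ = solve-∀ ℚ-ring

  near-unit : ∀ {c} (a : ℚ) → Integral p c → π * c + a ≈ a [ 1 ]
  near-unit {c} a ic = congruent c ic (lemma π c a)
    where
    lemma : ∀ π c a → π * c + a ≡ a + 1ℚ * π * c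
    lemma = solve-∀ ℚ-ring

  -- By `D-shift-p`, passing from z to z + 1 multiplies z² D by (z+1)(z+p)/(z(z+1-p)), which is ≡ 1
  -- (mod p); a value divisible by p² is therefore unchanged modulo p³. For j = 0 the shift starts
  -- at y = pc, where y (y + p) supplies p² c (c+1).
  z²D-≈ : ∀ j → j < m → ∀ {c} → Integral p c → let z = π * c + ℕ→ℚ (suc j) in
    z * z * D m z ≈ π * π * (c * (c + 1ℚ)) [ 3 ]
  z²D-≈ zero 0<m {c} ic = ≈-cancel-unit 0<m unit (int-* (int-* iz iz) (int-D ℕ.≤-refl iz)) (int-* (int-* (int-ℕ p) (int-ℕ p)) (int-* ic (int-+ ic int-1))) 3 (begin
    (z - π) * (z * z * D m z)                ≡⟨ reorder z π (D m z) ⟩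
    z * (z * (z - π) * D m z)                ≡⟨ cong (z *_) (D-shift-p y) ⟩
    z * (y * (y + π) * D m y)                ≈⟨ near ⟩
    (z - π) * (π * π * (c * (c + 1ℚ)))       ∎)
    where
    open ≈-Reasoning 3
    y z : ℚ
    y = π * c
    z = y + 1ℚ
    iz : Integral p z
    iz = int-+ (int-* (int-ℕ p) ic) int-1
    unit : z - π ≈ 1ℚ [ 1 ]
    unit = subst (_≈ 1ℚ [ 1 ]) (lemma π c) (near-unit 1ℚ (int-sub ic int-1))
      where
      lemma : ∀ π c → π * (c - 1ℚ) + 1ℚ ≡ π * c + 1ℚ - π
      lemma = solve-∀ ℚ-ring
    reorder : ∀ z π d → (z - π) * (z * z * d) ≡ z * (z * (z - π) * d)
    reorder = solve-∀ ℚ-ring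
    near : z * (y * (y + π) * D m y) ≈ (z - π) * (π * π * (c * (c + 1ℚ))) [ 3 ]
    near = expand (D-≈1 m ℕ.≤-refl ic)
      where
      lemma : ∀ π c q → (π * c + 1ℚ) * (π * c * (π * c + π) * (1ℚ + 1ℚ * π * π * q))
        ≡ (π * c + 1ℚ - π) * (π * π * (c * (c + 1ℚ))) + 1ℚ * π * π * π * (c * (c + 1ℚ) * (1ℚ + π * ((π * c + 1ℚ) * q)))
      lemma = solve-∀ ℚ-ring
      expand : D m y ≈ 1ℚ [ 2 ] → z * (y * (y + π) * D m y) ≈ (z - π) * (π * π * (c * (c + 1ℚ))) [ 3 ]
      expand (congruent q iq eq) = congruent (c * (c + 1ℚ) * (1ℚ + π * (z * q)))
        (int-* (int-* ic (int-+ ic int-1)) (int-+ int-1 (int-* (int-ℕ p) (int-* iz iq))))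
        (trans (cong (λ d → z * (y * (y + π) * d)) eq) (lemma π c q))
  z²D-≈ (suc j) 1+j<m {c} ic =
    ≈-cancel-unit j<m (near-unit (ℕ→ℚ (suc j)) ic) iX iW 3
    (≈-cancel-unit 1+j<m unit (int-* iz iX) (int-* iz iW) 3 (begin
      (z′ - π) * (z * (z′ * z′ * D m z′))         ≡⟨ reorder z z′ π (D m z′) ⟩
      z * z′ * (z′ * (z′ - π) * D m z′)           ≡⟨ cong (λ v → z * v * (v * (v - π) * D m v)) z′≡ ⟩
      z * (z + 1ℚ) * ((z + 1ℚ) * (z + 1ℚ - π) * D m (z + 1ℚ))   ≡⟨ cong (z * (z + 1ℚ) *_) (D-shift-p z) ⟩
      z * (z + 1ℚ) * (z * (z + π) * D m z)        ≡⟨ reorder′ z π (D m z) ⟩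
      (z + 1ℚ) * (z + π) * (z * z * D m z)        ≈⟨ ≈-*ˡ (int-* (int-+ iz int-1) (int-+ iz (int-ℕ p))) (z²D-≈ j j<m ic) ⟩
      -- The quotient arises because (z+1)(z+p) and z(z+1-p) differ by p(2z+1).
      (z + 1ℚ) * (z + π) * (π * π * w)            ≈⟨ congruent ((z + z + 1ℚ) * w) (int-* (int-+ (int-+ iz iz) int-1) iw) (lemma z π w) ⟩
      (z + 1ℚ - π) * (z * (π * π * w))            ≡⟨ cong (λ v → (v - π) * (z * (π * π * w))) z′≡ ⟨
      (z′ - π) * (z * (π * π * w))                ∎))
    where
    open ≈-Reasoning 3
    z z′ w : ℚ
    z = π * c + ℕ→ℚ (suc j)
    z′ = π * c + ℕ→ℚ (2 ℕ.+ j)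
    w = c * (c + 1ℚ)
    j<m : j < m
    j<m = ℕ.<⇒≤ 1+j<m
    iz : Integral p z
    iz = int-+ (int-* (int-ℕ p) ic) (int-ℕ (suc j))
    iz′ : Integral p z′
    iz′ = int-+ (int-* (int-ℕ p) ic) (int-ℕ (2 ℕ.+ j))
    iw : Integral p w
    iw = int-* ic (int-+ ic int-1)
    iX : Integral p (z′ * z′ * D m z′)
    iX = int-* (int-* iz′ iz′) (int-D ℕ.≤-refl iz′)
    iW : Integral p (π * π * w)
    iW = int-* (int-* (int-ℕ p) (int-ℕ p)) iw
    z′≡ : z′ ≡ z + 1ℚ
    z′≡ = trans (cong (_+_ (π * c)) (ℕ→ℚ-suc (suc j))) (sym (ℚ.+-assoc (π * c) (ℕ→ℚ (suc j)) 1ℚ))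
    unit : z′ - π ≈ ℕ→ℚ (2 ℕ.+ j) [ 1 ]
    unit = subst (_≈ ℕ→ℚ (2 ℕ.+ j) [ 1 ]) (shift π c (ℕ→ℚ (2 ℕ.+ j))) (near-unit (ℕ→ℚ (2 ℕ.+ j)) (int-sub ic int-1))
      where
      shift : ∀ π c a → π * (c - 1ℚ) + a ≡ π * c + a - π
      shift = solve-∀ ℚ-ring
    reorder : ∀ z v π d → (v - π) * (z * (v * v * d)) ≡ z * v * (v * (v - π) * d)
    reorder = solve-∀ ℚ-ring
    reorder′ : ∀ z π d → z * (z + 1ℚ) * (z * (z + π) * d) ≡ (z + 1ℚ) * (z + π) * (z * z * d)
    reorder′ = solve-∀ ℚ-ring
    lemma : ∀ z π w → (z + 1ℚ) * (z + π) * (π * π * w) ≡ (z + 1ℚ - π) * (z * (π * π * w)) + 1ℚ * π * π * π * ((z + z + 1ℚ) * w)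
    lemma = solve-∀ ℚ-ring

  umbral-≈ : ∀ n {a b x y k} → (∀ i → Integral p (b i)) → (∀ i → a i ≈ b i [ k ]) → Integral p y → x ≈ y [ k ] →
    umbral n a x ≈ umbral n b y [ k ]
  umbral-≈ zero    ib a≈b iy x≈y = a≈b 0
  umbral-≈ (suc n) ib a≈b iy x≈y = umbral-≈ n (λ i → int-+ (int-* iy (ib i)) (ib (suc i)))
    (λ i → ≈-+ (≈-* iy (≈-int (a≈b i) (ib i)) x≈y (a≈b i)) (a≈b (suc i))) iy x≈y

  int-umbral : ∀ n {a x} → (∀ i → Integral p (a i)) → Integral p x → Integral p (umbral n a x)
  int-umbral zero    ia ix = ia 0
  int-umbral (suc n) ia ix = int-umbral n (λ i → int-+ (int-* ix (ia i)) (ia (suc i))) ix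

  T-pair : ∀ j → j < m → ∀ {c} → Integral p c → let z = π * c + ℕ→ℚ (suc j) in
    z * z * (T z + T (z - 1ℚ)) ≈ 2ℚ * (π * (π * (c * (c + 1ℚ) + 1ℚ))) [ 3 ]
  T-pair j j<m {c} ic = begin
    z * z * (T z + T (z - 1ℚ))
      ≡⟨ cong (z * z *_) (trans (sym (ΣQ-+ (suc m) _ _)) (ΣQ-head m _)) ⟩
    z * z * ((1ℚ * (1ℚ * 1ℚ) + 1ℚ * (1ℚ * 1ℚ)) + ΣQ m (λ k → D (suc k) π * h z (suc k) + D (suc k) π * h (z - 1ℚ) (suc k)))
      ≡⟨ cong (λ s → z * z * (2ℚ + s)) (ΣQ-cong m λ k _ → trans (sym (ℚ.*-distribˡ-+ (D (suc k) π) (h z (suc k)) (h (z - 1ℚ) (suc k)))) (cong (D (suc k) π *_) (h-pair k z))) ⟩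
    z * z * (2ℚ + ΣQ m (λ k → D (suc k) π * (2ℚ * Δ k)))
      -- The constant part of D k p telescopes, its boundary value cancels the head term 2, and 2 D
      -- m z remains; the p² part is left for summation by parts.
      ≈⟨ ≈-*ˡ (int-* iz iz) (≈-+ (≈-refl {2ℚ}) (≈-Σ m λ k k<m → ≈-*ʳ (int-* (int-ℕ 2) (int-Δ k<m)) (D-≈H₂ (suc k) k<m))) ⟩
    z * z * (2ℚ + ΣQ m (λ k → (1ℚ - π * π * H₂ (suc k)) * (2ℚ * Δ k)))
      ≡⟨ cong (λ s → z * z * (2ℚ + s)) sum ⟩
    z * z * (2ℚ + (2ℚ * (D m z - 1ℚ) + - (2ℚ * (π * π)) * B))
      ≡⟨ lemma₂ z π (D m z) B ⟩
    2ℚ * (z * z * D m z) - 2ℚ * (π * (π * (z * z * B)))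
      ≡⟨ cong (λ s → 2ℚ * (z * z * D m z) - 2ℚ * (π * (π * s))) (ΣH₂-D m z) ⟩
    2ℚ * (z * z * D m z) - 2ℚ * (π * (π * (z * z * H₂ m * D m z - 1ℚ + D m z)))
      -- In the second term D carries the factor p², so D ≡ 0 (mod p) is enough there; the surviving
      -- -1 gives the summand 1 beside c (c+1).
      ≈⟨ ≈-sub (≈-*ˡ (int-ℕ 2) (z²D-≈ j j<m ic)) (≈-*ˡ (int-ℕ 2) (≈-scale (≈-scale
           (≈-+ (≈-sub (≈-*ˡ (int-* (int-* iz iz) (int-H₂ ℕ.≤-refl)) D≈0) (≈-refl {1ℚ})) D≈0)))) ⟩
    2ℚ * (π * π * (c * (c + 1ℚ))) - 2ℚ * (π * (π * (z * z * H₂ m * 0ℚ - 1ℚ + 0ℚ)))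
      ≡⟨ lemma₃ π c (z * z * H₂ m) ⟩
    2ℚ * (π * (π * (c * (c + 1ℚ) + 1ℚ)))
      ∎
    where
    open ≈-Reasoning 3
    z : ℚ
    z = π * c + ℕ→ℚ (suc j)
    iz : Integral p z
    iz = int-+ (int-* (int-ℕ p) ic) (int-ℕ (suc j))
    Δ : ℕ → ℚ
    Δ k = D (suc k) z - D k z
    int-Δ : ∀ {k} → k < m → Integral p (Δ k)
    int-Δ k<m = int-sub (int-D k<m iz) (int-D (ℕ.<⇒≤ k<m) iz)
    B : ℚ
    B = ΣQ m (λ k → H₂ (suc k) * Δ k)
    sum : ΣQ m (λ k → (1ℚ - π * π * H₂ (suc k)) * (2ℚ * Δ k)) ≡ 2ℚ * (D m z - 1ℚ) + - (2ℚ * (π * π)) * B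
    sum = trans (ΣQ-cong m λ k _ → lemma₁ π (H₂ (suc k)) (Δ k)) (trans (ΣQ-+ m _ _)
      (cong₂ _+_ (trans (ΣQ-*ˡ 2ℚ m Δ) (cong (2ℚ *_) (ΣQ-telescope m (λ k → D k z)))) (ΣQ-*ˡ (- (2ℚ * (π * π))) m (λ k → H₂ (suc k) * Δ k))))
      where
      lemma₁ : ∀ π H d → (1ℚ - π * π * H) * (2ℚ * d) ≡ 2ℚ * d + - (2ℚ * (π * π)) * (H * d)
      lemma₁ = solve-∀ ℚ-ring
    -- z² D ≡ 0 (mod p), and z is congruent to the unit j + 1 with 1 ≤ j + 1 < p.
    D≈0 : D m z ≈ 0ℚ [ 1 ]
    D≈0 = ≈-cancel-unit j<m z≈j (int-D ℕ.≤-refl iz) (int-ℕ 0) 1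
      (≈-cancel-unit j<m z≈j (int-* iz (int-D ℕ.≤-refl iz)) (int-* iz (int-ℕ 0)) 1
        (≈-trans (≈-reflexive (sym (ℚ.*-assoc z z (D m z)))) (≈-trans (≈-weaken (≈-weaken (z²D-≈ j j<m ic)))
          (congruent (π * (c * (c + 1ℚ))) (int-* (int-ℕ p) (int-* ic (int-+ ic int-1))) (vanish z π (c * (c + 1ℚ)))))))
      where
      z≈j : z ≈ ℕ→ℚ (suc j) [ 1 ]
      z≈j = near-unit (ℕ→ℚ (suc j)) ic
      vanish : ∀ z π w → π * π * w ≡ z * (z * 0ℚ) + 1ℚ * π * (π * w)
      vanish = solve-∀ ℚ-ring
    lemma₂ : ∀ z π d B → z * z * (2ℚ + (2ℚ * (d - 1ℚ) + - (2ℚ * (π * π)) * B)) ≡ 2ℚ * (z * z * d) - 2ℚ * (π * (π * (z * z * B)))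
    lemma₂ = solve-∀ ℚ-ring
    lemma₃ : ∀ π c x → 2ℚ * (π * π * (c * (c + 1ℚ))) - 2ℚ * (π * (π * (x * 0ℚ - 1ℚ + 0ℚ))) ≡ 2ℚ * (π * (π * (c * (c + 1ℚ) + 1ℚ)))
    lemma₃ = solve-∀ ℚ-ring

  -- Fermat's little theorem

  C≈0 : ∀ k → k < m → ℕ→ℚ (p C suc k) ≈ 0ℚ [ 1 ]
  C≈0 k k<m = congruent (binom (ℕ→ℚ m) k * invℕ (suc k)) (int-* (int-binom (ℕ.<⇒≤ k<m) (int-ℕ m)) (int-ι k<m)) (begin
    ℕ→ℚ (p C suc k)                                 ≡⟨ C≡binom p (suc k) ⟩
    binom π (suc k)                                 ≡⟨ cong (λ y → binom y (suc k)) π≡ ⟩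
    binom (ℕ→ℚ m + 1ℚ) (suc k)                      ≡⟨ binom-absorb k (ℕ→ℚ m) ⟩
    binom (ℕ→ℚ m) k * (ℕ→ℚ m + 1ℚ) * invℕ (suc k)   ≡⟨ cong (λ y → binom (ℕ→ℚ m) k * y * invℕ (suc k)) π≡ ⟨
    binom (ℕ→ℚ m) k * π * invℕ (suc k)              ≡⟨ lemma (binom (ℕ→ℚ m) k) π (invℕ (suc k)) ⟩
    0ℚ + π ^Q 1 * (binom (ℕ→ℚ m) k * invℕ (suc k))  ∎)
    where
    open ≡-Reasoning
    lemma : ∀ b π ι → b * π * ι ≡ 0ℚ + 1ℚ * π * (b * ι)
    lemma = solve-∀ ℚ-ring

  -- The binomial theorem enters as the umbral evaluation of the sequence 1ᵏ; the inner coefficients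
  -- C(p, k) vanish modulo p.
  frobenius-suc : ∀ {a} → Integral p a → (a + 1ℚ) ^Q p ≈ a ^Q p + 1ℚ [ 1 ]
  frobenius-suc {a} ia = begin
    (a + 1ℚ) ^Q p
      ≡⟨ trans (sym (ℚ.*-identityˡ _)) (sym (umbral-geometric p 1ℚ 1ℚ a)) ⟩
    umbral p (λ k → 1ℚ * 1ℚ ^Q k) a
      ≡⟨ umbral-last p (λ k → 1ℚ * 1ℚ ^Q k) a ⟩
    ΣQ p f + 1ℚ * 1ℚ ^Q p
      ≡⟨ cong₂ _+_ (ΣQ-head m f) (trans (ℚ.*-identityˡ _) (1^Q p)) ⟩
    1ℚ * a ^Q p * 1ℚ + ΣQ m (λ k → f (suc k)) + 1ℚ
      ≈⟨ ≈-+ (≈-+ (≈-refl {1ℚ * a ^Q p * 1ℚ}) (≈-Σ m λ k k<m → ≈-*ʳ (int-* int-1 (int-^ (suc k) int-1)) (≈-*ʳ (int-^ (m ∸ k) ia) (C≈0 k k<m)))) (≈-refl {1ℚ}) ⟩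
    1ℚ * a ^Q p * 1ℚ + ΣQ m (λ k → 0ℚ * a ^Q (m ∸ k) * (1ℚ * 1ℚ ^Q suc k)) + 1ℚ
      ≡⟨ cong (λ s → 1ℚ * a ^Q p * 1ℚ + s + 1ℚ) (ΣQ-zero m λ k _ → vanish (a ^Q (m ∸ k)) (1ℚ * 1ℚ ^Q suc k)) ⟩
    1ℚ * a ^Q p * 1ℚ + 0ℚ + 1ℚ
      ≡⟨ lemma (a ^Q p) ⟩
    a ^Q p + 1ℚ
      ∎
    where
    open ≈-Reasoning 1
    f : ℕ → ℚ
    f k = ℕ→ℚ (p C k) * a ^Q (p ∸ k) * (1ℚ * 1ℚ ^Q k)
    vanish : ∀ x y → 0ℚ * x * y ≡ 0ℚ
    vanish = solve-∀ ℚ-ring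
    lemma : ∀ x → 1ℚ * x * 1ℚ + 0ℚ + 1ℚ ≡ x + 1ℚ
    lemma = solve-∀ ℚ-ring

  fermat : ∀ j → ℕ→ℚ j ^Q p ≈ ℕ→ℚ j [ 1 ]
  fermat zero    = ≈-reflexive (ℚ.*-zeroʳ (0ℚ ^Q m))
  fermat (suc j) = begin
    ℕ→ℚ (suc j) ^Q p      ≡⟨ cong (_^Q p) (ℕ→ℚ-suc j) ⟩
    (ℕ→ℚ j + 1ℚ) ^Q p     ≈⟨ frobenius-suc (int-ℕ j) ⟩
    ℕ→ℚ j ^Q p + 1ℚ       ≈⟨ ≈-+ (fermat j) (≈-refl {1ℚ}) ⟩
    ℕ→ℚ j + 1ℚ            ≡⟨ ℕ→ℚ-suc j ⟨
    ℕ→ℚ (suc j)           ∎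
    where open ≈-Reasoning 1

  fermat-unit : ∀ {u k} → k < m → u ≈ ℕ→ℚ (suc k) [ 1 ] → u ^Q m ≈ 1ℚ [ 1 ]
  fermat-unit {u} {k} k<m u≈j = ≈-trans (≈-^ m (≈-int u≈j (int-ℕ (suc k))) (int-ℕ (suc k)) u≈j)
    (≈-cancel-unit k<m (≈-refl {ℕ→ℚ (suc k)}) (int-^ m (int-ℕ (suc k))) int-1 1 (begin
      ℕ→ℚ (suc k) * ℕ→ℚ (suc k) ^Q m    ≡⟨ ℚ.*-comm (ℕ→ℚ (suc k)) _ ⟩
      ℕ→ℚ (suc k) ^Q p                  ≈⟨ fermat (suc k) ⟩
      ℕ→ℚ (suc k)                       ≡⟨ ℚ.*-identityʳ (ℕ→ℚ (suc k)) ⟨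
      ℕ→ℚ (suc k) * 1ℚ                  ∎))
    where open ≈-Reasoning 1

  int-T : ∀ {z} → Integral p z → Integral p (T z)
  int-T iz = int-Σ (suc m) λ k k≤m → int-* (int-D (ℕ.s≤s⁻¹ k≤m) (int-ℕ p)) (int-h (ℕ.s≤s⁻¹ k≤m) iz)

-- The congruence modulo p⁴ and its special values, for p = n + 3

module OddModulus (l : ℕ) (pp : Prime (3 ℕ.+ 2 ℕ.* suc l)) where

  n m : ℕ
  n = 2 ℕ.* suc l
  m = 2 ℕ.+ n

  open Congruence pp
  open PrimeModulus {m} pp

  even : sgn m ≡ 1ℚ
  even = trans (trans (sgn-suc (suc n)) (cong -_ (sgn-odd (suc l)))) refl

  2<m : 2 < m
  2<m = s≤s (s≤s (s≤s z≤n))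

  G : ℚ → ℚ
  G z = eulerPoly n (- z)

  int-eulerQ : ∀ k → Integral p (eulerQ k)
  int-eulerQ k = int-ℤ (eulerNum k)

  int-½ : Integral p ½
  int-½ = int-ι {1} (ℕ.<⇒≤ 2<m)

  int-eulerPoly : ∀ {z} → Integral p z → Integral p (eulerPoly n z)
  int-eulerPoly {z} iz = subst (Integral p) (sym (eulerPoly≡umbral n z))
    (int-* (int-^ n int-½) (int-umbral n int-eulerQ (int-sub (int-* (int-ℕ 2) iz) int-1)))

  G-near-0 : ∀ {c} → Integral p c → G (π * c) ≈ 0ℚ [ 1 ]
  G-near-0 {c} ic = begin
    eulerPoly n (- (π * c))
      ≡⟨ eulerPoly≡umbral n (- (π * c)) ⟩
    ½ ^Q n * umbral n eulerQ (2ℚ * - (π * c) - 1ℚ)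
      ≈⟨ ≈-*ˡ (int-^ n int-½) (umbral-≈ n int-eulerQ (λ _ → ≈-refl) (int-neg int-1)
           (congruent (- (2ℚ * c)) (int-neg (int-* (int-ℕ 2) ic)) (lemma π c))) ⟩
    ½ ^Q n * umbral n eulerQ (- 1ℚ)
      ≡⟨ cong (½ ^Q n *_) (umbral-euler-at-1 l) ⟩
    ½ ^Q n * 0ℚ
      ≡⟨ ℚ.*-zeroʳ (½ ^Q n) ⟩
    0ℚ
      ∎
    where
    open ≈-Reasoning 1
    lemma : ∀ π c → 2ℚ * - (π * c) - 1ℚ ≡ - 1ℚ + 1ℚ * π * - (2ℚ * c)
    lemma = solve-∀ ℚ-ring

  T-value : ∀ j → j ℕ.≤ m → ∀ {c} → Integral p c → let z = π * c + ℕ→ℚ j in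
    T z ≈ sgn j + π * (π * ((c * (c + 1ℚ) + 1ℚ) * G z)) [ 3 ]
  T-value zero _ {c} ic = subst (λ z → T z ≈ 1ℚ + π * (π * (w * G z)) [ 3 ]) (sym (ℚ.+-identityʳ (π * c)))
    (≈-trans (T-near-0 even 2<m ic) (≈-sym (≈-trans
      (≈-+ (≈-refl {1ℚ}) (≈-scale (≈-scale (≈-*ˡ (int-+ (int-* ic (int-+ ic int-1)) int-1) (G-near-0 ic)))))
      (≈-reflexive (lemma π w)))))
    where
    w : ℚ
    w = c * (c + 1ℚ) + 1ℚ
    lemma : ∀ π w → 1ℚ + π * (π * (w * 0ℚ)) ≡ 1ℚ
    lemma = solve-∀ ℚ-ring
  T-value (suc j) j<m {c} ic = begin
    T z
      ≡⟨ add-sub (T z) (T (z - 1ℚ)) ⟩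
    (T z + T (z - 1ℚ)) - T (z - 1ℚ)
      -- Subtracting the previous value flips the sign (-1)ʲ and exchanges G (z - 1) for G z.
      ≈⟨ ≈-sub pair (subst (λ v → T v ≈ sgn j + π * (π * (w * G v)) [ 3 ]) (sym z-1≡) (T-value j (ℕ.<⇒≤ j<m) ic)) ⟩
    π * (π * (w * (2ℚ * z ^Q n))) - (sgn j + π * (π * (w * G (z - 1ℚ))))
      ≡⟨ cong (λ x → π * (π * (w * x)) - (sgn j + π * (π * (w * G (z - 1ℚ))))) (eulerPoly-pair (suc l) z) ⟨
    π * (π * (w * (G z + G (z - 1ℚ)))) - (sgn j + π * (π * (w * G (z - 1ℚ))))
      ≡⟨ lemma₁ π w (G z) (G (z - 1ℚ)) (sgn j) ⟩
    sgn (suc j) + π * (π * (w * G z))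
      ∎
    where
    open ≈-Reasoning 3
    z w : ℚ
    z = π * c + ℕ→ℚ (suc j)
    w = c * (c + 1ℚ) + 1ℚ
    iz : Integral p z
    iz = int-+ (int-* (int-ℕ p) ic) (int-ℕ (suc j))
    iw : Integral p w
    iw = int-+ (int-* ic (int-+ ic int-1)) int-1
    z-1≡ : z - 1ℚ ≡ π * c + ℕ→ℚ j
    z-1≡ = trans (ℚ.+-assoc (π * c) (ℕ→ℚ (suc j)) (- 1ℚ)) (cong (_+_ (π * c)) (ℕ→ℚ-pred j))
    z≈j : z ≈ ℕ→ℚ (suc j) [ 1 ]
    z≈j = near-unit (ℕ→ℚ (suc j)) ic
    add-sub : ∀ a b → a ≡ a + b - b
    add-sub = solve-∀ ℚ-ring
    lemma₁ : ∀ π w g g′ s → π * (π * (w * (g + g′))) - (s + π * (π * (w * g′))) ≡ s * - 1ℚ + π * (π * (w * g))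
    lemma₁ = solve-∀ ℚ-ring
    lemma₂ : ∀ z π w x → z * (z * (π * (π * (w * (2ℚ * x))))) ≡ π * (π * (2ℚ * w * (x * z * z)))
    lemma₂ = solve-∀ ℚ-ring
    lemma₃ : ∀ π w → π * (π * (2ℚ * w * 1ℚ)) ≡ 2ℚ * (π * (π * w))
    lemma₃ = solve-∀ ℚ-ring
    iE : Integral p (T z + T (z - 1ℚ))
    iE = int-+ (int-T iz) (int-T (int-sub iz int-1))
    iF : Integral p (π * (π * (w * (2ℚ * z ^Q n))))
    iF = int-* (int-ℕ p) (int-* (int-ℕ p) (int-* iw (int-* (int-ℕ 2) (int-^ n iz))))
    pair : T z + T (z - 1ℚ) ≈ π * (π * (w * (2ℚ * z ^Q n))) [ 3 ]
    -- Multiplication by z² turns zⁿ into zᵖ⁻¹; Fermat's theorem modulo p suffices because of the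
    -- factor p².
    pair = ≈-cancel-unit j<m z≈j iE iF 3 (≈-cancel-unit j<m z≈j (int-* iz iE) (int-* iz iF) 3 (begin
      z * (z * (T z + T (z - 1ℚ)))                      ≡⟨ ℚ.*-assoc z z (T z + T (z - 1ℚ)) ⟨
      z * z * (T z + T (z - 1ℚ))                        ≈⟨ T-pair j j<m ic ⟩
      2ℚ * (π * (π * w))                                ≡⟨ lemma₃ π w ⟨
      π * (π * (2ℚ * w * 1ℚ))                           ≈⟨ ≈-scale (≈-scale (≈-*ˡ (int-* (int-ℕ 2) iw) (≈-sym (fermat-unit j<m z≈j)))) ⟩
      π * (π * (2ℚ * w * (z ^Q n * z * z)))             ≡⟨ lemma₂ z π w (z ^Q n) ⟨
      z * (z * (π * (π * (w * (2ℚ * z ^Q n)))))         ∎))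

  S : ℚ → ℚ
  S x = ΣQ p λ n → ℕ→ℚ (2 ℕ.* n ℕ.+ 1) * sgn n * V n x

  S-value : ∀ j → j ℕ.≤ m → ∀ {c} → Integral p c → let z = π * c + ℕ→ℚ j in
    S z ≈ sgn j * π + π ^Q 3 * (c * (c + 1ℚ) + 1ℚ) * G z [ 4 ]
  S-value j j≤m {c} ic = begin
    S z                                                   ≡⟨ Σ[2n+1]V p z ⟩
    -- The sign -(-1)ᵖ of the closed form is 1 since p is odd.
    - (sgn m * - 1ℚ) * (π * T z)                          ≡⟨ cong (λ s → - (s * - 1ℚ) * (π * T z)) even ⟩
    1ℚ * (π * T z)                                        ≡⟨ ℚ.*-identityˡ (π * T z) ⟩
    π * T z                                               ≈⟨ ≈-scale (T-value j j≤m ic) ⟩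
    π * (sgn j + π * (π * ((c * (c + 1ℚ) + 1ℚ) * G z)))   ≡⟨ lemma π (sgn j) (c * (c + 1ℚ) + 1ℚ) (G z) ⟩
    sgn j * π + π ^Q 3 * (c * (c + 1ℚ) + 1ℚ) * G z        ∎
    where
    open ≈-Reasoning 4
    z : ℚ
    z = π * c + ℕ→ℚ j
    lemma : ∀ π s w g → π * (s + π * (π * (w * g))) ≡ s * π + 1ℚ * π * π * π * w * g
    lemma = solve-∀ ℚ-ring

  S-at : ∀ {x c} r → r < p → Integral p c → π * c + ℕ→ℚ r ≡ x →
    S x ≈ sgn r * π + π ^Q 3 * (c * (c + 1ℚ) + 1ℚ) * G x [ 4 ]
  S-at r r<p ic refl = S-value r (ℕ.s≤s⁻¹ r<p) ic

  general : (x : ℚ) (r : ℕ) → r < p → CongZp p 1 x (ℕ→ℚ r) → let x′ = (x - ℕ→ℚ r) * invℕ p in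
    CongZp p 4 (S x) (sgn r * π + π ^Q 3 * (x′ * (x′ + 1ℚ) + 1ℚ) * eulerPoly n (- x))
  general x r r<p (c , ic , eq) = ≈⇒CongZp (subst
    (λ d → S x ≈ sgn r * π + π ^Q 3 * (d * (d + 1ℚ) + 1ℚ) * G x [ 4 ]) (sym x′≡c)
    (S-at r r<p (InZp⇒Integral c ic) (sym x≡)))
    where
    open ≡-Reasoning
    x′≡c : (x - ℕ→ℚ r) * invℕ p ≡ c
    x′≡c = begin
      (x - ℕ→ℚ r) * invℕ p       ≡⟨ cong (_* invℕ p) eq ⟩
      1ℚ * π * c * invℕ p        ≡⟨ lemma π c (invℕ p) ⟩
      invℕ p * π * c             ≡⟨ cong (_* c) invℕ-p ⟩
      1ℚ * c                     ≡⟨ ℚ.*-identityˡ c ⟩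
      c                          ∎
      where
      lemma : ∀ π c i → 1ℚ * π * c * i ≡ i * π * c
      lemma = solve-∀ ℚ-ring
    x≡ : x ≡ π * c + ℕ→ℚ r
    x≡ = trans (add-sub x (ℕ→ℚ r)) (trans (cong (_+ ℕ→ℚ r) eq) (lemma π c (ℕ→ℚ r)))
      where
      add-sub : ∀ x r → x ≡ x - r + r
      add-sub = solve-∀ ℚ-ring
      lemma : ∀ π c r → 1ℚ * π * c + r ≡ π * c + r
      lemma = solve-∀ ℚ-ring

  int-⅓ : Integral p ⅓
  int-⅓ = int-ι {2} 2<m

  2^m≈1 : 2ℚ ^Q m ≈ 1ℚ [ 1 ]
  2^m≈1 = fermat-unit {2ℚ} {1} (ℕ.<⇒≤ 2<m) ≈-refl

  3^m≈1 : ℕ→ℚ 3 ^Q m ≈ 1ℚ [ 1 ]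
  3^m≈1 = fermat-unit {ℕ→ℚ 3} {2} 2<m ≈-refl

  -- The correction carries p³, so w G x has to be known only modulo p. The value w is given
  -- separately from c because different residue classes of p have different c but the same w.
  specialise : ∀ {x c} r σ w a b → c * (c + 1ℚ) + 1ℚ ≡ w → r < p → Integral p c → π * c + ℕ→ℚ r ≡ x → sgn r ≡ σ →
    w * G x ≈ a * b [ 1 ] → S x ≈ σ * π + a * π ^Q 3 * b [ 4 ]
  specialise {x} {c} r _ _ a b refl r<p ic x≡ refl wG≈ab = begin
    S x                                                ≈⟨ S-at r r<p ic x≡ ⟩
    sgn r * π + π ^Q 3 * w * G x                       ≡⟨ lemma₁ (sgn r) π w (G x) ⟩
    sgn r * π + π * (π * (π * (w * G x)))              ≈⟨ ≈-+ (≈-refl {sgn r * π}) (≈-scale (≈-scale (≈-scale wG≈ab))) ⟩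
    sgn r * π + π * (π * (π * (a * b)))                ≡⟨ lemma₂ (sgn r) π a b ⟩
    sgn r * π + a * π ^Q 3 * b                         ∎
    where
    open ≈-Reasoning 4
    w : ℚ
    w = c * (c + 1ℚ) + 1ℚ
    lemma₁ : ∀ s π w g → s * π + 1ℚ * π * π * π * w * g ≡ s * π + π * (π * (π * (w * g)))
    lemma₁ = solve-∀ ℚ-ring
    lemma₂ : ∀ s π a b → s * π + π * (π * (π * (a * b))) ≡ s * π + a * (1ℚ * π * π * π) * b
    lemma₂ = solve-∀ ℚ-ring

  -- 7/9 is c (c+1) + 1 for both c = -1/3 and c = -2/3. Fermat's theorem replaces 1/9 by 3ᵖ⁻³, the
  -- power that relates Eₙ(1/3) to U.
  euler-third : ((+ 7) ℚ./ 9) * G (- ⅓) ≈ ℕ→ℚ 7 * UQ n [ 1 ]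
  euler-third = begin
    ((+ 7) ℚ./ 9) * E                          ≡⟨ lemma₁ E ⟩
    ((+ 7) ℚ./ 9) * (1ℚ * E)                   ≈⟨ ≈-*ˡ (int-* (int-ℕ 7) (int-* int-⅓ int-⅓)) (≈-*ʳ (int-eulerPoly int-⅓) (≈-sym 3^m≈1)) ⟩
    ((+ 7) ℚ./ 9) * (t * ℕ→ℚ 3 * ℕ→ℚ 3 * E)    ≡⟨ lemma₂ t E ⟩
    ℕ→ℚ 7 * (t * E)                            ≡⟨ cong (λ y → ℕ→ℚ 7 * (t * y)) (eulerPoly≡umbral n ⅓) ⟩
    ℕ→ℚ 7 * (t * (½ ^Q n * u))                 ≡⟨ cong (ℕ→ℚ 7 *_) (ℚ.*-assoc t (½ ^Q n) u) ⟨
    ℕ→ℚ 7 * (t * ½ ^Q n * u)                   ≡⟨ cong (λ y → ℕ→ℚ 7 * (y * u)) (^Q-distribʳ-* (ℕ→ℚ 3) ½ n) ⟨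
    ℕ→ℚ 7 * (3/2 ^Q n * u)                     ≡⟨ cong (ℕ→ℚ 7 *_) (U≡umbral (suc l)) ⟨
    ℕ→ℚ 7 * UQ n                               ∎
    where
    open ≈-Reasoning 1
    E t u : ℚ
    E = eulerPoly n ⅓
    t = ℕ→ℚ 3 ^Q n
    u = umbral n eulerQ (- ⅓)
    lemma₁ : ∀ x → ((+ 7) ℚ./ 9) * x ≡ ((+ 7) ℚ./ 9) * (1ℚ * x)
    lemma₁ = solve-∀ ℚ-ring
    lemma₂ : ∀ t x → ((+ 7) ℚ./ 9) * (t * ℕ→ℚ 3 * ℕ→ℚ 3 * x) ≡ ℕ→ℚ 7 * (t * x)
    lemma₂ = solve-∀ ℚ-ring

  int-¼ : Integral p ¼
  int-¼ = int-* int-½ int-½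

  int-⅙ : Integral p ⅙
  int-⅙ = int-* int-½ int-⅓

  -- 13/16 belongs to c = -1/4 and c = -3/4. Fermat's theorem, used twice for base 2, turns 1/16
  -- into 2ⁿ · 2ⁿ; one factor cancels the 2⁻ⁿ of the Euler polynomial and the other remains in s.
  euler-quarter : ((+ 13) ℚ./ 16) * G (- ¼) ≈ ℕ→ℚ 13 * sQ n [ 1 ]
  euler-quarter = begin
    ((+ 13) ℚ./ 16) * E                                          ≡⟨ lemma₁ E ⟩
    ((+ 13) ℚ./ 16) * (1ℚ * (1ℚ * E))                            ≈⟨ ≈-*ˡ (int-* (int-ℕ 13) (int-* int-¼ int-¼))
                                                                      (≈-* (int-^ m (int-ℕ 2)) (int-* int-1 iE) (≈-sym 2^m≈1) (≈-*ʳ iE (≈-sym 2^m≈1))) ⟩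
    ((+ 13) ℚ./ 16) * (t * 2ℚ * 2ℚ * (t * 2ℚ * 2ℚ * E))          ≡⟨ lemma₂ t E ⟩
    ℕ→ℚ 13 * (t * (t * E))                                       ≡⟨ cong (λ y → ℕ→ℚ 13 * (t * (t * y))) (eulerPoly≡umbral n ¼) ⟩
    ℕ→ℚ 13 * (t * (t * (½ ^Q n * u)))                            ≡⟨ lemma₃ t (½ ^Q n) u ⟩
    ℕ→ℚ 13 * (t * (t * ½ ^Q n * u))                              ≡⟨ cong (λ y → ℕ→ℚ 13 * (t * (y * u))) (2^½^ n) ⟩
    ℕ→ℚ 13 * (t * (1ℚ * u))                                      ≡⟨ cong (λ y → ℕ→ℚ 13 * (t * y)) (ℚ.*-identityˡ u) ⟩
    ℕ→ℚ 13 * (t * u)                                             ≡⟨ cong (ℕ→ℚ 13 *_) (s≡umbral n) ⟨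
    ℕ→ℚ 13 * sQ n                                                ∎
    where
    open ≈-Reasoning 1
    E t u : ℚ
    E = eulerPoly n ¼
    t = 2ℚ ^Q n
    u = umbral n eulerQ (- ½)
    iE : Integral p E
    iE = int-eulerPoly int-¼
    lemma₁ : ∀ x → ((+ 13) ℚ./ 16) * x ≡ ((+ 13) ℚ./ 16) * (1ℚ * (1ℚ * x))
    lemma₁ = solve-∀ ℚ-ring
    lemma₂ : ∀ t x → ((+ 13) ℚ./ 16) * (t * 2ℚ * 2ℚ * (t * 2ℚ * 2ℚ * x)) ≡ ℕ→ℚ 13 * (t * (t * x))
    lemma₂ = solve-∀ ℚ-ring
    lemma₃ : ∀ t i u → ℕ→ℚ 13 * (t * (t * (i * u))) ≡ ℕ→ℚ 13 * (t * (t * i * u))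
    lemma₃ = solve-∀ ℚ-ring

  -- 31/36 belongs to c = -1/6 and c = -5/6. Here 1/36 becomes 2ⁿ · 3ⁿ, and `euler-sixth` leaves
  -- (31/2)(1 + 3ⁿ) Eₙ; since 3ⁿ ≡ 1/9, the constant is (31/2)(10/9) = 155/9.
  euler-sixth-≈ : ((+ 31) ℚ./ 36) * G (- ⅙) ≈ ((+ 155) ℚ./ 9) * eulerQ n [ 1 ]
  euler-sixth-≈ = begin
    ((+ 31) ℚ./ 36) * E
      ≡⟨ lemma₁ E ⟩
    ((+ 31) ℚ./ 36) * (1ℚ * (1ℚ * E))
      ≈⟨ ≈-*ˡ (int-* (int-ℕ 31) (int-* int-⅙ int-⅙)) (≈-* (int-^ m (int-ℕ 2)) (int-* int-1 iE) (≈-sym 2^m≈1) (≈-*ʳ iE (≈-sym 3^m≈1))) ⟩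
    ((+ 31) ℚ./ 36) * (a * 2ℚ * 2ℚ * (b * ℕ→ℚ 3 * ℕ→ℚ 3 * E))
      ≡⟨ cong (λ y → ((+ 31) ℚ./ 36) * (a * 2ℚ * 2ℚ * (b * ℕ→ℚ 3 * ℕ→ℚ 3 * y))) (eulerPoly≡umbral n ⅙) ⟩
    ((+ 31) ℚ./ 36) * (a * 2ℚ * 2ℚ * (b * ℕ→ℚ 3 * ℕ→ℚ 3 * (½ ^Q n * u)))
      ≡⟨ lemma₂ a b (½ ^Q n) u ⟩
    ((+ 31) ℚ./ 2) * (a * ½ ^Q n * (2ℚ * (b * u)))
      ≡⟨ cong₂ (λ x y → ((+ 31) ℚ./ 2) * (x * y)) (2^½^ n) (euler-sixth (suc l)) ⟩
    ((+ 31) ℚ./ 2) * (1ℚ * ((1ℚ + b) * eulerQ n))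
      ≡⟨ lemma₃ b (eulerQ n) ⟩
    ((+ 31) ℚ./ 18) * ((ℕ→ℚ 9 + b * ℕ→ℚ 3 * ℕ→ℚ 3) * eulerQ n)
      ≈⟨ ≈-*ˡ (int-* (int-ℕ 31) (int-* int-½ (int-* int-⅓ int-⅓))) (≈-*ʳ (int-eulerQ n) (≈-+ (≈-refl {ℕ→ℚ 9}) 3^m≈1)) ⟩
    ((+ 31) ℚ./ 18) * ((ℕ→ℚ 9 + 1ℚ) * eulerQ n)
      ≡⟨ lemma₄ (eulerQ n) ⟩
    ((+ 155) ℚ./ 9) * eulerQ n
      ∎
    where
    open ≈-Reasoning 1
    E a b u : ℚ
    E = eulerPoly n ⅙
    a = 2ℚ ^Q n
    b = ℕ→ℚ 3 ^Q n
    u = umbral n eulerQ (- ⅔)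
    iE : Integral p E
    iE = int-eulerPoly int-⅙
    lemma₁ : ∀ x → ((+ 31) ℚ./ 36) * x ≡ ((+ 31) ℚ./ 36) * (1ℚ * (1ℚ * x))
    lemma₁ = solve-∀ ℚ-ring
    lemma₂ : ∀ a b i u → ((+ 31) ℚ./ 36) * (a * 2ℚ * 2ℚ * (b * ℕ→ℚ 3 * ℕ→ℚ 3 * (i * u))) ≡ ((+ 31) ℚ./ 2) * (a * i * (2ℚ * (b * u)))
    lemma₂ = solve-∀ ℚ-ring
    lemma₃ : ∀ b x → ((+ 31) ℚ./ 2) * (1ℚ * ((1ℚ + b) * x)) ≡ ((+ 31) ℚ./ 18) * ((ℕ→ℚ 9 + b * ℕ→ℚ 3 * ℕ→ℚ 3) * x)
    lemma₃ = solve-∀ ℚ-ring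
    lemma₄ : ∀ x → ((+ 31) ℚ./ 18) * ((ℕ→ℚ 9 + 1ℚ) * x) ≡ ((+ 155) ℚ./ 9) * x
    lemma₄ = solve-∀ ℚ-ring

  third : S (- ⅓) ≈ sgn (p / 3) * π + ℕ→ℚ 7 * π ^Q 3 * UQ n [ 4 ]
  third = [ case₁ , case₂ ]′ (prime>3-mod-6 pp (s≤s 2<m))
    where
    Goal : Set
    Goal = S (- ⅓) ≈ sgn (p / 3) * π + ℕ→ℚ 7 * π ^Q 3 * UQ n [ 4 ]
    case₁ : (∃ λ q → p ≡ 1 ℕ.+ q ℕ.* 6) → Goal
    -- -1/3 = -p/3 + 2q for p = 6q + 1, and the residue 2q is [p/3] itself.
    case₁ (q , p≡) = specialise {x = - ⅓} {c = - ⅓} (q ℕ.* 2) _ ((+ 7) ℚ./ 9) (ℕ→ℚ 7) (UQ n) refl r<p (int-neg int-⅓) x≡ (cong sgn (sym p/3)) euler-third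
      where
      r<p : q ℕ.* 2 < p
      r<p = subst (q ℕ.* 2 <_) (sym p≡) (s≤s (ℕ.*-monoʳ-≤ q (s≤s (s≤s z≤n))))
      x≡ : π * - ⅓ + ℕ→ℚ (q ℕ.* 2) ≡ - ⅓
      x≡ = trans (cong₂ (λ x y → x * - ⅓ + y) (trans (cong ℕ→ℚ p≡) (ℕ→ℚ-affine 1 q 6)) (ℕ→ℚ-* q 2)) (lemma (ℕ→ℚ q))
        where
        lemma : ∀ q → (ℕ→ℚ 1 + q * ℕ→ℚ 6) * - ⅓ + q * ℕ→ℚ 2 ≡ - ⅓
        lemma = solve-∀ ℚ-ring
      p/3 : p / 3 ≡ q ℕ.* 2
      p/3 = trans (cong (_/ 3) (trans p≡ (cong suc (sym (ℕ.*-assoc q 2 3))))) ([r+k*d]/d≡r/d+k 1 (q ℕ.* 2) 3)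
    case₂ : (∃ λ q → p ≡ 5 ℕ.+ q ℕ.* 6) → Goal
    -- -1/3 = -2p/3 + (4q + 3) for p = 6q + 5; the residue is not [p/3] = 2q + 1 but is odd as well.
    case₂ (q , p≡) = specialise {x = - ⅓} {c = - ⅔} (3 ℕ.+ q ℕ.* 4) _ ((+ 7) ℚ./ 9) (ℕ→ℚ 7) (UQ n) refl r<p (int-neg (int-* (int-ℕ 2) int-⅓)) x≡ sign euler-third
      where
      r<p : 3 ℕ.+ q ℕ.* 4 < p
      r<p = subst (3 ℕ.+ q ℕ.* 4 <_) (sym p≡) (ℕ.+-mono-≤ {4} {5} (s≤s (s≤s (s≤s (s≤s z≤n)))) (ℕ.*-monoʳ-≤ q (s≤s (s≤s (s≤s (s≤s z≤n))))))
      x≡ : π * - ⅔ + ℕ→ℚ (3 ℕ.+ q ℕ.* 4) ≡ - ⅓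
      x≡ = trans (cong₂ (λ x y → x * - ⅔ + y) (trans (cong ℕ→ℚ p≡) (ℕ→ℚ-affine 5 q 6)) (ℕ→ℚ-affine 3 q 4)) (lemma (ℕ→ℚ q))
        where
        lemma : ∀ q → (ℕ→ℚ 5 + q * ℕ→ℚ 6) * - ⅔ + (ℕ→ℚ 3 + q * ℕ→ℚ 4) ≡ - ⅓
        lemma = solve-∀ ℚ-ring
      p/3 : p / 3 ≡ 1 ℕ.+ 2 ℕ.* q
      p/3 = trans (cong (_/ 3) (trans p≡ (cong (5 ℕ.+_) (trans (sym (ℕ.*-assoc q 2 3)) (cong (ℕ._* 3) (ℕ.*-comm q 2)))))) ([r+k*d]/d≡r/d+k 5 (2 ℕ.* q) 3)
      sign : sgn (3 ℕ.+ q ℕ.* 4) ≡ sgn (p / 3)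
      sign = trans (cong (λ k → sgn (3 ℕ.+ k)) (trans (sym (ℕ.*-assoc q 2 2)) (ℕ.*-comm (q ℕ.* 2) 2)))
        (trans (sgn-+2* 3 (q ℕ.* 2)) (sym (trans (cong sgn p/3) (sgn-+2* 1 q))))

  quarter : S (- ¼) ≈ sgn (p / 4) * π + ℕ→ℚ 13 * π ^Q 3 * sQ n [ 4 ]
  quarter = [ case₁ , case₂ ]′ (odd-mod-4 l)
    where
    Goal : Set
    Goal = S (- ¼) ≈ sgn (p / 4) * π + ℕ→ℚ 13 * π ^Q 3 * sQ n [ 4 ]
    case₁ : (∃ λ q → p ≡ 1 ℕ.+ q ℕ.* 4) → Goal
    case₁ (q , p≡) = specialise {x = - ¼} {c = - ¼} q _ ((+ 13) ℚ./ 16) (ℕ→ℚ 13) (sQ n) refl r<p (int-neg int-¼) x≡ (cong sgn (sym p/4)) euler-quarter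
      where
      r<p : q < p
      r<p = subst (q <_) (sym p≡) (s≤s (ℕ.m≤m*n q 4))
      x≡ : π * - ¼ + ℕ→ℚ q ≡ - ¼
      x≡ = trans (cong (λ x → x * - ¼ + ℕ→ℚ q) (trans (cong ℕ→ℚ p≡) (ℕ→ℚ-affine 1 q 4))) (lemma (ℕ→ℚ q))
        where
        lemma : ∀ q → (ℕ→ℚ 1 + q * ℕ→ℚ 4) * - ¼ + q ≡ - ¼
        lemma = solve-∀ ℚ-ring
      p/4 : p / 4 ≡ q
      p/4 = trans (cong (_/ 4) p≡) ([r+k*d]/d≡r/d+k 1 q 4)
    case₂ : (∃ λ q → p ≡ 3 ℕ.+ q ℕ.* 4) → Goal
    -- -1/4 = -3p/4 + (3q + 2) for p = 4q + 3; the residue has the parity of q = [p/4].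
    case₂ (q , p≡) = specialise {x = - ¼} {c = - ((+ 3) ℚ./ 4)} (2 ℕ.+ q ℕ.* 3) _ ((+ 13) ℚ./ 16) (ℕ→ℚ 13) (sQ n) refl r<p (int-neg (int-* (int-ℕ 3) int-¼)) x≡ sign euler-quarter
      where
      r<p : 2 ℕ.+ q ℕ.* 3 < p
      r<p = subst (2 ℕ.+ q ℕ.* 3 <_) (sym p≡) (ℕ.+-monoʳ-≤ 3 (ℕ.*-monoʳ-≤ q (s≤s (s≤s (s≤s z≤n)))))
      x≡ : π * - ((+ 3) ℚ./ 4) + ℕ→ℚ (2 ℕ.+ q ℕ.* 3) ≡ - ¼
      x≡ = trans (cong₂ (λ x y → x * - ((+ 3) ℚ./ 4) + y) (trans (cong ℕ→ℚ p≡) (ℕ→ℚ-affine 3 q 4)) (ℕ→ℚ-affine 2 q 3)) (lemma (ℕ→ℚ q))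
        where
        lemma : ∀ q → (ℕ→ℚ 3 + q * ℕ→ℚ 4) * - ((+ 3) ℚ./ 4) + (ℕ→ℚ 2 + q * ℕ→ℚ 3) ≡ - ¼
        lemma = solve-∀ ℚ-ring
      sign : sgn (2 ℕ.+ q ℕ.* 3) ≡ sgn (p / 4)
      sign = trans (sgn-2+ (q ℕ.* 3)) (trans (cong sgn (ℕ.*-suc q 2)) (trans (cong (λ k → sgn (q ℕ.+ k)) (ℕ.*-comm q 2)) (trans (sgn-+2* q q)
        (cong sgn (sym (trans (cong (_/ 4) p≡) ([r+k*d]/d≡r/d+k 3 q 4)))))))

  sixth : S (- ⅙) ≈ sgn ((p ∸ 1) / 2) * π + ((+ 155) ℚ./ 9) * π ^Q 3 * eulerQ n [ 4 ]
  sixth = [ case₁ , case₂ ]′ (prime>3-mod-6 pp (s≤s 2<m))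
    where
    Goal : Set
    Goal = S (- ⅙) ≈ sgn ((p ∸ 1) / 2) * π + ((+ 155) ℚ./ 9) * π ^Q 3 * eulerQ n [ 4 ]
    case₁ : (∃ λ q → p ≡ 1 ℕ.+ q ℕ.* 6) → Goal
    -- For p = 6q + 1 the residue is q, and (p - 1)/2 = 3q has the same parity.
    case₁ (q , p≡) = specialise {x = - ⅙} {c = - ⅙} q _ ((+ 31) ℚ./ 36) ((+ 155) ℚ./ 9) (eulerQ n) refl r<p (int-neg int-⅙) x≡ sign euler-sixth-≈
      where
      r<p : q < p
      r<p = subst (q <_) (sym p≡) (s≤s (ℕ.m≤m*n q 6))
      x≡ : π * - ⅙ + ℕ→ℚ q ≡ - ⅙
      x≡ = trans (cong (λ x → x * - ⅙ + ℕ→ℚ q) (trans (cong ℕ→ℚ p≡) (ℕ→ℚ-affine 1 q 6))) (lemma (ℕ→ℚ q))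
        where
        lemma : ∀ q → (ℕ→ℚ 1 + q * ℕ→ℚ 6) * - ⅙ + q ≡ - ⅙
        lemma = solve-∀ ℚ-ring
      half : (p ∸ 1) / 2 ≡ q ℕ.+ 2 ℕ.* q
      half = trans (cong (λ k → (k ∸ 1) / 2) (trans p≡ (cong suc (sym (ℕ.*-assoc q 3 2))))) (trans (m*n/n≡m (q ℕ.* 3) 2) (ℕ.*-comm q 3))
      sign : sgn q ≡ sgn ((p ∸ 1) / 2)
      sign = sym (trans (cong sgn half) (sgn-+2* q q))
    case₂ : (∃ λ q → p ≡ 5 ℕ.+ q ℕ.* 6) → Goal
    -- -1/6 = -5p/6 + (5q + 4) for p = 6q + 5; the residue and (p - 1)/2 = 3q + 2 both have the
    -- parity of q.
    case₂ (q , p≡) = specialise {x = - ⅙} {c = - ((+ 5) ℚ./ 6)} (4 ℕ.+ q ℕ.* 5) _ ((+ 31) ℚ./ 36) ((+ 155) ℚ./ 9) (eulerQ n) refl r<p (int-neg (int-* (int-ℕ 5) int-⅙)) x≡ sign euler-sixth-≈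
      where
      r<p : 4 ℕ.+ q ℕ.* 5 < p
      r<p = subst (4 ℕ.+ q ℕ.* 5 <_) (sym p≡) (ℕ.+-monoʳ-≤ 5 (ℕ.*-monoʳ-≤ q (s≤s (s≤s (s≤s (s≤s (s≤s z≤n)))))))
      x≡ : π * - ((+ 5) ℚ./ 6) + ℕ→ℚ (4 ℕ.+ q ℕ.* 5) ≡ - ⅙
      x≡ = trans (cong₂ (λ x y → x * - ((+ 5) ℚ./ 6) + y) (trans (cong ℕ→ℚ p≡) (ℕ→ℚ-affine 5 q 6)) (ℕ→ℚ-affine 4 q 5)) (lemma (ℕ→ℚ q))
        where
        lemma : ∀ q → (ℕ→ℚ 5 + q * ℕ→ℚ 6) * - ((+ 5) ℚ./ 6) + (ℕ→ℚ 4 + q * ℕ→ℚ 5) ≡ - ⅙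
        lemma = solve-∀ ℚ-ring
      half : (p ∸ 1) / 2 ≡ 2 ℕ.+ (q ℕ.+ 2 ℕ.* q)
      half = trans (cong (λ k → (k ∸ 1) / 2) (trans p≡ (cong (5 ℕ.+_) (sym (ℕ.*-assoc q 3 2))))) (trans ([r+k*d]/d≡r/d+k 4 (q ℕ.* 3) 2) (cong (2 ℕ.+_) (ℕ.*-comm q 3)))
      5q : q ℕ.* 5 ≡ q ℕ.+ 2 ℕ.* (q ℕ.* 2)
      5q = trans (ℕ.*-suc q 4) (cong (q ℕ.+_) (trans (sym (ℕ.*-assoc q 2 2)) (ℕ.*-comm (q ℕ.* 2) 2)))
      sign : sgn (4 ℕ.+ q ℕ.* 5) ≡ sgn ((p ∸ 1) / 2)
      sign = trans (trans (sgn-2+ (2 ℕ.+ q ℕ.* 5)) (sgn-2+ (q ℕ.* 5))) (trans (cong sgn 5q) (trans (sgn-+2* q (q ℕ.* 2))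
        (sym (trans (cong sgn half) (trans (sgn-2+ (q ℕ.+ 2 ℕ.* q)) (sgn-+2* q q))))))

-- In the theorem p is a variable; matching this equation with `refl` identifies `p ∸ 3` with the
-- even index n of `OddModulus`.
OddAbove3 : ℕ → Set
OddAbove3 p = ∃ λ l → p ≡ 3 ℕ.+ 2 ℕ.* suc l

module _ {p : ℕ} (pp : Prime p) where

  open Congruence pp

  ΣV-general : OddAbove3 p → (x : ℚ) (r : ℕ) → r < p → CongZp p 1 x (ℕ→ℚ r) → let x′ = (x - ℕ→ℚ r) * invℕ p in
    CongZp p 4 (ΣQ p λ n → ℕ→ℚ (2 ℕ.* n ℕ.+ 1) * sgn n * V n x)
      (sgn r * π + π ^Q 3 * (x′ * (x′ + 1ℚ) + 1ℚ) * eulerPoly (p ∸ 3) (- x))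
  ΣV-general (l , refl) = OddModulus.general l pp

  ΣV-third : OddAbove3 p → (ΣQ p λ n → ℕ→ℚ (2 ℕ.* n ℕ.+ 1) * sgn n * V n (- ⅓))
    ≈ sgn (p / 3) * π + ℕ→ℚ 7 * π ^Q 3 * UQ (p ∸ 3) [ 4 ]
  ΣV-third (l , refl) = OddModulus.third l pp

  ΣV-quarter : OddAbove3 p → (ΣQ p λ n → ℕ→ℚ (2 ℕ.* n ℕ.+ 1) * sgn n * V n (- ¼))
    ≈ sgn (p / 4) * π + ℕ→ℚ 13 * π ^Q 3 * sQ (p ∸ 3) [ 4 ]
  ΣV-quarter (l , refl) = OddModulus.quarter l pp

  ΣV-sixth : OddAbove3 p → (ΣQ p λ n → ℕ→ℚ (2 ℕ.* n ℕ.+ 1) * sgn n * V n (- ⅙))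
    ≈ sgn ((p ∸ 1) / 2) * π + ((+ 155) ℚ./ 9) * π ^Q 3 * eulerQ (p ∸ 3) [ 4 ]
  ΣV-sixth (l , refl) = OddModulus.sixth l pp

theorem4p6 : (p : ℕ) → Prime p → 3 < p →
    ((x : ℚ) → InZp p x → (r : ℕ) → r < p → CongZp p 1 x (ℕ→ℚ r) →
    let x′ = (x ℚ.- ℕ→ℚ r) ℚ.* invℕ p in
    CongZp p 4
    (ΣQ p λ n → ℕ→ℚ (2 ℕ.* n ℕ.+ 1) ℚ.* sgn n ℚ.* V n x)
    (sgn r ℚ.* ℕ→ℚ p ℚ.+ (ℕ→ℚ p ^Q 3) ℚ.* (x′ ℚ.* (x′ ℚ.+ ℚ.1ℚ) ℚ.+ ℚ.1ℚ) ℚ.* eulerPoly (p ∸ 3) (ℚ.- x)))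
    × CongZp p 4
    (ΣQ p λ n → ℕ→ℚ (2 ℕ.* n ℕ.+ 1) ℚ.* V3 n ℚ.* (((ℤ.- + 1) ℚ./ 27) ^Q n))
    (sgn (p / 3) ℚ.* ℕ→ℚ p ℚ.+ ℕ→ℚ 7 ℚ.* (ℕ→ℚ p ^Q 3) ℚ.* ℤ→ℚ (U (p ∸ 3)))
    × CongZp p 4
    (ΣQ p λ n → ℕ→ℚ (2 ℕ.* n ℕ.+ 1) ℚ.* V4 n ℚ.* (((ℤ.- + 1) ℚ./ 64) ^Q n))
    (sgn (p / 4) ℚ.* ℕ→ℚ p ℚ.+ ℕ→ℚ 13 ℚ.* (ℕ→ℚ p ^Q 3) ℚ.* ℤ→ℚ (s (p ∸ 3)))
    × CongZp p 4
    (ΣQ p λ n → ℕ→ℚ (2 ℕ.* n ℕ.+ 1) ℚ.* V6 n ℚ.* (((ℤ.- + 1) ℚ./ 432) ^Q n))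
    (sgn ((p ∸ 1) / 2) ℚ.* ℕ→ℚ p ℚ.+ ((+ 155) ℚ./ 9) ℚ.* (ℕ→ℚ p ^Q 3) ℚ.* ℤ→ℚ (eulerNum (p ∸ 3)))
theorem4p6 p pp 3<p =
  (λ x _ → ΣV-general pp odd x) ,
  -- 27 · (-1/27) = -1 holds by computation, so dividing by (-27)ⁿ leaves the sign (-1)ⁿ; likewise
  -- for 64 and 432.
  ≈⇒CongZp (≈-trans (≈-reflexive (twist p (ℕ→ℚ 27) ((ℤ.- + 1) ℚ./ 27) (- ⅓) refl)) (ΣV-third pp odd)) ,
  ≈⇒CongZp (≈-trans (≈-reflexive (twist p (ℕ→ℚ 64) ((ℤ.- + 1) ℚ./ 64) (- ¼) refl)) (ΣV-quarter pp odd)) ,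
  ≈⇒CongZp (≈-trans (≈-reflexive (twist p (ℕ→ℚ 432) ((ℤ.- + 1) ℚ./ 432) (- ⅙) refl)) (ΣV-sixth pp odd))
  where
  open Congruence pp
  odd : OddAbove3 p
  odd = prime>3⇒odd pp 3<p
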